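{- Let $(R,\Phi)$ be a form ring for which the Weight Enumerator Conjecture holds, let $\rho=(V,\rho_M,\rho_\Phi,\beta)$ be a finite representation of $(R,\Phi)$, and let $N\ge1$. Let $C_1,\ldots,C_{t_N}$ be a complete list of the self-dual isotropic codes in $\rho^{(N,N)}$. Then $$\big(\varphi(\mathrm{fwe}^{(N,N)}(C_1)),\ldots,\varphi(\mathrm{fwe}^{(N,N)}(C_{t_N}))\big)$$ is a generating set of the $\mathbb C$-vector space $\mathrm{End}_{\mathcal C(\rho)}(\mathbb CV^N)$, the algebra of endomorphisms of $\mathbb CV^N=\otimes^N\mathbb CV$ commuting with the diagonal action of the Clifford-Weil group $\mathcal C(\rho)$.
   Context: **Form rings.** For a ring $R$ (unital, associative), an $R$-qmodule is an abelian group $\Phi$ with a map $[\,]:R\to\mathrm{End}_{\mathbb Z}(\Phi)$ (written on the right, $\phi\mapsto\phi[r]$) that is pointed quadratic ($[0]=0$ and $(r,s)\mapsto[r+s]-[r]-[s]$ is biadditive) with $[1]=1$, $[rs]=[r][s]$. A right $R\otimes R$-module $M$ is a qmodule via $m[r]=m(r\otimes r)$; qmodule homomorphisms are additive maps commuting with all $[r]$. A form ring $(R,M,\psi,\Phi)$ consists of a ring $R$, a right $R\otimes R$-module $M$, an isomorphism of right $R$-modules $\psi:R_R\to M_{1\otimes R}$, an additive involution $\tau:M\to M$ with $\tau(m)(s\otimes r)=\tau(m(r\otimes s))$ such that $\psi^{ -1}(\tau(\psi(1)))$ is a unit of $R$, an $R$-qmodule $\Phi$, and qmodule homomorphisms $\{\!\{\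 \}\!\}:M\to\Phi$, $\lambda:\Phi\to M$ with $\{\!\{\tau(m)\}\!\}=\{\!\{m\}\!\}$, $\tau(\lambda(\phi))=\lambda(\phi)$, $\lambda(\{\!\{m\}\!\})=m+\tau(m)$, $\{\!\{\lambda(\phi)(r\otimes s)\}\!\}=\phi[r+s]-\phi[r]-\phi[s]$. It is abbreviated $(R,\Phi)$. The map $r^J:=\psi^{ -1}(\psi(1)(r\otimes1))$ is an anti-automorphism of $R$. **Representations.** A finite representation $\rho=(V,\rho_M,\rho_\Phi,\beta)$ of $(R,\Phi)$ consists of a finite left $R$-module $V$; an $R\otimes R$-module homomorphism $\rho_M$ from $M$ to the group $\mathrm{Bil}(V)$ of biadditive maps $V\times V\to\mathbb Q/\mathbb Z$ (where $(b(r\otimes s))(x,y)=b(rx,sy)$) with $\rho_M(\tau(m))(x,y)=\rho_M(m)(y,x)$ and such that $\beta:=\rho_M(\psi(1))$ is non-singular; and a qmodule homomorphism $\rho_\Phi$ from $\Phi$ to the group of $\mathbb Q/\mathbb Z$-valued (pointed) quadratic maps on $V$ (where $(q[r])(x)=q(rx)$) with $\rho_\Phi(\{\!\{m\}\!\})(x)=\rho_M(m)(x,x)$ and $\rho_M(\lambda(\phi))(x,y)=\rho_\Phi(\phi)(x+y)-\rho_\Phi(\phi)(x)-\rho_\Phi(\phi)(y)$. **Codes.** A code in $\rho$ is an $R$-submodule $C\le V$; $C^\perp=\{x\in V\mid\beta(x,c)=0\ \forall c\in C\}$; $C$ is self-dual if $C=C^\perp$; a code $C\subseteq C^\perp$ is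 isotropic if $\rho_\Phi(\phi)(C)=\{0\}$ for all $\phi\in\Phi$. A code of Type $\rho$ is a self-dual isotropic code in $\rho$. **The representation $\rho^{(N,N)}$.** This is the finite representation of $(R,\Phi)$ on $V^{2N}=V^N\times V^N$ in which $\rho_M(m)$, $\rho_\Phi(\phi)$, $\beta$ are replaced by the orthogonal sums of $N$ copies of the original and $N$ copies of its negative, e.g. the quadratic maps are $(x,y)\mapsto\sum_{i=1}^N\rho_\Phi(\phi)(x_i)-\sum_{i=1}^N\rho_\Phi(\phi)(y_i)$ and the form is $((x,y),(x',y'))\mapsto\sum_{i=1}^N\beta(x_i,x'_i)-\sum_{i=1}^N\beta(y_i,y_i')$. **Clifford-Weil group.** An idempotent $\iota\in R$ is symmetric if $\iota R\cong\iota^JR$ as right $R$-modules; then one fixes $v_\iota\in\iota^JR\iota$, $u_\iota\in\iota R\iota^J$ with $u_\iota v_\iota=\iota$, $v_\iota u_\iota=\iota^J$. For a finite representation $\rho$ on $V$, let $\mathbb CV$ have basis $(b_w:w\in V)$. The Clifford-Weil group $\mathcal C(\rho)$ is the group of linear operators on $\mathbb CV$ generated by $m_r:b_w\mapsto b_{rw}$ ($r\in R^\times$), $d_\phi:b_w\mapsto\exp(2\pi i\rho_\Phi(\phi)(w))\,b_w$ ($\phi\in\Phi$), and $h_{\iota,u_\iota,v_\iota}:b_w\mapsto|\iota V|^{ -1/2}\sum_{u\in\iota V}\exp(2\pi i\beta(u,v_\iota w))\,b_{u+(1-\iota)w}$, where $\iota$ runs through representatives of the $R^\times$-conjugacy classes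 of symmetric idempotents of $R$. **Weight Enumerator Conjecture.** For a code $C$ in $\rho$ let $\mathrm{fwe}(C)=\sum_{c\in C}b_c\in\mathbb CV$. The Weight Enumerator Conjecture holds for $(R,\Phi)$ if for every finite representation $\rho'$ of $(R,\Phi)$, with underlying module $V'$, the subspace of $\mathbb CV'$ fixed by $\mathcal C(\rho')$ is spanned by the $\mathrm{fwe}(C)$, $C$ a code of Type $\rho'$. **The map $\varphi$.** Put $W_N=\mathbb CV^N=\otimes^N\mathbb CV$ (group algebra of $V^N$, basis $b_x$, $x\in V^N$) and $W_N^*=\mathrm{Hom}(W_N,\mathbb C)$ with dual basis $b_y^*$. Let $\varphi:W_N\otimes W_N^*\to\mathrm{End}_{\mathbb C}(W_N)$ be the isomorphism $w\otimes f\mapsto(x\mapsto f(x)w)$. For a code $C\le V^N\times V^N$ in $\rho^{(N,N)}$, $\mathrm{fwe}^{(N,N)}(C)=\sum_{(x,y)\in C}b_{(x,y)}$ is regarded as the element $\sum_{(x,y)\in C}b_x\otimes b_y^*$ of $W_N\otimes W_N^*$. -}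

module Defs where

open import Algebra.Bundles using (AbelianGroup; CommutativeMonoid; CommutativeRing; Ring)
open import Algebra.Apartness.Bundles using (HeytingCommutativeRing; HeytingField)
open import Algebra.Module.Bundles using (LeftModule)
open import Algebra.Module.Bundles.Raw using (RawRightModule)
open import Algebra.Module.Morphism.Structures using (IsLeftModuleHomomorphism; IsRightModuleIsomorphism)
open import Algebra.Morphism.Structures using (module GroupMorphisms)
open import Data.Bool.Base using (if_then_else_)
open import Data.Fin.Base using (Fin; zero; suc; combine; remQuot; finToFun; funToFin)
import Data.Fin.Properties as Fin
open import Data.Integer.Base as ℤ using (ℤ)
import Data.Integer.Properties as ℤ
open import Data.List.Base as List using (List; []; _∷_)
open import Data.Nat.Base as ℕ using (ℕ; zero; suc)
import Data.Nat.Properties as ℕ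
open import Data.Product.Base using (Σ; ∃; ∃-syntax; Σ-syntax; _×_; _,_; proj₁; proj₂)
open import Data.Rational.Base as ℚ using (ℚ; ↥_; ↧ₙ_)
import Data.Rational.Properties as ℚ
open import Data.Sum.Base using (_⊎_; inj₂)
open import Function.Base using (_∘_; id)
open import Function.Bundles using (Equivalence; Func; Inverse; _⟨$⟩_; _⇔_)
open import Level using (0ℓ; _⊔_)
open import Relation.Binary.Bundles using (Setoid)
open import Relation.Binary.Core using (Rel)
open import Relation.Binary.PropositionalEquality as ≡ using (_≡_)
open import Relation.Binary.Structures using (IsStrictPartialOrder)
open import Relation.Nullary using (¬_; Dec; does; yes; no)
open import Relation.Nullary.Negation using (contradiction)
open import Relation.Unary using (Pred; Decidable; _⊆_; _≐_)
import Algebra.Construct.DirectProduct as ×-Algebra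
import Algebra.Module.Construct.DirectProduct as ×-Module
import Algebra.Module.Construct.TensorUnit as TensorUnit
import Algebra.Morphism.Construct.Composition as Composition
import Algebra.Properties.AbelianGroup
import Algebra.Properties.CommutativeMonoid.Sum
import Algebra.Properties.Monoid.Mult
import Algebra.Properties.Ring
import Algebra.Solver.CommutativeMonoid
import Algebra.Solver.Ring.NaturalCoefficients.Default
import Data.Vec.Functional as Vector
import Data.Vec.Functional.Relation.Binary.Equality.Setoid
import Relation.Binary.Reasoning.Setoid

Ab : Set₁
Ab = AbelianGroup 0ℓ 0ℓ

module +Notation (A : Ab) where
  open AbelianGroup A public
    using (Carrier; _≈_; setoid; refl; sym; trans; assoc; comm; identityˡ; identityʳ; inverseˡ; inverseʳ)
    renaming (_∙_ to infixl 6 _+_; ε to 0#; _⁻¹ to infix 8 -_; ∙-cong to +-cong; ⁻¹-cong to -‿cong)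

  infixl 6 _-_
  _-_ : Carrier → Carrier → Carrier
  x - y = x + (- y)

record Additive (A B : Ab) (f : AbelianGroup.Carrier A → AbelianGroup.Carrier B) : Set where
  open GroupMorphisms (AbelianGroup.rawGroup A) (AbelianGroup.rawGroup B)
  field
    isGroupHomomorphism : IsGroupHomomorphism f

  open IsGroupHomomorphism isGroupHomomorphism public
    using () renaming (⟦⟧-cong to cong; homo to +-homo; ε-homo to 0-homo; ⁻¹-homo to -‿homo)

module _ {A B : Ab} where
  private
    module A = +Notation A
    module B = +Notation B
    open Relation.Binary.Reasoning.Setoid B.setoid
    open Algebra.Properties.AbelianGroup B

  mkAdditive : ∀ {f} → (∀ {x y} → x A.≈ y → f x B.≈ f y) →
               (∀ x y → f (x A.+ y) B.≈ f x B.+ f y) → Additive A B f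
  mkAdditive {f} f-cong f-homo = record { isGroupHomomorphism = record
    { isMonoidHomomorphism = record
      { isMagmaHomomorphism = record
        { isRelHomomorphism = record { cong = f-cong }
        ; homo = f-homo
        }
      ; ε-homo = ε-homo
      }
    ; ⁻¹-homo = λ x → inverseˡ-unique (f (A.- x)) (f x)
        (B.trans (B.sym (f-homo _ x)) (B.trans (f-cong (A.inverseˡ x)) ε-homo))
    } }
    where
    ε-homo : f A.0# B.≈ B.0#
    ε-homo = begin
      f A.0#                               ≈⟨ B.identityʳ _ ⟨
      f A.0# B.+ B.0#                      ≈⟨ B.+-cong B.refl (B.inverseʳ (f A.0#)) ⟨
      f A.0# B.+ (f A.0# B.- f A.0#)       ≈⟨ B.assoc _ _ _ ⟨
      f A.0# B.+ f A.0# B.- f A.0#         ≈⟨ B.+-cong (f-homo _ _) B.refl ⟨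
      f (A.0# A.+ A.0#) B.- f A.0#         ≈⟨ B.+-cong (f-cong (A.identityˡ _)) B.refl ⟩
      f A.0# B.- f A.0#                    ≈⟨ B.inverseʳ _ ⟩
      B.0#                                 ∎

  interchange : ∀ a b c d → (a B.+ b) B.+ (c B.+ d) B.≈ (a B.+ c) B.+ (b B.+ d)
  interchange = solve 4 (λ a b c d → (a ⊕ b) ⊕ (c ⊕ d) ⊜ (a ⊕ c) ⊕ (b ⊕ d)) B.refl
    where open Algebra.Solver.CommutativeMonoid (AbelianGroup.commutativeMonoid B)

  0-additive : Additive A B (λ _ → B.0#)
  0-additive = mkAdditive (λ _ → B.refl) (λ _ _ → B.sym (B.identityˡ _))

  +-additive : ∀ {f g} → Additive A B f → Additive A B g → Additive A B (λ x → f x B.+ g x)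
  +-additive {f} {g} F G = mkAdditive
    (λ e → B.+-cong (Additive.cong F e) (Additive.cong G e))
    (λ x y → B.trans (B.+-cong (Additive.+-homo F x y) (Additive.+-homo G x y)) (interchange (f x) (f y) (g x) (g y)))

  neg-additive : ∀ {f} → Additive A B f → Additive A B (λ x → B.- f x)
  neg-additive F = mkAdditive (λ e → B.-‿cong (Additive.cong F e))
    (λ x y → B.trans (B.-‿cong (Additive.+-homo F x y)) (B.sym (⁻¹-∙-comm _ _)))

  ≈-additive : ∀ {f g} → Additive A B f → (∀ x → f x B.≈ g x) → Additive A B g
  ≈-additive F f≈g = mkAdditive
    (λ e → B.trans (B.sym (f≈g _)) (B.trans (Additive.cong F e) (f≈g _)))
    (λ x y → B.trans (B.sym (f≈g _)) (B.trans (Additive.+-homo F x y) (B.+-cong (f≈g x) (f≈g y))))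

∘-additive : ∀ {A B C : Ab} {f g} → Additive B C g → Additive A B f → Additive A C (g ∘ f)
∘-additive {C = C} G F = record { isGroupHomomorphism = Composition.isGroupHomomorphism
  (AbelianGroup.trans C) (Additive.isGroupHomomorphism F) (Additive.isGroupHomomorphism G) }

module _ (A B C : Ab) where
  private
    module A = AbelianGroup A
    module B = AbelianGroup B
    module C = AbelianGroup C

  record IsBiadditive (f : A.Carrier → B.Carrier → C.Carrier) : Set where
    field
      additiveˡ : ∀ y → Additive A C (λ x → f x y)
      additiveʳ : ∀ x → Additive B C (f x)

    cong₂ : ∀ {x x′ y y′} → x A.≈ x′ → y B.≈ y′ → f x y C.≈ f x′ y′
    cong₂ e e′ = C.trans (Additive.cong (additiveˡ _) e) (Additive.cong (additiveʳ _) e′)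

module _ (A B : Ab) where
  private
    module A = +Notation A
    module B = +Notation B

  polar : (A.Carrier → B.Carrier) → A.Carrier → A.Carrier → B.Carrier
  polar q x y = q (x A.+ y) B.- q x B.- q y

  record IsPointedQuadratic (q : A.Carrier → B.Carrier) : Set where
    field
      cong             : ∀ {x y} → x A.≈ y → q x B.≈ q y
      pointed          : q A.0# B.≈ B.0#
      polar-biadditive : IsBiadditive A A B (polar q)

module _ {A B C : Ab} where
  private module C = +Notation C

  0-biadditive : IsBiadditive A B C (λ _ _ → C.0#)
  0-biadditive = record { additiveˡ = λ _ → 0-additive ; additiveʳ = λ _ → 0-additive }

  +-biadditive : ∀ {f g} → IsBiadditive A B C f → IsBiadditive A B C g →
                 IsBiadditive A B C (λ x y → f x y C.+ g x y)
  +-biadditive F G = record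
    { additiveˡ = λ y → +-additive (F.additiveˡ y) (G.additiveˡ y)
    ; additiveʳ = λ x → +-additive (F.additiveʳ x) (G.additiveʳ x)
    }
    where
    module F = IsBiadditive F
    module G = IsBiadditive G

  neg-biadditive : ∀ {f} → IsBiadditive A B C f → IsBiadditive A B C (λ x y → C.- f x y)
  neg-biadditive F = record
    { additiveˡ = λ y → neg-additive (F.additiveˡ y)
    ; additiveʳ = λ x → neg-additive (F.additiveʳ x)
    }
    where
    module F = IsBiadditive F

  ≈-biadditive : ∀ {f g} → IsBiadditive A B C f → (∀ x y → f x y C.≈ g x y) → IsBiadditive A B C g
  ≈-biadditive F f≈g = record
    { additiveˡ = λ y → ≈-additive (F.additiveˡ y) (λ x → f≈g x y)
    ; additiveʳ = λ x → ≈-additive (F.additiveʳ x) (f≈g x)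
    }
    where
    module F = IsBiadditive F

∘-biadditive : ∀ {A A′ B B′ C : Ab} {f g h} → IsBiadditive A B C f → Additive A′ A g → Additive B′ B h →
               IsBiadditive A′ B′ C (λ x y → f (g x) (h y))
∘-biadditive F G H = record
  { additiveˡ = λ y → ∘-additive (F.additiveˡ _) G
  ; additiveʳ = λ x → ∘-additive (F.additiveʳ _) H
  }
  where
  module F = IsBiadditive F

module _ {A B : Ab} where
  private
    module A = +Notation A
    module B = +Notation B
    open Relation.Binary.Reasoning.Setoid B.setoid
    open Algebra.Properties.AbelianGroup B
    open Algebra.Solver.CommutativeMonoid (AbelianGroup.commutativeMonoid B)

  private
    ∸-cong : ∀ {a a′ b b′ c c′} → a B.≈ a′ → b B.≈ b′ → c B.≈ c′ → a B.- b B.- c B.≈ a′ B.- b′ B.- c′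
    ∸-cong p q r = B.+-cong (B.+-cong p (B.-‿cong q)) (B.-‿cong r)

  polar-cong : ∀ {f g} → (∀ x → f x B.≈ g x) → ∀ x y → polar A B f x y B.≈ polar A B g x y
  polar-cong e x y = ∸-cong (e _) (e x) (e y)

  polar-+ : ∀ f g x y → polar A B f x y B.+ polar A B g x y B.≈ polar A B (λ z → f z B.+ g z) x y
  polar-+ f g x y = begin
    (f (x A.+ y) B.- f x B.- f y) B.+ (g (x A.+ y) B.- g x B.- g y)
      ≈⟨ solve 6 (λ a b c d e h → ((a ⊕ b) ⊕ c) ⊕ ((d ⊕ e) ⊕ h) ⊜ ((a ⊕ d) ⊕ (b ⊕ e)) ⊕ (c ⊕ h)) B.refl _ _ _ _ _ _ ⟩
    (f (x A.+ y) B.+ g (x A.+ y)) B.+ (B.- f x B.+ B.- g x) B.+ (B.- f y B.+ B.- g y)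
      ≈⟨ B.+-cong (B.+-cong B.refl (⁻¹-∙-comm _ _)) (⁻¹-∙-comm _ _) ⟩
    polar A B (λ z → f z B.+ g z) x y ∎

  polar-neg : ∀ f x y → B.- polar A B f x y B.≈ polar A B (λ z → B.- f z) x y
  polar-neg f x y = begin
    B.- (f (x A.+ y) B.- f x B.- f y)            ≈⟨ ⁻¹-∙-comm _ _ ⟨
    B.- (f (x A.+ y) B.- f x) B.+ B.- (B.- f y)  ≈⟨ B.+-cong (B.sym (⁻¹-∙-comm _ _)) B.refl ⟩
    polar A B (λ z → B.- f z) x y                ∎

  0-quadratic : IsPointedQuadratic A B (λ _ → B.0#)
  0-quadratic = record
    { cong = λ _ → B.refl
    ; pointed = B.refl
    ; polar-biadditive = ≈-biadditive 0-biadditive λ x y → B.sym (begin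
        B.0# B.- B.0# B.- B.0#  ≈⟨ B.+-cong (B.inverseʳ _) ε⁻¹≈ε ⟩
        B.0# B.+ B.0#           ≈⟨ B.identityˡ _ ⟩
        B.0#                    ∎)
    }

  +-quadratic : ∀ {f g} → IsPointedQuadratic A B f → IsPointedQuadratic A B g →
                IsPointedQuadratic A B (λ x → f x B.+ g x)
  +-quadratic {f} {g} F G = record
    { cong = λ e → B.+-cong (F.cong e) (G.cong e)
    ; pointed = B.trans (B.+-cong F.pointed G.pointed) (B.identityˡ _)
    ; polar-biadditive = ≈-biadditive (+-biadditive F.polar-biadditive G.polar-biadditive) (polar-+ f g)
    }
    where
    module F = IsPointedQuadratic F
    module G = IsPointedQuadratic G

  neg-quadratic : ∀ {f} → IsPointedQuadratic A B f → IsPointedQuadratic A B (λ x → B.- f x)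
  neg-quadratic {f} F = record
    { cong = λ e → B.-‿cong (F.cong e)
    ; pointed = B.trans (B.-‿cong F.pointed) ε⁻¹≈ε
    ; polar-biadditive = ≈-biadditive (neg-biadditive F.polar-biadditive) (polar-neg f)
    }
    where
    module F = IsPointedQuadratic F

module _ {A A′ B : Ab} where
  private
    module A′ = +Notation A′
    module B = +Notation B

  polar-∘ : ∀ {q h} → IsPointedQuadratic A B q → Additive A′ A h →
            ∀ x y → polar A B q (h x) (h y) B.≈ polar A′ B (q ∘ h) x y
  polar-∘ Q H x y = B.+-cong (B.+-cong (IsPointedQuadratic.cong Q (AbelianGroup.sym A (Additive.+-homo H x y))) B.refl) B.refl

  ∘-quadratic : ∀ {q h} → IsPointedQuadratic A B q → Additive A′ A h → IsPointedQuadratic A′ B (q ∘ h)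
  ∘-quadratic Q H = record
    { cong = λ e → Q.cong (Additive.cong H e)
    ; pointed = B.trans (Q.cong (Additive.0-homo H)) Q.pointed
    ; polar-biadditive = ≈-biadditive (∘-biadditive Q.polar-biadditive H H) (polar-∘ Q H)
    }
    where
    module Q = IsPointedQuadratic Q

record QModule (R : Ring 0ℓ 0ℓ) : Set₁ where
  private module R = Ring R
  infixl 10 _[_]
  field
    abelianGroup : Ab
  open +Notation abelianGroup public
  field
    _[_]         : Carrier → R.Carrier → Carrier
    []-additive  : ∀ r → Additive abelianGroup abelianGroup (_[ r ])
    []-quadratic : ∀ φ → IsPointedQuadratic R.+-abelianGroup abelianGroup (φ [_])
    [1]          : ∀ φ → φ [ R.1# ] ≈ φ
    [*]          : ∀ φ r s → φ [ r R.* s ] ≈ φ [ r ] [ s ]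

-- By the universal property of R ⊗ R, the action of the ring R ⊗ R is the
-- same datum as the biadditive, multiplicative action of the pure tensors;
-- m · r ⊗ s stands for m(r ⊗ s).
record TensorModule (R : Ring 0ℓ 0ℓ) : Set₁ where
  private module R = Ring R
  infixl 10 _·_⊗_
  field
    abelianGroup : Ab
  open +Notation abelianGroup public
  field
    _·_⊗_        : Carrier → R.Carrier → R.Carrier → Carrier
    ·-additive   : ∀ r s → Additive abelianGroup abelianGroup (_· r ⊗ s)
    ⊗-biadditive : ∀ m → IsBiadditive R.+-abelianGroup R.+-abelianGroup abelianGroup (m ·_⊗_)
    ·-identity   : ∀ m → m · R.1# ⊗ R.1# ≈ m
    ·-assoc      : ∀ m r s r′ s′ → m · (r R.* r′) ⊗ (s R.* s′) ≈ m · r ⊗ s · r′ ⊗ s′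

record QHom {R : Ring 0ℓ 0ℓ} (Φ Ψ : QModule R) : Set where
  private
    module R = Ring R
    module Φ = QModule Φ
    module Ψ = QModule Ψ
  field
    to       : Φ.Carrier → Ψ.Carrier
    additive : Additive Φ.abelianGroup Ψ.abelianGroup to
    []-homo  : ∀ φ r → to (φ Φ.[ r ]) Ψ.≈ to φ Ψ.[ r ]

record TensorHom {R : Ring 0ℓ 0ℓ} (M N : TensorModule R) : Set where
  private
    module R = Ring R
    module M = TensorModule M
    module N = TensorModule N
  field
    to       : M.Carrier → N.Carrier
    additive : Additive M.abelianGroup N.abelianGroup to
    ·-homo   : ∀ m r s → to (m M.· r ⊗ s) N.≈ to m N.· r ⊗ s

asQModule : ∀ {R} → TensorModule R → QModule R
asQModule {R} M = record
  { abelianGroup = abelianGroup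
  ; _[_] = λ m r → m · r ⊗ r
  ; []-additive = λ r → ·-additive r r
  ; []-quadratic = λ m → let open IsBiadditive (⊗-biadditive m) in record
    { cong = λ e → cong₂ e e
    ; pointed = Additive.0-homo (additiveˡ _)
    ; polar-biadditive = ≈-biadditive
        (+-biadditive (⊗-biadditive m) (record { additiveˡ = additiveʳ ; additiveʳ = additiveˡ }))
        (expand m)
    }
  ; [1] = ·-identity
  ; [*] = λ m r s → ·-assoc m r r s s
  }
  where
  open TensorModule M
  module R = Ring R
  open Relation.Binary.Reasoning.Setoid setoid
  open Algebra.Properties.AbelianGroup abelianGroup using (xyx⁻¹≈y; ⁻¹-∙-comm)
  open Algebra.Solver.CommutativeMonoid (AbelianGroup.commutativeMonoid abelianGroup)

  expand : ∀ m r s → m · r ⊗ s + m · s ⊗ r ≈ m · (r R.+ s) ⊗ (r R.+ s) - m · r ⊗ r - m · s ⊗ s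
  expand m r s = begin
    m · r ⊗ s + m · s ⊗ r
      ≈⟨ xyx⁻¹≈y (m · r ⊗ r + m · s ⊗ s) (m · r ⊗ s + m · s ⊗ r) ⟨
    (m · r ⊗ r + m · s ⊗ s) + (m · r ⊗ s + m · s ⊗ r) - (m · r ⊗ r + m · s ⊗ s)
      ≈⟨ +-cong refl (⁻¹-∙-comm _ _) ⟨
    (m · r ⊗ r + m · s ⊗ s) + (m · r ⊗ s + m · s ⊗ r) + (- m · r ⊗ r + - m · s ⊗ s)
      ≈⟨ solve 6 (λ a b c d e f → ((a ⊕ b) ⊕ (c ⊕ d)) ⊕ (e ⊕ f) ⊜ (((a ⊕ d) ⊕ (c ⊕ b)) ⊕ e) ⊕ f) refl _ _ _ _ _ _ ⟩
    (m · r ⊗ r + m · s ⊗ r) + (m · r ⊗ s + m · s ⊗ s) - m · r ⊗ r - m · s ⊗ s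
      ≈⟨ +-cong (+-cong (+-cong (Additive.+-homo (additiveˡ r) r s) (Additive.+-homo (additiveˡ s) r s)) refl) refl ⟨
    m · (r R.+ s) ⊗ r + m · (r R.+ s) ⊗ s - m · r ⊗ r - m · s ⊗ s
      ≈⟨ +-cong (+-cong (Additive.+-homo (additiveʳ (r R.+ s)) r s) refl) refl ⟨
    m · (r R.+ s) ⊗ (r R.+ s) - m · r ⊗ r - m · s ⊗ s ∎
    where open IsBiadditive (⊗-biadditive m)

module _ (R : Ring 0ℓ 0ℓ) where
  open Ring R

  IsUnit : Carrier → Set
  IsUnit r = ∃[ s ] r * s ≈ 1# × s * r ≈ 1#

record FormRing : Set₁ where
  field
    R : Ring 0ℓ 0ℓ
    M : TensorModule R
    Φ : QModule R
  module R = Ring R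
  module M = TensorModule M
  module Φ = QModule Φ
  field
    ψ          : Inverse R.setoid M.setoid
    ψ-additive : Additive R.+-abelianGroup M.abelianGroup (Inverse.to ψ)
    ψ-linear   : ∀ r s → Inverse.to ψ (r R.* s) M.≈ Inverse.to ψ r M.· R.1# ⊗ s

    τ            : M.Carrier → M.Carrier
    τ-additive   : Additive M.abelianGroup M.abelianGroup τ
    τ-involutive : ∀ m → τ (τ m) M.≈ m
    τ-swap       : ∀ m r s → τ m M.· s ⊗ r M.≈ τ (m M.· r ⊗ s)
    τ-unit       : IsUnit R (Inverse.from ψ (τ (Inverse.to ψ R.1#)))

    brace : QHom (asQModule M) Φ
    lam   : QHom Φ (asQModule M)

  ⦃⦃_⦄⦄ : M.Carrier → Φ.Carrier
  ⦃⦃_⦄⦄ = QHom.to brace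

  λ[_] : Φ.Carrier → M.Carrier
  λ[_] = QHom.to lam

  field
    brace-τ   : ∀ m → ⦃⦃ τ m ⦄⦄ Φ.≈ ⦃⦃ m ⦄⦄
    τ-lam     : ∀ φ → τ λ[ φ ] M.≈ λ[ φ ]
    lam-brace : ∀ m → λ[ ⦃⦃ m ⦄⦄ ] M.≈ m M.+ τ m
    brace-lam : ∀ φ r s → ⦃⦃ λ[ φ ] M.· r ⊗ s ⦄⦄ Φ.≈ polar R.+-abelianGroup Φ.abelianGroup (φ Φ.[_]) r s

  ψ1 : M.Carrier
  ψ1 = Inverse.to ψ R.1#

  infix 10 _ᴶ
  _ᴶ : R.Carrier → R.Carrier
  r ᴶ = Inverse.from ψ (ψ1 M.· r ⊗ R.1#)

fromℤ : ℤ → ℚ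
fromℤ k = k ℚ./ 1

fromℤ-+ : ∀ k l → fromℤ (k ℤ.+ l) ≡ fromℤ k ℚ.+ fromℤ l
fromℤ-+ k l = ℚ.toℚᵘ-injective (begin
  ℚ.toℚᵘ (fromℤ (k ℤ.+ l))             ≈⟨ ℚ.toℚᵘ-fromℚᵘ (mkℚᵘ (k ℤ.+ l) 0) ⟩
  mkℚᵘ (k ℤ.+ l) 0                     ≈⟨ *≡* (≡.cong (ℤ._* ℤ.1ℤ) (≡.cong₂ ℤ._+_ (≡.sym (ℤ.*-identityʳ k)) (≡.sym (ℤ.*-identityʳ l)))) ⟩
  mkℚᵘ k 0 ℚᵘ.+ mkℚᵘ l 0               ≈⟨ ℚᵘ.+-cong (ℚ.toℚᵘ-fromℚᵘ (mkℚᵘ k 0)) (ℚ.toℚᵘ-fromℚᵘ (mkℚᵘ l 0)) ⟨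
  ℚ.toℚᵘ (fromℤ k) ℚᵘ.+ ℚ.toℚᵘ (fromℤ l) ≈⟨ ℚ.toℚᵘ-homo-+ (fromℤ k) (fromℤ l) ⟨
  ℚ.toℚᵘ (fromℤ k ℚ.+ fromℤ l)         ∎)
  where
  open import Data.Rational.Unnormalised.Base as ℚᵘ using (mkℚᵘ; *≡*)
  import Data.Rational.Unnormalised.Properties as ℚᵘ
  open Relation.Binary.Reasoning.Setoid ℚᵘ.≃-setoid

fromℤ-neg : ∀ k → fromℤ (ℤ.- k) ≡ ℚ.- fromℤ k
fromℤ-neg k = inverseˡ-unique _ _ (≡.trans (≡.sym (fromℤ-+ (ℤ.- k) k)) (≡.cong fromℤ (ℤ.+-inverseˡ k)))
  where open Algebra.Properties.AbelianGroup ℚ.+-0-abelianGroup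

infix 4 _≡ℤ_
record _≡ℤ_ (p q : ℚ) : Set where
  constructor shift
  field
    difference : ℤ
    equality   : p ≡ q ℚ.+ fromℤ difference

ℚ/ℤ : Ab
ℚ/ℤ = record
  { Carrier = ℚ
  ; _≈_ = _≡ℤ_
  ; _∙_ = ℚ._+_
  ; ε = ℚ.0ℚ
  ; _⁻¹ = ℚ.-_
  ; isAbelianGroup = record
    { isGroup = record
      { isMonoid = record
        { isSemigroup = record
          { isMagma = record
            { isEquivalence = record { refl = lift ≡.refl ; sym = ≡ℤ-sym ; trans = ≡ℤ-trans }
            ; ∙-cong = ≡ℤ-+
            }
          ; assoc = λ p q r → lift (ℚ.+-assoc p q r)
          }
        ; identity = (λ p → lift (ℚ.+-identityˡ p)) , (λ p → lift (ℚ.+-identityʳ p))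
        }
      ; inverse = (λ p → lift (ℚ.+-inverseˡ p)) , (λ p → lift (ℚ.+-inverseʳ p))
      ; ⁻¹-cong = ≡ℤ-neg
      }
    ; comm = λ p q → lift (ℚ.+-comm p q)
    }
  }
  where
  open ≡.≡-Reasoning
  open Algebra.Properties.AbelianGroup ℚ.+-0-abelianGroup using (⁻¹-∙-comm)

  lift : ∀ {p q} → p ≡ q → p ≡ℤ q
  lift {p} ≡.refl = shift ℤ.0ℤ (≡.sym (ℚ.+-identityʳ p))

  ≡ℤ-sym : ∀ {p q} → p ≡ℤ q → q ≡ℤ p
  ≡ℤ-sym {_} {q} (shift k ≡.refl) = shift (ℤ.- k) (begin
    q                                    ≡⟨ ℚ.+-identityʳ q ⟨
    q ℚ.+ ℚ.0ℚ                           ≡⟨ ≡.cong (q ℚ.+_) (ℚ.+-inverseʳ (fromℤ k)) ⟨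
    q ℚ.+ (fromℤ k ℚ.- fromℤ k)          ≡⟨ ℚ.+-assoc q _ _ ⟨
    q ℚ.+ fromℤ k ℚ.- fromℤ k            ≡⟨ ≡.cong (q ℚ.+ fromℤ k ℚ.+_) (fromℤ-neg k) ⟨
    q ℚ.+ fromℤ k ℚ.+ fromℤ (ℤ.- k)      ∎)

  ≡ℤ-trans : ∀ {p q r} → p ≡ℤ q → q ≡ℤ r → p ≡ℤ r
  ≡ℤ-trans {r = r} (shift k ≡.refl) (shift l ≡.refl) =
    shift (l ℤ.+ k) (≡.trans (ℚ.+-assoc r _ _) (≡.cong (r ℚ.+_) (≡.sym (fromℤ-+ l k))))

  ≡ℤ-+ : ∀ {p p′ q q′} → p ≡ℤ p′ → q ≡ℤ q′ → p ℚ.+ q ≡ℤ p′ ℚ.+ q′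
  ≡ℤ-+ {_} {p′} {_} {q′} (shift k ≡.refl) (shift l ≡.refl) = shift (k ℤ.+ l) (begin
    (p′ ℚ.+ fromℤ k) ℚ.+ (q′ ℚ.+ fromℤ l)  ≡⟨ interchange {ℚ.+-0-abelianGroup} {ℚ.+-0-abelianGroup} p′ (fromℤ k) q′ (fromℤ l) ⟩
    (p′ ℚ.+ q′) ℚ.+ (fromℤ k ℚ.+ fromℤ l)  ≡⟨ ≡.cong ((p′ ℚ.+ q′) ℚ.+_) (fromℤ-+ k l) ⟨
    (p′ ℚ.+ q′) ℚ.+ fromℤ (k ℤ.+ l)        ∎)

  ≡ℤ-neg : ∀ {p q} → p ≡ℤ q → ℚ.- p ≡ℤ ℚ.- q
  ≡ℤ-neg {_} {q} (shift k ≡.refl) = shift (ℤ.- k)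
    (≡.trans (≡.sym (⁻¹-∙-comm q (fromℤ k))) (≡.cong (ℚ.- q ℚ.+_) (≡.sym (fromℤ-neg k))))

module ℚ/ℤ = +Notation ℚ/ℤ

∑ : ∀ {N} → (Fin N → ℚ) → ℚ
∑ = sum where open Algebra.Properties.CommutativeMonoid.Sum (AbelianGroup.commutativeMonoid ℚ/ℤ)

record Finite (S : Setoid 0ℓ 0ℓ) : Set where
  open Setoid S
  field
    size        : ℕ
    enumeration : Inverse (≡.setoid (Fin size)) S
  open Inverse enumeration

  enum : Fin size → Carrier
  enum = to

  infix 4 _≟_
  _≟_ : ∀ x y → Dec (x ≈ y)
  x ≟ y with from x Fin.≟ from y
  ... | yes p = yes (trans (sym (strictlyInverseˡ x)) (trans (to-cong p) (strictlyInverseˡ y)))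
  ... | no ¬p = no (λ x≈y → ¬p (from-cong x≈y))

  ∃? : ∀ {P : Pred Carrier 0ℓ} → (∀ {x y} → x ≈ y → P x → P y) → Decidable P → Dec (∃ P)
  ∃? resp P? with Fin.any? (λ i → P? (to i))
  ... | yes (i , p) = yes (to i , p)
  ... | no ¬p       = no λ (x , p) → ¬p (from x , resp (sym (strictlyInverseˡ x)) p)

record FiniteSet : Set₁ where
  field
    setoid : Setoid 0ℓ 0ℓ
    finite : Finite setoid
  open Setoid setoid public
  open Finite finite public

_×ᶠ_ : FiniteSet → FiniteSet → FiniteSet
X ×ᶠ Y = record
  { setoid = ×-setoid X.setoid Y.setoid
  ; finite = record
    { size = X.size ℕ.* Y.size
    ; enumeration = record
      { to = λ k → let i , j = remQuot Y.size k in X.enum i , Y.enum j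
      ; from = λ (x , y) → combine (EX.from x) (EY.from y)
      ; to-cong = λ { ≡.refl → X.refl , Y.refl }
      ; from-cong = λ (p , q) → ≡.cong₂ combine (EX.from-cong p) (EY.from-cong q)
      ; inverse =
          (λ { {x , y} ≡.refl →
            X.trans (X.reflexive (≡.cong (X.enum ∘ proj₁) (Fin.remQuot-combine (EX.from x) (EY.from y)))) (EX.strictlyInverseˡ x)
          , Y.trans (Y.reflexive (≡.cong (Y.enum ∘ proj₂) (Fin.remQuot-combine (EX.from x) (EY.from y)))) (EY.strictlyInverseˡ y) })
        , (λ {k} (p , q) → ≡.trans
            (≡.cong₂ combine (EX.inverseʳ p) (EY.inverseʳ q))
            (Fin.combine-remQuot {X.size} Y.size k))
      }
    }
  }
  where
  open import Data.Product.Relation.Binary.Pointwise.NonDependent using (×-setoid)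
  module X = FiniteSet X
  module Y = FiniteSet Y
  module EX = Inverse X.enumeration
  module EY = Inverse Y.enumeration

infixl 8 _^ᶠ_
_^ᶠ_ : FiniteSet → ℕ → FiniteSet
X ^ᶠ N = record
  { setoid = ≋-setoid N
  ; finite = record
    { size = X.size ℕ.^ N
    ; enumeration = record
      { to = λ k i → X.enum (finToFun k i)
      ; from = λ x → funToFin (E.from ∘ x)
      ; to-cong = λ { ≡.refl _ → X.refl }
      ; from-cong = λ e → funToFin-cong (λ i → E.from-cong (e i))
      ; inverse =
          (λ { {x} ≡.refl i → X.trans (X.reflexive (≡.cong X.enum (Fin.finToFun-funToFin (E.from ∘ x) i))) (E.strictlyInverseˡ (x i)) })
        , (λ {k} e → ≡.trans (funToFin-cong (λ i → E.inverseʳ (e i))) (Fin.funToFin-finToFin {N} k))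
      }
    }
  }
  where
  module X = FiniteSet X
  module E = Inverse X.enumeration
  open Data.Vec.Functional.Relation.Binary.Equality.Setoid X.setoid using (≋-setoid)

  funToFin-cong : ∀ {m n} {f g : Fin m → Fin n} → (∀ i → f i ≡ g i) → funToFin f ≡ funToFin g
  funToFin-cong {zero}  e = ≡.refl
  funToFin-cong {suc m} e = ≡.cong₂ combine (e zero) (funToFin-cong (e ∘ suc))

infixl 8 _^ᴹ_
_^ᴹ_ : ∀ {R : Ring 0ℓ 0ℓ} → LeftModule R 0ℓ 0ℓ → ℕ → LeftModule R 0ℓ 0ℓ
V ^ᴹ N = record
  { Carrierᴹ = Fin N → Carrierᴹ
  ; _≈ᴹ_ = λ x y → ∀ i → x i ≈ᴹ y i
  ; _+ᴹ_ = λ x y i → x i +ᴹ y i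
  ; _*ₗ_ = λ r x i → r *ₗ x i
  ; 0ᴹ = λ _ → 0ᴹ
  ; -ᴹ_ = λ x i → -ᴹ x i
  ; isLeftModule = record
    { isLeftSemimodule = record
      { +ᴹ-isCommutativeMonoid = record
        { isMonoid = record
          { isSemigroup = record
            { isMagma = record
              { isEquivalence = Setoid.isEquivalence (≋-setoid N)
              ; ∙-cong = λ p q i → +ᴹ-cong (p i) (q i)
              }
            ; assoc = λ x y z i → +ᴹ-assoc (x i) (y i) (z i)
            }
          ; identity = (λ x i → +ᴹ-identityˡ (x i)) , (λ x i → +ᴹ-identityʳ (x i))
          }
        ; comm = λ x y i → +ᴹ-comm (x i) (y i)
        }
      ; isPreleftSemimodule = record
        { *ₗ-cong = λ p q i → *ₗ-cong p (q i)
        ; *ₗ-zeroˡ = λ x i → *ₗ-zeroˡ (x i)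
        ; *ₗ-distribʳ = λ x r s i → *ₗ-distribʳ (x i) r s
        ; *ₗ-identityˡ = λ x i → *ₗ-identityˡ (x i)
        ; *ₗ-assoc = λ r s x i → *ₗ-assoc r s (x i)
        ; *ₗ-zeroʳ = λ r i → *ₗ-zeroʳ r
        ; *ₗ-distribˡ = λ r x y i → *ₗ-distribˡ r (x i) (y i)
        }
      }
    ; -ᴹ‿cong = λ p i → -ᴹ‿cong (p i)
    ; -ᴹ‿inverse = (λ x i → -ᴹ‿inverseˡ (x i)) , (λ x i → -ᴹ‿inverseʳ (x i))
    }
  }
  where
  open LeftModule V
  open Data.Vec.Functional.Relation.Binary.Equality.Setoid ≈ᴹ-setoid using (≋-setoid)

record FiniteModule (R : Ring 0ℓ 0ℓ) : Set₁ where
  field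
    leftModule : LeftModule R 0ℓ 0ℓ
  open LeftModule leftModule public
  field
    finite : Finite ≈ᴹ-setoid

  finiteSet : FiniteSet
  finiteSet = record { setoid = ≈ᴹ-setoid ; finite = finite }

module _ {R : Ring 0ℓ 0ℓ} where

  infixr 7 _⊕ᴹ_
  _⊕ᴹ_ : FiniteModule R → FiniteModule R → FiniteModule R
  V ⊕ᴹ W = record
    { leftModule = ×-Module.leftModule V.leftModule W.leftModule
    ; finite = FiniteSet.finite (V.finiteSet ×ᶠ W.finiteSet)
    }
    where
    module V = FiniteModule V
    module W = FiniteModule W

  infixl 8 _^ᶠᴹ_
  _^ᶠᴹ_ : FiniteModule R → ℕ → FiniteModule R
  V ^ᶠᴹ N = record
    { leftModule = V.leftModule ^ᴹ N
    ; finite = FiniteSet.finite (V.finiteSet ^ᶠ N)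
    }
    where
    module V = FiniteModule V

module _ {R : Ring 0ℓ 0ℓ} (V : LeftModule R 0ℓ 0ℓ) where
  private
    module R = Ring R
    open LeftModule V

  *ₗ-additive : ∀ r → Additive +ᴹ-abelianGroup +ᴹ-abelianGroup (r *ₗ_)
  *ₗ-additive r = mkAdditive *ₗ-congˡ (*ₗ-distribˡ r)

  private
    *ₗ-additiveˡ : ∀ x → Additive R.+-abelianGroup +ᴹ-abelianGroup (_*ₗ x)
    *ₗ-additiveˡ x = mkAdditive *ₗ-congʳ (*ₗ-distribʳ x)

  record BilinearForm : Set where
    field
      form         : Carrierᴹ → Carrierᴹ → ℚ
      isBiadditive : IsBiadditive +ᴹ-abelianGroup +ᴹ-abelianGroup ℚ/ℤ form
    open IsBiadditive isBiadditive public

  record QuadraticForm : Set where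
    field
      form        : Carrierᴹ → ℚ
      isQuadratic : IsPointedQuadratic +ᴹ-abelianGroup ℚ/ℤ form
    open IsPointedQuadratic isQuadratic public

  private
    Bil-Ab : Ab
    Bil-Ab = record
      { Carrier = BilinearForm
      ; _≈_ = λ b c → ∀ x y → form b x y ℚ/ℤ.≈ form c x y
      ; _∙_ = λ b c → record { isBiadditive = +-biadditive (isBiadditive b) (isBiadditive c) }
      ; ε = record { isBiadditive = 0-biadditive }
      ; _⁻¹ = λ b → record { isBiadditive = neg-biadditive (isBiadditive b) }
      ; isAbelianGroup = record
        { isGroup = record
          { isMonoid = record
            { isSemigroup = record
              { isMagma = record
                { isEquivalence = record
                  { refl = λ _ _ → ℚ/ℤ.refl
                  ; sym = λ p x y → ℚ/ℤ.sym (p x y)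
                  ; trans = λ p q x y → ℚ/ℤ.trans (p x y) (q x y)
                  }
                ; ∙-cong = λ p q x y → ℚ/ℤ.+-cong (p x y) (q x y)
                }
              ; assoc = λ b c d x y → ℚ/ℤ.assoc (form b x y) (form c x y) (form d x y)
              }
            ; identity = (λ _ _ _ → ℚ/ℤ.identityˡ _) , (λ _ _ _ → ℚ/ℤ.identityʳ _)
            }
          ; inverse = (λ b x y → ℚ/ℤ.inverseˡ (form b x y)) , (λ b x y → ℚ/ℤ.inverseʳ (form b x y))
          ; ⁻¹-cong = λ p x y → ℚ/ℤ.-‿cong (p x y)
          }
        ; comm = λ b c x y → ℚ/ℤ.comm (form b x y) (form c x y)
        }
      }
      where
      open BilinearForm

    Quad-Ab : Ab
    Quad-Ab = record
      { Carrier = QuadraticForm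
      ; _≈_ = λ q q′ → ∀ x → form q x ℚ/ℤ.≈ form q′ x
      ; _∙_ = λ q q′ → record { isQuadratic = +-quadratic (isQuadratic q) (isQuadratic q′) }
      ; ε = record { isQuadratic = 0-quadratic }
      ; _⁻¹ = λ q → record { isQuadratic = neg-quadratic (isQuadratic q) }
      ; isAbelianGroup = record
        { isGroup = record
          { isMonoid = record
            { isSemigroup = record
              { isMagma = record
                { isEquivalence = record
                  { refl = λ _ → ℚ/ℤ.refl
                  ; sym = λ p x → ℚ/ℤ.sym (p x)
                  ; trans = λ p q x → ℚ/ℤ.trans (p x) (q x)
                  }
                ; ∙-cong = λ p q x → ℚ/ℤ.+-cong (p x) (q x)
                }
              ; assoc = λ p q r x → ℚ/ℤ.assoc (form p x) (form q x) (form r x)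
              }
            ; identity = (λ _ _ → ℚ/ℤ.identityˡ _) , (λ _ _ → ℚ/ℤ.identityʳ _)
            }
          ; inverse = (λ q x → ℚ/ℤ.inverseˡ (form q x)) , (λ q x → ℚ/ℤ.inverseʳ (form q x))
          ; ⁻¹-cong = λ p x → ℚ/ℤ.-‿cong (p x)
          }
        ; comm = λ p q x → ℚ/ℤ.comm (form p x) (form q x)
        }
      }
      where
      open QuadraticForm

  Bil : TensorModule R
  Bil = record
    { abelianGroup = Bil-Ab
    ; _·_⊗_ = λ b r s → record
      { form = λ x y → form b (r *ₗ x) (s *ₗ y)
      ; isBiadditive = ∘-biadditive (isBiadditive b) (*ₗ-additive r) (*ₗ-additive s)
      }
    ; ·-additive = λ r s → mkAdditive (λ e x y → e _ _) (λ _ _ _ _ → ℚ/ℤ.refl)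
    ; ⊗-biadditive = λ b → record
      { additiveˡ = λ s → mkAdditive (λ e x y → cong₂ b (*ₗ-congʳ e) ≈ᴹ-refl)
          (λ r r′ x y → Additive.+-homo (∘-additive (additiveˡ b (s *ₗ y)) (*ₗ-additiveˡ x)) r r′)
      ; additiveʳ = λ r → mkAdditive (λ e x y → cong₂ b ≈ᴹ-refl (*ₗ-congʳ e))
          (λ s s′ x y → Additive.+-homo (∘-additive (additiveʳ b (r *ₗ x)) (*ₗ-additiveˡ y)) s s′)
      }
    ; ·-identity = λ b x y → cong₂ b (*ₗ-identityˡ x) (*ₗ-identityˡ y)
    ; ·-assoc = λ b r s r′ s′ x y → cong₂ b (*ₗ-assoc r r′ x) (*ₗ-assoc s s′ y)
    }
    where
    open BilinearForm

  Quad : QModule R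
  Quad = record
    { abelianGroup = Quad-Ab
    ; _[_] = λ q r → record
      { form = λ x → form q (r *ₗ x)
      ; isQuadratic = ∘-quadratic (isQuadratic q) (*ₗ-additive r)
      }
    ; []-additive = λ r → mkAdditive (λ e x → e _) (λ _ _ _ → ℚ/ℤ.refl)
    ; []-quadratic = λ q → record
      { cong = λ e x → IsPointedQuadratic.cong (along q x) e
      ; pointed = λ x → IsPointedQuadratic.pointed (along q x)
      ; polar-biadditive = record
        { additiveˡ = λ s → mkAdditive
            (λ e x → Additive.cong (IsBiadditive.additiveˡ (polar-along q x) s) e)
            (λ r r′ x → Additive.+-homo (IsBiadditive.additiveˡ (polar-along q x) s) r r′)
        ; additiveʳ = λ r → mkAdditive
            (λ e x → Additive.cong (IsBiadditive.additiveʳ (polar-along q x) r) e)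
            (λ s s′ x → Additive.+-homo (IsBiadditive.additiveʳ (polar-along q x) r) s s′)
        }
      }
    ; [1] = λ q x → cong q (*ₗ-identityˡ x)
    ; [*] = λ q r s x → cong q (*ₗ-assoc r s x)
    }
    where
    open QuadraticForm

    along : ∀ q x → IsPointedQuadratic R.+-abelianGroup ℚ/ℤ (λ r → form q (r *ₗ x))
    along q x = ∘-quadratic (isQuadratic q) (*ₗ-additiveˡ x)

    polar-along : ∀ q x → IsBiadditive R.+-abelianGroup R.+-abelianGroup ℚ/ℤ (polar R.+-abelianGroup ℚ/ℤ (λ r → form q (r *ₗ x)))
    polar-along q x = IsPointedQuadratic.polar-biadditive (along q x)

module _ {R : Ring 0ℓ 0ℓ} (V : LeftModule R 0ℓ 0ℓ) where
  open LeftModule V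

  record NonSingular (β : Carrierᴹ → Carrierᴹ → ℚ) : Set where
    field
      injective  : ∀ x x′ → (∀ y → β x y ℚ/ℤ.≈ β x′ y) → x ≈ᴹ x′
      surjective : ∀ f → Additive +ᴹ-abelianGroup ℚ/ℤ f → ∃[ x ] ∀ y → β x y ℚ/ℤ.≈ f y

record FiniteRep (F : FormRing) : Set₁ where
  open FormRing F
  field
    V : FiniteModule R
  module V = FiniteModule V
  field
    ρM : TensorHom M (Bil V.leftModule)
    ρΦ : QHom Φ (Quad V.leftModule)

  bil : M.Carrier → V.Carrierᴹ → V.Carrierᴹ → ℚ
  bil m = BilinearForm.form (TensorHom.to ρM m)

  quad : Φ.Carrier → V.Carrierᴹ → ℚ
  quad φ = QuadraticForm.form (QHom.to ρΦ φ)

  β : V.Carrierᴹ → V.Carrierᴹ → ℚ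
  β = bil ψ1

  field
    bil-τ         : ∀ m x y → bil (τ m) x y ℚ/ℤ.≈ bil m y x
    β-nonsingular : NonSingular V.leftModule β
    quad-brace    : ∀ m x → quad ⦃⦃ m ⦄⦄ x ℚ/ℤ.≈ bil m x x
    bil-lam       : ∀ φ x y → bil λ[ φ ] x y ℚ/ℤ.≈ polar V.+ᴹ-abelianGroup ℚ/ℤ (quad φ) x y

open Algebra.Properties.CommutativeMonoid.Sum (AbelianGroup.commutativeMonoid ℚ/ℤ) using () renaming (sum-cong-≋ to ∑-cong)

∑-additive : ∀ {A N} {f : Fin N → AbelianGroup.Carrier A → ℚ} →
             (∀ i → Additive A ℚ/ℤ (f i)) → Additive A ℚ/ℤ (λ x → ∑ (λ i → f i x))
∑-additive {N = zero}  F = 0-additive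
∑-additive {N = suc N} F = +-additive (F zero) (∑-additive (F ∘ suc))

∑-biadditive : ∀ {A B N} {f : Fin N → AbelianGroup.Carrier A → AbelianGroup.Carrier B → ℚ} →
               (∀ i → IsBiadditive A B ℚ/ℤ (f i)) → IsBiadditive A B ℚ/ℤ (λ x y → ∑ (λ i → f i x y))
∑-biadditive F = record
  { additiveˡ = λ y → ∑-additive (λ i → IsBiadditive.additiveˡ (F i) y)
  ; additiveʳ = λ x → ∑-additive (λ i → IsBiadditive.additiveʳ (F i) x)
  }

∑-quadratic : ∀ {A N} {q : Fin N → AbelianGroup.Carrier A → ℚ} →
              (∀ i → IsPointedQuadratic A ℚ/ℤ (q i)) → IsPointedQuadratic A ℚ/ℤ (λ x → ∑ (λ i → q i x))
∑-quadratic {N = zero}  Q = 0-quadratic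
∑-quadratic {N = suc N} Q = +-quadratic (Q zero) (∑-quadratic (Q ∘ suc))

polar-∑ : ∀ {A N} (q : Fin N → AbelianGroup.Carrier A → ℚ) x y →
          ∑ (λ i → polar A ℚ/ℤ (q i) x y) ℚ/ℤ.≈ polar A ℚ/ℤ (λ z → ∑ (λ i → q i z)) x y
polar-∑ {N = zero}  q x y = shift ℤ.0ℤ ≡.refl
polar-∑ {A} {suc N} q x y = ℚ/ℤ.trans
  (ℚ/ℤ.+-cong (ℚ/ℤ.refl {polar A ℚ/ℤ (q zero) x y}) (polar-∑ {A} (q ∘ suc) x y))
  (polar-+ {A} {ℚ/ℤ} (q zero) (λ z → ∑ (λ i → q (suc i) z)) x y)

module _ {F : FormRing} where
  open FormRing F

  module _ (ρ : FiniteRep F) where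
    private
      module ρ = FiniteRep ρ
      module V = ρ.V
      module ρM m = BilinearForm (TensorHom.to ρ.ρM m)
      module ρΦ φ = QuadraticForm (QHom.to ρ.ρΦ φ)

    negate : FiniteRep F
    negate = record
      { V = ρ.V
      ; ρM = record
        { to = λ m → record { isBiadditive = neg-biadditive (ρM.isBiadditive m) }
        ; additive = neg-additive (TensorHom.additive ρ.ρM)
        ; ·-homo = λ m r s x y → ℚ/ℤ.-‿cong (TensorHom.·-homo ρ.ρM m r s x y)
        }
      ; ρΦ = record
        { to = λ φ → record { isQuadratic = neg-quadratic (ρΦ.isQuadratic φ) }
        ; additive = neg-additive (QHom.additive ρ.ρΦ)
        ; []-homo = λ φ r x → ℚ/ℤ.-‿cong (QHom.[]-homo ρ.ρΦ φ r x)
        }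
      ; bil-τ = λ m x y → ℚ/ℤ.-‿cong (ρ.bil-τ m x y)
      ; β-nonsingular = record
        { injective = λ x x′ e → injective x x′ (λ y → ⁻¹-injective (e y))
        ; surjective = λ f f-additive →
            let x , e = surjective _ (neg-additive f-additive) in
            x , λ y → ℚ/ℤ.trans (ℚ/ℤ.-‿cong (e y)) (⁻¹-involutive (f y))
        }
      ; quad-brace = λ m x → ℚ/ℤ.-‿cong (ρ.quad-brace m x)
      ; bil-lam = λ φ x y → ℚ/ℤ.trans (ℚ/ℤ.-‿cong (ρ.bil-lam φ x y)) (polar-neg {V.+ᴹ-abelianGroup} {ℚ/ℤ} (ρ.quad φ) x y)
      }
      where
      open NonSingular ρ.β-nonsingular
      open Algebra.Properties.AbelianGroup ℚ/ℤ using (⁻¹-injective; ⁻¹-involutive)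

    copies : ℕ → FiniteRep F
    copies N = record
      { V = ρ.V ^ᶠᴹ N
      ; ρM = record
        { to = λ m → record
          { form = λ x y → ∑ {N} λ i → ρ.bil m (x i) (y i)
          ; isBiadditive = ∑-biadditive λ i → ∘-biadditive (ρM.isBiadditive m) (coord i) (coord i)
          }
        ; additive = mkAdditive
            (λ e x y → ∑-cong {N} λ i → Additive.cong ρM-additive e (x i) (y i))
            (λ m m′ x y → Additive.+-homo (∑-additive {f = λ i m → ρ.bil m (x i) (y i)} λ i → at (x i) (y i)) m m′)
        ; ·-homo = λ m r s x y → ∑-cong {N} λ i → TensorHom.·-homo ρ.ρM m r s (x i) (y i)
        }
      ; ρΦ = record
        { to = λ φ → record
          { form = λ x → ∑ {N} λ i → ρ.quad φ (x i)
          ; isQuadratic = ∑-quadratic λ i → ∘-quadratic (ρΦ.isQuadratic φ) (coord i)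
          }
        ; additive = mkAdditive
            (λ e x → ∑-cong {N} λ i → Additive.cong ρΦ-additive e (x i))
            (λ φ φ′ x → Additive.+-homo (∑-additive {f = λ i φ → ρ.quad φ (x i)} λ i → atΦ (x i)) φ φ′)
        ; []-homo = λ φ r x → ∑-cong {N} λ i → QHom.[]-homo ρ.ρΦ φ r (x i)
        }
      ; bil-τ = λ m x y → ∑-cong {N} λ i → ρ.bil-τ m (x i) (y i)
      ; β-nonsingular = record
        { injective = λ x x′ e i → injective (x i) (x′ i) λ v →
            ℚ/ℤ.trans (ℚ/ℤ.sym (∑-single x i v)) (ℚ/ℤ.trans (e (single i v)) (∑-single x′ i v))
        ; surjective = λ f f-additive →
            let sol = λ i → surjective (λ v → f (single i v)) (∘-additive f-additive (single-additive i)) in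
            (λ i → proj₁ (sol i)) , λ y → ℚ/ℤ.trans
              (∑-cong {N} λ i → proj₂ (sol i) (y i))
              (∑-restrict f f-additive y)
        }
      ; quad-brace = λ m x → ∑-cong {N} λ i → ρ.quad-brace m (x i)
      ; bil-lam = λ φ x y → ℚ/ℤ.trans
          (∑-cong {N} λ i → ρ.bil-lam φ (x i) (y i))
          (polar-∑ {VN.+ᴹ-abelianGroup} (λ i x → ρ.quad φ (x i)) x y)
      }
      where
      module VN = LeftModule (V.leftModule ^ᴹ N)
      open NonSingular ρ.β-nonsingular
      open TensorHom ρ.ρM using () renaming (additive to ρM-additive)
      open QHom ρ.ρΦ using () renaming (additive to ρΦ-additive)

      Vᴺ : ℕ → Ab
      Vᴺ n = LeftModule.+ᴹ-abelianGroup (V.leftModule ^ᴹ n)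

      coord : ∀ i → Additive VN.+ᴹ-abelianGroup V.+ᴹ-abelianGroup (λ x → x i)
      coord i = mkAdditive (λ e → e i) (λ _ _ → V.≈ᴹ-refl)

      at : ∀ x y → Additive M.abelianGroup ℚ/ℤ (λ m → ρ.bil m x y)
      at x y = mkAdditive (λ e → Additive.cong ρM-additive e x y) (λ m m′ → Additive.+-homo ρM-additive m m′ x y)

      atΦ : ∀ x → Additive Φ.abelianGroup ℚ/ℤ (λ φ → ρ.quad φ x)
      atΦ x = mkAdditive (λ e → Additive.cong ρΦ-additive e x) (λ φ φ′ → Additive.+-homo ρΦ-additive φ φ′ x)

      infixr 5 _◂_
      _◂_ : ∀ {n} → V.Carrierᴹ → (Fin n → V.Carrierᴹ) → Fin (suc n) → V.Carrierᴹ
      _◂_ = Vector._∷_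

      single : ∀ {n} → Fin n → V.Carrierᴹ → Fin n → V.Carrierᴹ
      single zero    v = v ◂ λ _ → V.0ᴹ
      single (suc i) v = V.0ᴹ ◂ single i v

      single-cong : ∀ {n} (i : Fin n) {v w} → v V.≈ᴹ w → ∀ j → single i v j V.≈ᴹ single i w j
      single-cong zero    e zero    = e
      single-cong zero    e (suc j) = V.≈ᴹ-refl
      single-cong (suc i) e zero    = V.≈ᴹ-refl
      single-cong (suc i) e (suc j) = single-cong i e j

      single-+ : ∀ {n} (i : Fin n) v w j → single i (v V.+ᴹ w) j V.≈ᴹ single i v j V.+ᴹ single i w j
      single-+ zero    v w zero    = V.≈ᴹ-refl
      single-+ zero    v w (suc j) = V.≈ᴹ-sym (V.+ᴹ-identityˡ V.0ᴹ)
      single-+ (suc i) v w zero    = V.≈ᴹ-sym (V.+ᴹ-identityˡ V.0ᴹ)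
      single-+ (suc i) v w (suc j) = single-+ i v w j

      single-additive : ∀ {n} (i : Fin n) → Additive V.+ᴹ-abelianGroup (Vᴺ n) (single i)
      single-additive i = mkAdditive (single-cong i) (single-+ i)

      module β = BilinearForm (TensorHom.to ρ.ρM ψ1)

      β-0 : ∀ v → ρ.β v V.0ᴹ ℚ/ℤ.≈ ℚ/ℤ.0#
      β-0 v = Additive.0-homo (β.additiveʳ v)

      ∑-β-0 : ∀ {n} (x : Fin n → V.Carrierᴹ) → ∑ (λ j → ρ.β (x j) V.0ᴹ) ℚ/ℤ.≈ ℚ/ℤ.0#
      ∑-β-0 {zero}  x = ℚ/ℤ.refl
      ∑-β-0 {suc n} x = ℚ/ℤ.trans (ℚ/ℤ.+-cong (β-0 (x zero)) (∑-β-0 (x ∘ suc))) (ℚ/ℤ.identityˡ ℚ/ℤ.0#)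

      ∑-single : ∀ {n} (x : Fin n → V.Carrierᴹ) i v → ∑ (λ j → ρ.β (x j) (single i v j)) ℚ/ℤ.≈ ρ.β (x i) v
      ∑-single x zero    v = ℚ/ℤ.trans (ℚ/ℤ.+-cong (ℚ/ℤ.refl {ρ.β (x zero) v}) (∑-β-0 (x ∘ suc))) (ℚ/ℤ.identityʳ _)
      ∑-single x (suc i) v = ℚ/ℤ.trans (ℚ/ℤ.+-cong (β-0 (x zero)) (∑-single (x ∘ suc) i v)) (ℚ/ℤ.identityˡ _)

      ∑-restrict : ∀ {n} f → Additive (Vᴺ n) ℚ/ℤ f → ∀ y → ∑ (λ i → f (single i (y i))) ℚ/ℤ.≈ f y
      ∑-restrict {zero}  f F y = ℚ/ℤ.trans (ℚ/ℤ.sym (Additive.0-homo F)) (Additive.cong F λ ())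
      ∑-restrict {suc n} f F y = begin
        f (single zero (y zero)) ℚ/ℤ.+ ∑ (λ i → f (V.0ᴹ ◂ single i (y (suc i))))
          ≈⟨ ℚ/ℤ.+-cong (ℚ/ℤ.refl {f (single zero (y zero))}) (∑-restrict (λ z → f (V.0ᴹ ◂ z)) (∘-additive F ◂-additive) (y ∘ suc)) ⟩
        f (single zero (y zero)) ℚ/ℤ.+ f (V.0ᴹ ◂ y ∘ suc)
          ≈⟨ Additive.+-homo F _ _ ⟨
        f (λ i → single zero (y zero) i V.+ᴹ (V.0ᴹ ◂ y ∘ suc) i)
          ≈⟨ Additive.cong F (λ { zero → V.+ᴹ-identityʳ _ ; (suc i) → V.+ᴹ-identityˡ _ }) ⟩
        f y ∎
        where
        open Relation.Binary.Reasoning.Setoid ℚ/ℤ.setoid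
        ◂-additive : Additive (Vᴺ n) (Vᴺ (suc n)) (V.0ᴹ ◂_)
        ◂-additive = mkAdditive
          (λ e → λ { zero → V.≈ᴹ-refl ; (suc i) → e i })
          (λ x y → λ { zero → V.≈ᴹ-sym (V.+ᴹ-identityˡ V.0ᴹ) ; (suc i) → V.≈ᴹ-refl })

  infixr 7 _⊥_
  _⊥_ : FiniteRep F → FiniteRep F → FiniteRep F
  ρ ⊥ σ = record
    { V = ρ.V ⊕ᴹ σ.V
    ; ρM = record
      { to = λ m → record
        { form = λ (x , y) (x′ , y′) → ρ.bil m x x′ ℚ/ℤ.+ σ.bil m y y′
        ; isBiadditive = +-biadditive
            (∘-biadditive (BilinearForm.isBiadditive (TensorHom.to ρ.ρM m)) fst fst)
            (∘-biadditive (BilinearForm.isBiadditive (TensorHom.to σ.ρM m)) snd snd)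
        }
      ; additive = mkAdditive
          (λ e (x , y) (x′ , y′) → ℚ/ℤ.+-cong (Additive.cong (TensorHom.additive ρ.ρM) e x x′) (Additive.cong (TensorHom.additive σ.ρM) e y y′))
          (λ m m′ (x , y) (x′ , y′) → ℚ/ℤ.trans
            (ℚ/ℤ.+-cong (Additive.+-homo (TensorHom.additive ρ.ρM) m m′ x x′) (Additive.+-homo (TensorHom.additive σ.ρM) m m′ y y′))
            (interchange {ℚ/ℤ} {ℚ/ℤ} (ρ.bil m x x′) (ρ.bil m′ x x′) (σ.bil m y y′) (σ.bil m′ y y′)))
      ; ·-homo = λ m r s (x , y) (x′ , y′) → ℚ/ℤ.+-cong (TensorHom.·-homo ρ.ρM m r s x x′) (TensorHom.·-homo σ.ρM m r s y y′)
      }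
    ; ρΦ = record
      { to = λ φ → record
        { form = λ (x , y) → ρ.quad φ x ℚ/ℤ.+ σ.quad φ y
        ; isQuadratic = +-quadratic (∘-quadratic (QuadraticForm.isQuadratic (QHom.to ρ.ρΦ φ)) fst) (∘-quadratic (QuadraticForm.isQuadratic (QHom.to σ.ρΦ φ)) snd)
        }
      ; additive = mkAdditive
          (λ e (x , y) → ℚ/ℤ.+-cong (Additive.cong (QHom.additive ρ.ρΦ) e x) (Additive.cong (QHom.additive σ.ρΦ) e y))
          (λ φ φ′ (x , y) → ℚ/ℤ.trans
            (ℚ/ℤ.+-cong (Additive.+-homo (QHom.additive ρ.ρΦ) φ φ′ x) (Additive.+-homo (QHom.additive σ.ρΦ) φ φ′ y))
            (interchange {ℚ/ℤ} {ℚ/ℤ} (ρ.quad φ x) (ρ.quad φ′ x) (σ.quad φ y) (σ.quad φ′ y)))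
      ; []-homo = λ φ r (x , y) → ℚ/ℤ.+-cong (QHom.[]-homo ρ.ρΦ φ r x) (QHom.[]-homo σ.ρΦ φ r y)
      }
    ; bil-τ = λ m (x , y) (x′ , y′) → ℚ/ℤ.+-cong (ρ.bil-τ m x x′) (σ.bil-τ m y y′)
    ; β-nonsingular = record
      { injective = λ (x , y) (x′ , y′) e →
          ρ.β.injective x x′ (λ v → ℚ/ℤ.trans (ℚ/ℤ.sym (β-left x y v)) (ℚ/ℤ.trans (e (v , σ.V.0ᴹ)) (β-left x′ y′ v)))
        , σ.β.injective y y′ (λ w → ℚ/ℤ.trans (ℚ/ℤ.sym (β-right x y w)) (ℚ/ℤ.trans (e (ρ.V.0ᴹ , w)) (β-right x′ y′ w)))
      ; surjective = λ f f-additive →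
          let x , p = ρ.β.surjective (λ v → f (v , σ.V.0ᴹ)) (∘-additive f-additive inl)
              y , q = σ.β.surjective (λ w → f (ρ.V.0ᴹ , w)) (∘-additive f-additive inr)
          in (x , y) , λ (v , w) → ℚ/ℤ.trans (ℚ/ℤ.+-cong (p v) (q w)) (ℚ/ℤ.trans
            (ℚ/ℤ.sym (Additive.+-homo f-additive (v , σ.V.0ᴹ) (ρ.V.0ᴹ , w)))
            (Additive.cong f-additive (ρ.V.+ᴹ-identityʳ v , σ.V.+ᴹ-identityˡ w)))
      }
    ; quad-brace = λ m (x , y) → ℚ/ℤ.+-cong (ρ.quad-brace m x) (σ.quad-brace m y)
    ; bil-lam = λ φ (x , y) (x′ , y′) → ℚ/ℤ.trans
        (ℚ/ℤ.+-cong (ρ.bil-lam φ x x′) (σ.bil-lam φ y y′))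
        (polar-+ {V⊕W} {ℚ/ℤ} (ρ.quad φ ∘ proj₁) (σ.quad φ ∘ proj₂) (x , y) (x′ , y′))
    }
    where
    module ρ where
      open FiniteRep ρ public
      module β where
        open NonSingular β-nonsingular public
        open BilinearForm (TensorHom.to ρM ψ1) public
    module σ where
      open FiniteRep σ public
      module β where
        open NonSingular β-nonsingular public
        open BilinearForm (TensorHom.to ρM ψ1) public

    V⊕W : Ab
    V⊕W = FiniteModule.+ᴹ-abelianGroup (ρ.V ⊕ᴹ σ.V)

    fst : Additive V⊕W ρ.V.+ᴹ-abelianGroup proj₁
    fst = mkAdditive proj₁ (λ _ _ → ρ.V.≈ᴹ-refl)

    snd : Additive V⊕W σ.V.+ᴹ-abelianGroup proj₂
    snd = mkAdditive proj₂ (λ _ _ → σ.V.≈ᴹ-refl)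

    inl : Additive ρ.V.+ᴹ-abelianGroup V⊕W (_, σ.V.0ᴹ)
    inl = mkAdditive (_, σ.V.≈ᴹ-refl) (λ _ _ → ρ.V.≈ᴹ-refl , σ.V.≈ᴹ-sym (σ.V.+ᴹ-identityˡ σ.V.0ᴹ))

    inr : Additive σ.V.+ᴹ-abelianGroup V⊕W (ρ.V.0ᴹ ,_)
    inr = mkAdditive (ρ.V.≈ᴹ-refl ,_) (λ _ _ → ρ.V.≈ᴹ-sym (ρ.V.+ᴹ-identityˡ ρ.V.0ᴹ) , σ.V.≈ᴹ-refl)

    β-left : ∀ x y v → ρ.β x v ℚ/ℤ.+ σ.β y σ.V.0ᴹ ℚ/ℤ.≈ ρ.β x v
    β-left x y v = ℚ/ℤ.trans (ℚ/ℤ.+-cong (ℚ/ℤ.refl {ρ.β x v}) (Additive.0-homo (σ.β.additiveʳ y))) (ℚ/ℤ.identityʳ _)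

    β-right : ∀ x y w → ρ.β x ρ.V.0ᴹ ℚ/ℤ.+ σ.β y w ℚ/ℤ.≈ σ.β y w
    β-right x y w = ℚ/ℤ.trans (ℚ/ℤ.+-cong (Additive.0-homo (ρ.β.additiveʳ x)) ℚ/ℤ.refl) (ℚ/ℤ.identityˡ _)

  -- ρ^(N,N) is ρ ^⟨ N ,- N ⟩: N copies of ρ and N copies of its negative.
  infix 9 _^⟨_,-_⟩
  _^⟨_,-_⟩ : FiniteRep F → ℕ → ℕ → FiniteRep F
  ρ ^⟨ N ,- N′ ⟩ = copies ρ N ⊥ copies (negate ρ) N′

module _ (F : FormRing) where
  open FormRing F
  open R

  rightIdeal : Carrier → RawRightModule Carrier 0ℓ 0ℓ
  rightIdeal e = record
    { Carrierᴹ = Σ[ x ∈ Carrier ] ∃[ y ] x ≈ e * y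
    ; _≈ᴹ_ = λ (x , _) (x′ , _) → x ≈ x′
    ; _+ᴹ_ = λ (x , y , p) (x′ , y′ , p′) → x + x′ , y + y′ , trans (+-cong p p′) (sym (distribˡ e y y′))
    ; _*ᵣ_ = λ (x , y , p) r → x * r , y * r , trans (*-congʳ p) (*-assoc e y r)
    ; 0ᴹ = 0# , 0# , sym (zeroʳ e)
    ; -ᴹ_ = λ (x , y , p) → - x , - y , trans (-‿cong p) (-‿distribʳ-* e y)
    }
    where
    open Algebra.Properties.Ring R

  record IsSymmetricIdempotent (e : Carrier) : Set where
    field
      idempotent : e * e ≈ e
      iso        : RawRightModule.Carrierᴹ (rightIdeal e) → RawRightModule.Carrierᴹ (rightIdeal (e ᴶ))
      isIso      : IsRightModuleIsomorphism (rightIdeal e) (rightIdeal (e ᴶ)) iso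

  Conjugate : Carrier → Carrier → Set
  Conjugate e f = ∃[ a ] ∃[ a⁻¹ ] a * a⁻¹ ≈ 1# × a⁻¹ * a ≈ 1# × e ≈ a * f * a⁻¹

  -- Representatives ι of the classes of symmetric idempotents under
  -- conjugation by units, together with the chosen elements u_ι and v_ι.
  record SymmetricIdempotents : Set₁ where
    field
      Index      : Set
      ι          : Index → Carrier
      symmetric  : ∀ i → IsSymmetricIdempotent (ι i)
      exhaustive : ∀ e → IsSymmetricIdempotent e → ∃[ i ] Conjugate e (ι i)
      distinct   : ∀ i j → Conjugate (ι i) (ι j) → i ≡ j
      u v        : Index → Carrier
      u∈ιRιᴶ     : ∀ i → ∃[ r ] u i ≈ ι i * r * ι i ᴶ
      v∈ιᴶRι     : ∀ i → ∃[ r ] v i ≈ ι i ᴶ * r * ι i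
      uv≈ι       : ∀ i → u i * v i ≈ ι i
      vu≈ιᴶ      : ∀ i → v i * u i ≈ ι i ᴶ

module _ {F : FormRing} (ρ : FiniteRep F) where
  open FormRing F using (module R)
  open FiniteRep ρ

  -- Membership is decidable, as for every subset of a finite set classically.
  record Code : Set₁ where
    field
      _∈C   : Pred V.Carrierᴹ 0ℓ
      _∈C?  : Decidable _∈C
      ∈-resp : ∀ {x y} → x V.≈ᴹ y → x ∈C → y ∈C
      0∈     : V.0ᴹ ∈C
      +-∈    : ∀ {x y} → x ∈C → y ∈C → (x V.+ᴹ y) ∈C
      *ₗ-∈   : ∀ r {x} → x ∈C → (r V.*ₗ x) ∈C

  module _ (C : Code) where
    open Code C

    _⟂ : Pred V.Carrierᴹ 0ℓ
    _⟂ x = ∀ c → c ∈C → β x c ℚ/ℤ.≈ ℚ/ℤ.0#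

    SelfDual : Set
    SelfDual = _∈C ≐ _⟂

    Isotropic : Set
    Isotropic = _∈C ⊆ _⟂ × (∀ φ c → c ∈C → quad φ c ℚ/ℤ.≈ ℚ/ℤ.0#)

    OfType : Set
    OfType = SelfDual × Isotropic

  IsCompleteList : ∀ {t} → (Fin t → Code) → Set₁
  IsCompleteList C = (∀ i → OfType (C i)) × (∀ D → OfType D → ∃[ i ] Code._∈C D ≐ Code._∈C (C i))

-- A complete Archimedean ordered field, presented constructively. Such a
-- field is unique up to unique isomorphism, so quantifying over this record
-- amounts to speaking about ℝ, which the library does not construct. Square
-- roots exist by completeness; √ names them.
record RealNumbers : Set₁ where
  field
    heytingField : HeytingField 0ℓ 0ℓ 0ℓ
  open HeytingField heytingField public
    using (Carrier; _≈_; _#_; _+_; _*_; -_; _-_; 0#; 1#; #⇒invertible; heytingCommutativeRing)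

  commutativeRing : CommutativeRing 0ℓ 0ℓ
  commutativeRing = HeytingCommutativeRing.commutativeRing heytingCommutativeRing

  open Algebra.Properties.Monoid.Mult (CommutativeRing.+-monoid commutativeRing) using () renaming (_×_ to _times_)

  fromℕ : ℕ → Carrier
  fromℕ n = n times 1#

  infix 4 _<_ _≤_
  field
    _<_                  : Rel Carrier 0ℓ
    isStrictPartialOrder : IsStrictPartialOrder _≈_ _<_
    #⇔<⊎>                : ∀ x y → x # y ⇔ (x < y ⊎ y < x)
    0<1                  : 0# < 1#
    +-mono-<             : ∀ z {x y} → x < y → x + z < y + z
    *-pos                : ∀ {x y} → 0# < x → 0# < y → 0# < x * y
    archimedean          : ∀ x → ∃[ n ] x < fromℕ n

  _≤_ : Rel Carrier 0ℓ
  x ≤ y = ¬ (y < x)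

  Within : Carrier → Carrier → Carrier → Set
  Within ε x y = x < y + ε × y < x + ε

  Cauchy : (ℕ → Carrier) → Set
  Cauchy s = ∀ ε → 0# < ε → ∃[ N ] ∀ m n → N ℕ.≤ m → N ℕ.≤ n → Within ε (s m) (s n)

  _⟶_ : (ℕ → Carrier) → Carrier → Set
  s ⟶ l = ∀ ε → 0# < ε → ∃[ N ] ∀ n → N ℕ.≤ n → Within ε (s n) l

  field
    complete : ∀ s → Cauchy s → ∃[ l ] s ⟶ l
    √        : ∀ x → 0# < x → Carrier
    √-pos    : ∀ x p → 0# < √ x p
    √-square : ∀ x p → √ x p * √ x p ≈ x

  recip : ∀ x → 0# < x → Carrier
  recip x 0<x = proj₁ (#⇒invertible (Equivalence.from (#⇔<⊎> x 0#) (inj₂ 0<x)))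

  fromℕ-pos : ∀ n → 0# < fromℕ (suc n)
  fromℕ-pos zero = <-respʳ-≈ (sym (+-identityʳ 1#)) 0<1
    where
    open CommutativeRing commutativeRing using (+-identityʳ; sym)
    open IsStrictPartialOrder isStrictPartialOrder using (<-respʳ-≈)
  fromℕ-pos (suc n) = trans (fromℕ-pos n) (<-respˡ-≈ (+-identityˡ _) (+-mono-< (fromℕ (suc n)) 0<1))
    where
    open CommutativeRing commutativeRing using (+-identityˡ)
    open IsStrictPartialOrder isStrictPartialOrder

  fromInteger : ℤ → Carrier
  fromInteger (ℤ.+ n)      = fromℕ n
  fromInteger (ℤ.-[1+ n ]) = - fromℕ (suc n)

  fromℚ : ℚ → Carrier
  fromℚ q = fromInteger (↥ q) * recip (fromℕ (↧ₙ q)) (fromℕ-pos (ℚ.denominator-1 q))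

  -- n^(-1/2); the value at 0 is irrelevant.
  invSqrt : ℕ → Carrier
  invSqrt zero    = 0#
  invSqrt (suc n) = recip (√ (fromℕ (suc n)) (fromℕ-pos n)) (√-pos _ _)

module Complex (ℝ : RealNumbers) where
  private
    module ℝ where
      open RealNumbers ℝ public using (invSqrt; fromℚ; _<_; _≤_)
      open CommutativeRing (RealNumbers.commutativeRing ℝ) public

  ℂ-ring : CommutativeRing 0ℓ 0ℓ
  ℂ-ring = record
    { Carrier = ℝ.Carrier × ℝ.Carrier
    ; _≈_ = λ (a , b) (c , d) → a ℝ.≈ c × b ℝ.≈ d
    ; _+_ = λ (a , b) (c , d) → a ℝ.+ c , b ℝ.+ d
    ; _*_ = λ (a , b) (c , d) → a ℝ.* c ℝ.- b ℝ.* d , a ℝ.* d ℝ.+ b ℝ.* c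
    ; -_ = λ (a , b) → ℝ.- a , ℝ.- b
    ; 0# = ℝ.0# , ℝ.0#
    ; 1# = ℝ.1# , ℝ.0#
    ; isCommutativeRing = record
      { isRing = record
        { +-isAbelianGroup = AbelianGroup.isAbelianGroup (×-Algebra.abelianGroup ℝ.+-abelianGroup ℝ.+-abelianGroup)
        ; *-cong = λ (p , q) (r , s) →
            ℝ.+-cong (ℝ.*-cong p r) (ℝ.-‿cong (ℝ.*-cong q s)) , ℝ.+-cong (ℝ.*-cong p s) (ℝ.*-cong q r)
        ; *-assoc = λ (a , b) (c , d) (e , f) → assoc-re a b c d e f , assoc-im a b c d e f
        ; *-identity =
            (λ (a , b) → one-re a b , one-im a b)
          , (λ (a , b) → ℝ.trans (comm-re a b ℝ.1# ℝ.0#) (one-re a b) , ℝ.trans (comm-im a b ℝ.1# ℝ.0#) (one-im a b))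
        ; distrib =
            (λ (a , b) (c , d) (e , f) → distrib-re a b c d e f , distrib-im a b c d e f)
          , (λ (a , b) (c , d) (e , f) → distribʳ-re a b c d e f , distribʳ-im a b c d e f)
        }
      ; *-comm = λ (a , b) (c , d) → comm-re a b c d , comm-im a b c d
      }
    }
    where
    open CommutativeRing (RealNumbers.commutativeRing ℝ)
    open Algebra.Properties.Ring (CommutativeRing.ring (RealNumbers.commutativeRing ℝ))
    open Algebra.Properties.AbelianGroup +-abelianGroup using (⁻¹-∙-comm; ⁻¹-involutive)
    open Algebra.Solver.Ring.NaturalCoefficients.Default commutativeSemiring
    open Relation.Binary.Reasoning.Setoid setoid

    x-y≈z-w : ∀ {x y z w} → x + w ≈ z + y → x - y ≈ z - w
    x-y≈z-w {x} {y} {z} {w} e = begin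
      x - y                ≈⟨ +-identityʳ _ ⟨
      x - y + 0#           ≈⟨ +-congˡ (-‿inverseʳ w) ⟨
      x - y + (w - w)      ≈⟨ solve 4 (λ a b c d → (a :+ b) :+ (c :+ d) := (a :+ c) :+ (b :+ d)) refl x (- y) w (- w) ⟩
      (x + w) + (- y - w)  ≈⟨ +-congʳ e ⟩
      (z + y) + (- y - w)  ≈⟨ solve 4 (λ a b c d → (a :+ b) :+ (c :+ d) := (a :+ d) :+ (b :+ c)) refl z y (- y) (- w) ⟩
      z - w + (y - y)      ≈⟨ +-congˡ (-‿inverseʳ y) ⟩
      z - w + 0#           ≈⟨ +-identityʳ _ ⟩
      z - w                ∎

    sub-sub : ∀ x y z → x - y - z ≈ x - (y + z)
    sub-sub x y z = trans (+-assoc x (- y) (- z)) (+-congˡ (⁻¹-∙-comm y z))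

    sub-add : ∀ x y z → (x - y) + z ≈ (x + z) - y
    sub-add x y z = solve 3 (λ a b c → (a :+ b) :+ c := (a :+ c) :+ b) refl x (- y) z

    assoc-re : ∀ a b c d e f → (a * c - b * d) * e - (a * d + b * c) * f ≈ a * (c * e - d * f) - b * (c * f + d * e)
    assoc-re a b c d e f = begin
      (a * c - b * d) * e - (a * d + b * c) * f          ≈⟨ +-congʳ ([y-z]x≈yx-zx e (a * c) (b * d)) ⟩
      a * c * e - b * d * e - (a * d + b * c) * f        ≈⟨ sub-sub _ _ _ ⟩
      a * c * e - (b * d * e + (a * d + b * c) * f)      ≈⟨ x-y≈z-w (solve 6 (λ a b c d e f →
        a :* c :* e :+ (a :* (d :* f) :+ b :* (c :* f :+ d :* e)) := a :* (c :* e) :+ (b :* d :* e :+ (a :* d :+ b :* c) :* f)) refl a b c d e f) ⟩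
      a * (c * e) - (a * (d * f) + b * (c * f + d * e))  ≈⟨ sub-sub _ _ _ ⟨
      a * (c * e) - a * (d * f) - b * (c * f + d * e)    ≈⟨ +-congʳ (x[y-z]≈xy-xz a (c * e) (d * f)) ⟨
      a * (c * e - d * f) - b * (c * f + d * e)          ∎

    assoc-im : ∀ a b c d e f → (a * c - b * d) * f + (a * d + b * c) * e ≈ a * (c * f + d * e) + b * (c * e - d * f)
    assoc-im a b c d e f = begin
      (a * c - b * d) * f + (a * d + b * c) * e          ≈⟨ +-congʳ ([y-z]x≈yx-zx f (a * c) (b * d)) ⟩
      a * c * f - b * d * f + (a * d + b * c) * e        ≈⟨ sub-add _ _ _ ⟩
      a * c * f + (a * d + b * c) * e - b * d * f        ≈⟨ x-y≈z-w (solve 6 (λ a b c d e f →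
        (a :* c :* f :+ (a :* d :+ b :* c) :* e) :+ b :* (d :* f) := (a :* (c :* f :+ d :* e) :+ b :* (c :* e)) :+ b :* d :* f) refl a b c d e f) ⟩
      a * (c * f + d * e) + b * (c * e) - b * (d * f)    ≈⟨ +-assoc _ _ _ ⟩
      a * (c * f + d * e) + (b * (c * e) - b * (d * f))  ≈⟨ +-congˡ (x[y-z]≈xy-xz b (c * e) (d * f)) ⟨
      a * (c * f + d * e) + b * (c * e - d * f)          ∎

    comm-re : ∀ a b c d → a * c - b * d ≈ c * a - d * b
    comm-re a b c d = +-cong (*-comm a c) (-‿cong (*-comm b d))

    comm-im : ∀ a b c d → a * d + b * c ≈ c * b + d * a
    comm-im = solve 4 (λ a b c d → a :* d :+ b :* c := c :* b :+ d :* a) refl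

    one-re : ∀ a b → 1# * a - 0# * b ≈ a
    one-re a b = begin
      1# * a - 0# * b  ≈⟨ +-cong (*-identityˡ a) (-‿cong (zeroˡ b)) ⟩
      a - 0#           ≈⟨ +-congˡ -0#≈0# ⟩
      a + 0#           ≈⟨ +-identityʳ a ⟩
      a                ∎

    one-im : ∀ a b → 1# * b + 0# * a ≈ b
    one-im = solve 2 (λ a b → con 1 :* b :+ con 0 :* a := b) refl

    distrib-re : ∀ a b c d e f → a * (c + e) - b * (d + f) ≈ (a * c - b * d) + (a * e - b * f)
    distrib-re a b c d e f = begin
      a * (c + e) - b * (d + f)            ≈⟨ +-cong (distribˡ a c e) (-‿cong (distribˡ b d f)) ⟩
      (a * c + a * e) - (b * d + b * f)    ≈⟨ +-congˡ (⁻¹-∙-comm _ _) ⟨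
      (a * c + a * e) + (- (b * d) - b * f) ≈⟨ solve 4 (λ x y z w → (x :+ y) :+ (z :+ w) := (x :+ z) :+ (y :+ w)) refl (a * c) (a * e) (- (b * d)) (- (b * f)) ⟩
      (a * c - b * d) + (a * e - b * f)    ∎

    distrib-im : ∀ a b c d e f → a * (d + f) + b * (c + e) ≈ (a * d + b * c) + (a * f + b * e)
    distrib-im = solve 6 (λ a b c d e f → a :* (d :+ f) :+ b :* (c :+ e) := (a :* d :+ b :* c) :+ (a :* f :+ b :* e)) refl

    distribʳ-re : ∀ a b c d e f → (c + e) * a - (d + f) * b ≈ (c * a - d * b) + (e * a - f * b)
    distribʳ-re a b c d e f = begin
      (c + e) * a - (d + f) * b          ≈⟨ comm-re (c + e) (d + f) a b ⟩
      a * (c + e) - b * (d + f)          ≈⟨ distrib-re a b c d e f ⟩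
      (a * c - b * d) + (a * e - b * f)  ≈⟨ +-cong (comm-re a b c d) (comm-re a b e f) ⟩
      (c * a - d * b) + (e * a - f * b)  ∎

    distribʳ-im : ∀ a b c d e f → (c + e) * b + (d + f) * a ≈ (c * b + d * a) + (e * b + f * a)
    distribʳ-im = solve 6 (λ a b c d e f → (c :+ e) :* b :+ (d :+ f) :* a := (c :* b :+ d :* a) :+ (e :* b :+ f :* a)) refl

  open CommutativeRing ℂ-ring public

  ofReal : ℝ.Carrier → Carrier
  ofReal x = x , ℝ.0#

  i·_ : ℝ.Carrier → Carrier
  i· x = ℝ.0# , x

  Im : Carrier → ℝ.Carrier
  Im = proj₂

  normSq : Carrier → ℝ.Carrier
  normSq (a , b) = a ℝ.* a ℝ.+ b ℝ.* b

-- ℂ = ℝ × ℝ with exp and π. The function exp is pinned down as the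
-- homomorphism from (ℂ, +) to (ℂ, ·) with derivative 1 at 0, and π as the
-- positive real with exp(iπ) = -1 and sin > 0 on (0, π).
record ComplexNumbers : Set₁ where
  field
    ℝ : RealNumbers
  private
    module ℝ = RealNumbers ℝ
    module ℂ = Complex ℝ
  field
    exp            : ℂ.Carrier → ℂ.Carrier
    exp-cong       : ∀ {z w} → z ℂ.≈ w → exp z ℂ.≈ exp w
    exp-+          : ∀ z w → exp (z ℂ.+ w) ℂ.≈ exp z ℂ.* exp w
    exp-derivative : ∀ ε → ℝ.0# ℝ.< ε → ∃[ δ ] ℝ.0# ℝ.< δ ×
                     (∀ z → ℂ.normSq z ℝ.< δ →
                      ℂ.normSq (exp z ℂ.- ℂ.1# ℂ.- z) ℝ.≤ ε ℝ.* ℂ.normSq z)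
    π              : ℝ.Carrier
    0<π            : ℝ.0# ℝ.< π
    exp-iπ         : exp (ℂ.i· π) ℂ.≈ ℂ.- ℂ.1#
    sin-pos        : ∀ t → ℝ.0# ℝ.< t → t ℝ.< π → ℝ.0# ℝ.< ℂ.Im (exp (ℂ.i· t))

  open Complex ℝ public using (ℂ-ring; ofReal)

  exp2πi : ℚ → ℂ.Carrier
  exp2πi q = exp (ℂ.i· ((ℝ.1# ℝ.+ ℝ.1#) ℝ.* π ℝ.* ℝ.fromℚ q))

  invSqrt : ℕ → ℂ.Carrier
  invSqrt n = ofReal (ℝ.invSqrt n)

module _ (X : FiniteSet) where
  private module X = FiniteSet X

  ∑-over : (G : CommutativeMonoid 0ℓ 0ℓ) → (X.Carrier → CommutativeMonoid.Carrier G) → CommutativeMonoid.Carrier G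
  ∑-over G f = sum (f ∘ X.enum)
    where open Algebra.Properties.CommutativeMonoid.Sum G using (sum)

  ∑-in : (G : CommutativeMonoid 0ℓ 0ℓ) {P : Pred X.Carrier 0ℓ} → Decidable P →
         (X.Carrier → CommutativeMonoid.Carrier G) → CommutativeMonoid.Carrier G
  ∑-in G P? f = ∑-over G (λ x → if does (P? x) then f x else CommutativeMonoid.ε G)

  cardinality : {P : Pred X.Carrier 0ℓ} → Decidable P → ℕ
  cardinality P? = ∑-in ℕ.+-0-commutativeMonoid P? (λ _ → 1)

module Linear (K : CommutativeRing 0ℓ 0ℓ) where
  private module K = CommutativeRing K

  Space : Set₁
  Space = LeftModule K.ring 0ℓ 0ℓ

  module _ (M : Space) where
    open LeftModule M

    combination : ∀ {i} {I : Set i} → (I → Carrierᴹ) → List (K.Carrier × I) → Carrierᴹ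
    combination x []             = 0ᴹ
    combination x ((c , i) ∷ cs) = c *ₗ x i +ᴹ combination x cs

    Span : ∀ {i} {I : Set i} → (I → Carrierᴹ) → Pred Carrierᴹ i
    Span x y = ∃[ cs ] y ≈ᴹ combination x cs

    Generates : ∀ {i p} {I : Set i} → (I → Carrierᴹ) → Pred Carrierᴹ p → Set (i ⊔ p)
    Generates x P = (∀ i → P (x i)) × (∀ y → P y → Span x y)

  record LinearMap (M N : Space) : Set where
    private
      module M = LeftModule M
      module N = LeftModule N
    infixl 20 _$$_
    field
      _$$_           : M.Carrierᴹ → N.Carrierᴹ
      isHomomorphism : IsLeftModuleHomomorphism M.rawLeftModule N.rawLeftModule _$$_

    open IsLeftModuleHomomorphism isHomomorphism public using (⟦⟧-cong; *ₗ-homo; +ᴹ-homo)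

  open LinearMap public using (_$$_)

  module _ {M N : Space} where
    private
      module M = LeftModule M
      module N = LeftModule N

    mkLinear : (f : M.Carrierᴹ → N.Carrierᴹ) → (∀ {x y} → x M.≈ᴹ y → f x N.≈ᴹ f y) →
               (∀ x y → f (x M.+ᴹ y) N.≈ᴹ f x N.+ᴹ f y) → (∀ c x → f (c M.*ₗ x) N.≈ᴹ c N.*ₗ f x) →
               LinearMap M N
    mkLinear f f-cong f-+ f-* = record
      { _$$_ = f
      ; isHomomorphism = record
        { +ᴹ-isGroupHomomorphism = Additive.isGroupHomomorphism
            (mkAdditive {M.+ᴹ-abelianGroup} {N.+ᴹ-abelianGroup} f-cong f-+)
        ; *ₗ-homo = f-*
        }
      }

  idᴸ : ∀ {M} → LinearMap M M
  idᴸ {M} = mkLinear id id (λ _ _ → LeftModule.≈ᴹ-refl M) (λ _ _ → LeftModule.≈ᴹ-refl M)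

  infixr 9 _∘ᴸ_
  _∘ᴸ_ : ∀ {M N P} → LinearMap N P → LinearMap M N → LinearMap M P
  _∘ᴸ_ {M} {N} {P} g f = mkLinear (λ x → g $$ (f $$ x))
    (λ e → g.⟦⟧-cong (f.⟦⟧-cong e))
    (λ x y → trans (g.⟦⟧-cong (f.+ᴹ-homo x y)) (g.+ᴹ-homo _ _))
    (λ c x → trans (g.⟦⟧-cong (f.*ₗ-homo c x)) (g.*ₗ-homo c _))
    where
    module f = LinearMap f
    module g = LinearMap g
    open LeftModule P using () renaming (≈ᴹ-trans to trans)

  module _ (M N : Space) where
    private
      module M = LeftModule M
      module N = LeftModule N
      open LinearMap
      +N-interchange = interchange {N.+ᴹ-abelianGroup} {N.+ᴹ-abelianGroup}

      open Relation.Binary.Reasoning.Setoid N.≈ᴹ-setoid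

    Hom : Space
    Hom = record
      { Carrierᴹ = LinearMap M N
      ; _≈ᴹ_ = λ S T → ∀ x → S $$ x N.≈ᴹ T $$ x
      ; _+ᴹ_ = λ S T → mkLinear (λ x → S $$ x N.+ᴹ T $$ x)
          (λ e → N.+ᴹ-cong (⟦⟧-cong S e) (⟦⟧-cong T e))
          (λ x y → N.≈ᴹ-trans (N.+ᴹ-cong (+ᴹ-homo S x y) (+ᴹ-homo T x y)) (+N-interchange _ _ _ _))
          (λ c x → N.≈ᴹ-trans (N.+ᴹ-cong (*ₗ-homo S c x) (*ₗ-homo T c x)) (N.≈ᴹ-sym (N.*ₗ-distribˡ c _ _)))
      ; _*ₗ_ = λ c T → mkLinear (λ x → c N.*ₗ T $$ x)
          (λ e → N.*ₗ-congˡ (⟦⟧-cong T e))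
          (λ x y → N.≈ᴹ-trans (N.*ₗ-congˡ (+ᴹ-homo T x y)) (N.*ₗ-distribˡ c _ _))
          (λ d x → begin
            c N.*ₗ T $$ (d M.*ₗ x)     ≈⟨ N.*ₗ-congˡ (*ₗ-homo T d x) ⟩
            c N.*ₗ d N.*ₗ T $$ x       ≈⟨ N.*ₗ-assoc c d _ ⟨
            (c K.* d) N.*ₗ T $$ x      ≈⟨ N.*ₗ-congʳ (K.*-comm c d) ⟩
            (d K.* c) N.*ₗ T $$ x      ≈⟨ N.*ₗ-assoc d c _ ⟩
            d N.*ₗ c N.*ₗ T $$ x       ∎)
      ; 0ᴹ = mkLinear (λ _ → N.0ᴹ) (λ _ → N.≈ᴹ-refl) (λ _ _ → N.≈ᴹ-sym (N.+ᴹ-identityˡ N.0ᴹ)) (λ c _ → N.≈ᴹ-sym (N.*ₗ-zeroʳ c))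
      ; -ᴹ_ = λ T → mkLinear (λ x → N.-ᴹ (T $$ x))
          (λ e → N.-ᴹ‿cong (⟦⟧-cong T e))
          (λ x y → N.≈ᴹ-trans (N.-ᴹ‿cong (+ᴹ-homo T x y)) (N.≈ᴹ-sym (⁻¹-∙-comm _ _)))
          (λ c x → N.≈ᴹ-trans (N.-ᴹ‿cong (*ₗ-homo T c x)) (N.≈ᴹ-sym (Additive.-‿homo (*ₗ-additive N c) _)))
      ; isLeftModule = record
        { isLeftSemimodule = record
          { +ᴹ-isCommutativeMonoid = record
            { isMonoid = record
              { isSemigroup = record
                { isMagma = record
                  { isEquivalence = record
                    { refl = λ _ → N.≈ᴹ-refl
                    ; sym = λ e x → N.≈ᴹ-sym (e x)
                    ; trans = λ e e′ x → N.≈ᴹ-trans (e x) (e′ x)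
                    }
                  ; ∙-cong = λ e e′ x → N.+ᴹ-cong (e x) (e′ x)
                  }
                ; assoc = λ _ _ _ _ → N.+ᴹ-assoc _ _ _
                }
              ; identity = (λ _ _ → N.+ᴹ-identityˡ _) , (λ _ _ → N.+ᴹ-identityʳ _)
              }
            ; comm = λ _ _ _ → N.+ᴹ-comm _ _
            }
          ; isPreleftSemimodule = record
            { *ₗ-cong = λ p e x → N.*ₗ-cong p (e x)
            ; *ₗ-zeroˡ = λ _ _ → N.*ₗ-zeroˡ _
            ; *ₗ-distribʳ = λ _ _ _ _ → N.*ₗ-distribʳ _ _ _
            ; *ₗ-identityˡ = λ _ _ → N.*ₗ-identityˡ _
            ; *ₗ-assoc = λ _ _ _ _ → N.*ₗ-assoc _ _ _
            ; *ₗ-zeroʳ = λ _ _ → N.*ₗ-zeroʳ _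
            ; *ₗ-distribˡ = λ _ _ _ _ → N.*ₗ-distribˡ _ _ _
            }
          }
        ; -ᴹ‿cong = λ e x → N.-ᴹ‿cong (e x)
        ; -ᴹ‿inverse = (λ _ _ → N.-ᴹ‿inverseˡ _) , (λ _ _ → N.-ᴹ‿inverseʳ _)
        }
      }
      where open Algebra.Properties.AbelianGroup N.+ᴹ-abelianGroup using (⁻¹-∙-comm)

  End : Space → Space
  End M = Hom M M

  𝕂 : Space
  𝕂 = TensorUnit.leftModule

  _* : Space → Space
  M * = Hom M 𝕂

  module _ (X : FiniteSet) where
    private module X = FiniteSet X

    -- The space with basis X, its elements written as coefficient functions.
    Free : Space
    Free = record
      { Carrierᴹ = Func X.setoid K.setoid
      ; _≈ᴹ_ = λ f g → ∀ x → (f ⟨$⟩ x) K.≈ (g ⟨$⟩ x)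
      ; _+ᴹ_ = λ f g → record { to = λ x → (f ⟨$⟩ x) K.+ (g ⟨$⟩ x) ; cong = λ e → K.+-cong (Func.cong f e) (Func.cong g e) }
      ; _*ₗ_ = λ c f → record { to = λ x → c K.* (f ⟨$⟩ x) ; cong = λ e → K.*-congˡ (Func.cong f e) }
      ; 0ᴹ = record { to = λ _ → K.0# ; cong = λ _ → K.refl }
      ; -ᴹ_ = λ f → record { to = λ x → K.- (f ⟨$⟩ x) ; cong = λ e → K.-‿cong (Func.cong f e) }
      ; isLeftModule = record
        { isLeftSemimodule = record
          { +ᴹ-isCommutativeMonoid = record
            { isMonoid = record
              { isSemigroup = record
                { isMagma = record
                  { isEquivalence = record
                    { refl = λ _ → K.refl
                    ; sym = λ e x → K.sym (e x)
                    ; trans = λ e e′ x → K.trans (e x) (e′ x)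
                    }
                  ; ∙-cong = λ e e′ x → K.+-cong (e x) (e′ x)
                  }
                ; assoc = λ _ _ _ _ → K.+-assoc _ _ _
                }
              ; identity = (λ _ _ → K.+-identityˡ _) , (λ _ _ → K.+-identityʳ _)
              }
            ; comm = λ _ _ _ → K.+-comm _ _
            }
          ; isPreleftSemimodule = record
            { *ₗ-cong = λ p e x → K.*-cong p (e x)
            ; *ₗ-zeroˡ = λ _ _ → K.zeroˡ _
            ; *ₗ-distribʳ = λ _ _ _ _ → K.distribʳ _ _ _
            ; *ₗ-identityˡ = λ _ _ → K.*-identityˡ _
            ; *ₗ-assoc = λ _ _ _ _ → K.*-assoc _ _ _
            ; *ₗ-zeroʳ = λ _ _ → K.zeroʳ _
            ; *ₗ-distribˡ = λ _ _ _ _ → K.distribˡ _ _ _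
            }
          }
        ; -ᴹ‿cong = λ e x → K.-‿cong (e x)
        ; -ᴹ‿inverse = (λ _ _ → K.-‿inverseˡ _) , (λ _ _ → K.-‿inverseʳ _)
        }
      }

    basis : X.Carrier → LeftModule.Carrierᴹ Free
    basis x = record
      { to = λ y → if does (x X.≟ y) then K.1# else K.0#
      ; cong = λ {y} {z} y≈z → δ-cong y z y≈z
      }
      where
      δ-cong : ∀ y z → y X.≈ z → (if does (x X.≟ y) then K.1# else K.0#) K.≈ (if does (x X.≟ z) then K.1# else K.0#)
      δ-cong y z y≈z with x X.≟ y | x X.≟ z
      ... | yes _   | yes _   = K.refl
      ... | no _    | no _    = K.refl
      ... | yes x≈y | no x≉z  = contradiction (X.trans x≈y y≈z) x≉z
      ... | no x≉y  | yes x≈z = contradiction (X.trans x≈z (X.sym y≈z)) x≉y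

    dualBasis : X.Carrier → LeftModule.Carrierᴹ (Free *)
    dualBasis x = mkLinear {Free} {𝕂} (λ f → f ⟨$⟩ x) (λ e → e x) (λ _ _ → K.refl) (λ _ _ → K.refl)

    -- The linear map sending basis x to F x.
    extend : {M : Space} → (X.Carrier → LeftModule.Carrierᴹ M) → LinearMap Free M
    extend {M} F = mkLinear (λ f → ∑-over X +ᴹ-commutativeMonoid (λ x → (f ⟨$⟩ x) *ₗ F x))
      (λ e → sum-cong-≋ (λ k → *ₗ-congʳ (e (X.enum k))))
      (λ f g → ≈ᴹ-trans
        (sum-cong-≋ (λ k → *ₗ-distribʳ (F (X.enum k)) (f ⟨$⟩ X.enum k) (g ⟨$⟩ X.enum k)))
        (∑-distrib-+ (λ k → (f ⟨$⟩ X.enum k) *ₗ F (X.enum k)) (λ k → (g ⟨$⟩ X.enum k) *ₗ F (X.enum k))))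
      (λ c f → ≈ᴹ-trans
        (sum-cong-≋ (λ k → *ₗ-assoc c (f ⟨$⟩ X.enum k) (F (X.enum k))))
        (≈ᴹ-sym (*ₗ-sum c (λ k → (f ⟨$⟩ X.enum k) *ₗ F (X.enum k)))))
      where
      open LeftModule M
      open Algebra.Properties.CommutativeMonoid.Sum +ᴹ-commutativeMonoid using (sum; sum-cong-≋; ∑-distrib-+)

      *ₗ-sum : ∀ {n} c (v : Fin n → Carrierᴹ) → c *ₗ sum v ≈ᴹ sum (λ k → c *ₗ v k)
      *ₗ-sum {zero}  c v = *ₗ-zeroʳ c
      *ₗ-sum {suc n} c v = ≈ᴹ-trans (*ₗ-distribˡ c _ _) (+ᴹ-congˡ (*ₗ-sum c (v ∘ suc)))

  -- Free (X ^ᶠ N) is the N-fold tensor power of Free X, with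
  -- basis x = basis (x 0) ⊗ ... ⊗ basis (x (N - 1)).
  tensorPower : ∀ X N → LinearMap (Free X) (Free X) → LinearMap (Free (X ^ᶠ N)) (Free (X ^ᶠ N))
  tensorPower X N g = extend (X ^ᶠ N) λ x → record
    { to = λ y → product λ i → (g $$ basis X (x i)) ⟨$⟩ y i
    ; cong = λ e → sum-cong-≋ λ i → Func.cong (g $$ basis X (x i)) (e i)
    }
    where
    open Algebra.Properties.CommutativeMonoid.Sum K.*-commutativeMonoid using (sum-cong-≋) renaming (sum to product)

  rankOne : ∀ {M : Space} → LeftModule.Carrierᴹ M → LinearMap M 𝕂 → LinearMap M M
  rankOne {M} w f = mkLinear (λ x → (f $$ x) *ₗ w)
    (λ e → *ₗ-congʳ (⟦⟧-cong e))
    (λ x y → ≈ᴹ-trans (*ₗ-congʳ (+ᴹ-homo x y)) (*ₗ-distribʳ w _ _))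
    (λ c x → ≈ᴹ-trans (*ₗ-congʳ (*ₗ-homo c x)) (*ₗ-assoc c _ w))
    where
    open LeftModule M
    open LinearMap f using (⟦⟧-cong; +ᴹ-homo; *ₗ-homo)

  -- W ⊗ W* → End W, w ⊗ f ↦ (x ↦ f(x)w), for W = Free X. The vector
  -- basis (x , y) of Free (X ×ᶠ X) stands for basis x ⊗ dualBasis y.
  φ : ∀ X → LinearMap (Free (X ×ᶠ X)) (End (Free X))
  φ X = extend (X ×ᶠ X) λ (x , y) → rankOne (basis X x) (dualBasis X y)

module _ (𝒞 : ComplexNumbers) where
  open ComplexNumbers 𝒞
  open Linear ℂ-ring

  module _ {F : FormRing} (ρ : FiniteRep F) where
    open FormRing F using (module R; module Φ)
    open FiniteRep ρ

    ℂV : Space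
    ℂV = Free V.finiteSet

    private
      module ℂV = LeftModule ℂV

      b : V.Carrierᴹ → ℂV.Carrierᴹ
      b = basis V.finiteSet

    fwe : Code ρ → ℂV.Carrierᴹ
    fwe C = ∑-in V.finiteSet ℂV.+ᴹ-commutativeMonoid (Code._∈C? C) b

    m-op : R.Carrier → LinearMap ℂV ℂV
    m-op r = extend V.finiteSet λ w → b (r V.*ₗ w)

    d-op : Φ.Carrier → LinearMap ℂV ℂV
    d-op φ = extend V.finiteSet λ w → exp2πi (quad φ w) ℂV.*ₗ b w

    Image : R.Carrier → Pred V.Carrierᴹ 0ℓ
    Image r x = ∃[ y ] x V.≈ᴹ r V.*ₗ y

    image? : ∀ r → Decidable (Image r)
    image? r x = ∃? (λ y≈z e → V.≈ᴹ-trans e (V.*ₗ-congˡ y≈z)) (λ y → x ≟ r V.*ₗ y)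
      where open Finite V.finite using (∃?; _≟_)

    h-op : (ι v : R.Carrier) → LinearMap ℂV ℂV
    h-op ι v = extend V.finiteSet λ w →
      invSqrt (cardinality V.finiteSet (image? ι)) ℂV.*ₗ
      ∑-in V.finiteSet ℂV.+ᴹ-commutativeMonoid (image? ι) λ u →
        exp2πi (β u (v V.*ₗ w)) ℂV.*ₗ b (u V.+ᴹ (R.1# R.- ι) V.*ₗ w)

    module _ (S : SymmetricIdempotents F) where
      open SymmetricIdempotents S

      data CliffordWeil : LinearMap ℂV ℂV → Set where
        m-gen : ∀ r → IsUnit (FormRing.R F) r → CliffordWeil (m-op r)
        d-gen : ∀ φ → CliffordWeil (d-op φ)
        h-gen : ∀ i → CliffordWeil (h-op (ι i) (v i))
        one   : CliffordWeil idᴸ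
        mul   : ∀ {g g′} → CliffordWeil g → CliffordWeil g′ → CliffordWeil (g ∘ᴸ g′)
        inv   : ∀ {g g′} → CliffordWeil g → (∀ x → g $$ (g′ $$ x) ℂV.≈ᴹ x) → (∀ x → g′ $$ (g $$ x) ℂV.≈ᴹ x) →
                CliffordWeil g′
        resp  : ∀ {g g′} → (∀ x → g $$ x ℂV.≈ᴹ g′ $$ x) → CliffordWeil g → CliffordWeil g′

      Fixed : Pred ℂV.Carrierᴹ 0ℓ
      Fixed x = ∀ g → CliffordWeil g → g $$ x ℂV.≈ᴹ x

      Commuting : ∀ N → Pred (LinearMap (Free (V.finiteSet ^ᶠ N)) (Free (V.finiteSet ^ᶠ N))) 0ℓ
      Commuting N T = ∀ g → CliffordWeil g → ∀ x →
        LeftModule._≈ᴹ_ (Free (V.finiteSet ^ᶠ N)) (T $$ (gᴺ g $$ x)) (gᴺ g $$ (T $$ x))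
        where gᴺ = tensorPower V.finiteSet N

  WeightEnumeratorConjecture : (F : FormRing) → SymmetricIdempotents F → Set₁
  WeightEnumeratorConjecture F S = ∀ (ρ : FiniteRep F) →
    Generates (ℂV ρ) {I = Σ (Code ρ) (OfType ρ)} (λ (C , _) → fwe ρ C) (Fixed ρ S)

{-# OPTIONS --safe #-}
module Submission where

-- Write F for the matrix of an endomorphism of ℂV^N, regarded as a vector of ℂV^N ⊗ (ℂV^N)* = ℂV^(2N). A
-- generator of the Clifford-Weil group of ρ has an invertible matrix A, and complex conjugation of the
-- characters in A yields the inverse transpose B of A: for the generators h this is the orthogonality of the
-- characters u ↦ exp(2πi β(u, v w)) of ιV, on which β(·, v ·) is non-degenerate. Since ρ^(N,N) consists of N
-- copies of ρ and N copies of its negative, the corresponding generator for ρ^(N,N) is the tensor product of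
-- the N-th tensor powers of A and B, so it maps F to A^⊗N F (A^⊗N)⁻¹. Hence F is fixed by the Clifford-Weil
-- group of ρ^(N,N) if and only if it commutes with that of ρ, and the conjecture for ρ^(N,N) describes
-- these F.

open import Algebra.Apartness.Bundles using (HeytingField)
import Algebra.Apartness.Properties.HeytingCommutativeRing
open import Algebra.Bundles using (AbelianGroup; CommutativeMonoid; CommutativeRing; CommutativeSemiring; Ring)
open import Algebra.Module.Bundles using (LeftModule)
open import Algebra.Module.Morphism.Structures using (IsLeftModuleHomomorphism)
import Algebra.Properties.AbelianGroup
import Algebra.Properties.CommutativeMonoid.Sum
import Algebra.Properties.CommutativeSemigroup
import Algebra.Properties.Monoid.Mult
import Algebra.Properties.Ring
import Algebra.Properties.Semiring.Mult
import Algebra.Properties.Semiring.Sum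
import Algebra.Solver.Ring.NaturalCoefficients.Default
open import Data.Bool.Base using (if_then_else_)
open import Data.Fin.Base using (Fin; _↑ʳ_; _↑ˡ_; finToFun; remQuot; suc; zero)
import Data.Fin.Permutation as Perm
import Data.Fin.Properties as Fin
open import Data.Integer.Base as ℤ using (ℤ)
import Data.Integer.DivMod as ℤ
import Data.Integer.Properties as ℤ
open import Data.List.Base as List using (List; []; _∷_)
open import Data.Nat.Base as ℕ using (_≤_; suc; zero; ℕ)
import Data.Nat.Properties as ℕ
open import Data.Product.Base using (_,_; _×_; map₂; proj₁; proj₂; Σ; ∃-syntax)
open import Data.Rational.Base as ℚ using (mkℚ; ℚ)
import Data.Rational.Properties as ℚ
open import Data.Rational.Unnormalised.Base as ℚᵘ using (*≡*; mkℚᵘ; ℚᵘ)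
open import Data.Sum.Base using (_⊎_; inj₁; inj₂)
open import Defs
open import Function.Base using (_$′_; _∘_; id)
open import Function.Bundles using (Equivalence; Func; Inverse; _⟨$⟩_)
open import Level using (0ℓ)
open import Relation.Binary.PropositionalEquality as ≡ using (_≡_; _≢_)
import Relation.Binary.Reasoning.Setoid
open import Relation.Binary.Structures using (IsStrictPartialOrder)
open import Relation.Nullary using (Dec; does; no; yes; ¬_)
open import Relation.Nullary.Negation using (contradiction)
open import Relation.Unary using (Decidable; Pred; _≐_)

-- Sums over finite sets

-- The two groups have generators with the same labels (a unit r, an element φ of Φ, an idempotent ι
-- with its v). The correspondence is therefore checked label by label, and it reaches all group
-- elements because commuting with T and fixing F are both stable under products and inverses. For h
-- it also requires the normalising constants to match, and they do since ιV^(2N) = (ιV)^(2N).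
-- Complex conjugation never occurs as an operation: B is A with the exponents negated, so the
-- linear algebra runs over any commutative ring with a suitable character e of ℚ/ℤ. The obstacle is
-- constructive. A character sum S satisfies S = S e(q) after a translation, and without decidable
-- equality the conclusion S = 0 needs an inverse of e(q) - 1, not merely e(q) ≠ 1. The positivity
-- of the sine on (0, π) supplies this inverse, and the triviality of a character is settled by a
-- search through the finite module.

module FiniteSums (S : CommutativeSemiring 0ℓ 0ℓ) where
  open CommutativeSemiring S hiding (zero)
  open Algebra.Properties.Semiring.Sum semiring public
  open Algebra.Properties.CommutativeMonoid.Sum *-commutativeMonoid using ()
    renaming (sum to product; sum-cong-≋ to product-cong; ∑-distrib-+ to product-distrib-*)
    public
  open Relation.Binary.Reasoning.Setoid setoid

  ind : {P : Set} → Dec P → Carrier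
  ind P? = if does P? then 1# else 0#

  ind-yes : {P : Set} (P? : Dec P) → P → ind P? ≈ 1#
  ind-yes (yes _) _ = refl
  ind-yes (no ¬p) p = contradiction p ¬p

  ind-no : {P : Set} (P? : Dec P) → ¬ P → ind P? ≈ 0#
  ind-no (yes p) ¬p = contradiction p ¬p
  ind-no (no _)  _  = refl

  ind-⇔ : {P Q : Set} (P? : Dec P) (Q? : Dec Q) → (P → Q) → (Q → P) → ind P? ≈ ind Q?
  ind-⇔ (yes p) Q? f g = sym (ind-yes Q? (f p))
  ind-⇔ (no ¬p) Q? f g = sym (ind-no Q? (¬p ∘ g))

  ind-∧ : {P Q R : Set} (P? : Dec P) (Q? : Dec Q) (R? : Dec R) → (P × Q → R) → (R → P × Q) →
          ind P? * ind Q? ≈ ind R?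
  ind-∧ (yes p) Q? R? f g = trans (*-identityˡ _) (ind-⇔ Q? R? (λ q → f (p , q)) (proj₂ ∘ g))
  ind-∧ (no ¬p) Q? R? f g = trans (zeroˡ _) (sym (ind-no R? (¬p ∘ proj₁ ∘ g)))

  ind-∀ : ∀ {N} {P : Fin N → Set} {R : Set} (P? : ∀ i → Dec (P i)) (R? : Dec R) → ((∀ i → P i) → R) → (R → ∀ i → P i) →
          product (λ i → ind (P? i)) ≈ ind R?
  ind-∀ {zero}          P? R? f g = sym (ind-yes R? (f λ ()))
  ind-∀ {suc N} {P} {R} P? R? f g with P? zero
  ... | no ¬p = trans (zeroˡ _) (sym (ind-no R? (λ r → ¬p (g r zero))))
  ... | yes p = trans (*-identityˡ _) (ind-∀ (P? ∘ suc) R? (λ ps → f λ { zero → p ; (suc i) → ps i }) (λ r → g r ∘ suc))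

  ind-idem : {P : Set} (P? : Dec P) → ind P? * ind P? ≈ ind P?
  ind-idem (yes _) = *-identityˡ 1#
  ind-idem (no _)  = zeroˡ 0#

  sum-single : ∀ {n} (i : Fin n) (f : Fin n → Carrier) → (∀ j → j ≢ i → f j ≈ 0#) → sum f ≈ f i
  sum-single {suc n} zero f z = begin
    f zero + sum (f ∘ suc)     ≈⟨ +-congˡ (sum-cong-≋ (λ j → z (suc j) λ ())) ⟩
    f zero + sum {n} (λ _ → 0#)  ≈⟨ +-congˡ (sum-replicate-zero n) ⟩
    f zero + 0#                ≈⟨ +-identityʳ _ ⟩
    f zero                     ∎
  sum-single (suc i) f z = begin
    f zero + sum (f ∘ suc)  ≈⟨ +-cong (z zero λ ()) (sum-single i (f ∘ suc) (λ j j≢i → z (suc j) (j≢i ∘ Fin.suc-injective))) ⟩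
    0# + f (suc i)          ≈⟨ +-identityˡ _ ⟩
    f (suc i)               ∎

  sum-split : ∀ m n (f : Fin (m ℕ.+ n) → Carrier) → sum f ≈ sum (f ∘ (_↑ˡ n)) + sum (f ∘ (m ↑ʳ_))
  sum-split zero    n f = sym (+-identityˡ _)
  sum-split (suc m) n f = trans (+-congˡ (sum-split m n (f ∘ suc))) (sym (+-assoc _ _ _))

  -- Both `X ×ᶠ Y` and `X ^ᶠ suc N` are enumerated through `remQuot`, so `Σ-×` and the induction
  -- step of `Σ-^` are instances.
  sum-remQuot : ∀ m n (f : Fin m × Fin n → Carrier) → sum {m ℕ.* n} (f ∘ remQuot n) ≈ sum {m} (λ i → sum {n} (λ j → f (i , j)))
  sum-remQuot zero    n f = refl
  sum-remQuot (suc m) n f = begin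
    sum (f ∘ remQuot n)
      ≈⟨ sum-split n (m ℕ.* n) (f ∘ remQuot n) ⟩
    sum (f ∘ remQuot n ∘ (_↑ˡ (m ℕ.* n))) + sum (f ∘ remQuot {suc m} n ∘ (n ↑ʳ_))
      ≈⟨ +-cong (sum-cong-≋ λ j → reflexive (first j)) (sum-cong-≋ λ k → reflexive (rest k)) ⟩
    sum (λ j → f (zero , j)) + sum (λ k → f (suc (proj₁ (remQuot {m} n k)) , proj₂ (remQuot {m} n k)))
      ≈⟨ +-congˡ (sum-remQuot m n (λ (i , j) → f (suc i , j))) ⟩
    sum (λ j → f (zero , j)) + sum (λ i → sum (λ j → f (suc i , j))) ∎
    where
    first : ∀ j → f (remQuot {suc m} n (j ↑ˡ (m ℕ.* n))) ≡ f (zero , j)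
    first j rewrite Fin.splitAt-↑ˡ n j (m ℕ.* n) = ≡.refl

    rest : ∀ k → f (remQuot {suc m} n (n ↑ʳ k)) ≡ f (suc (proj₁ (remQuot {m} n k)) , proj₂ (remQuot {m} n k))
    rest k rewrite Fin.splitAt-↑ʳ n (m ℕ.* n) k = ≡.refl

  Σ[_] : (X : FiniteSet) → (FiniteSet.Carrier X → Carrier) → Carrier
  Σ[ X ] = ∑-over X +-commutativeMonoid

  module _ (X : FiniteSet) where
    private
      module X = FiniteSet X
      module E = Inverse X.enumeration

    Σ-cong : ∀ {f g : X.Carrier → Carrier} → (∀ x → f x ≈ g x) → Σ[ X ] f ≈ Σ[ X ] g
    Σ-cong e = sum-cong-≋ (λ k → e (X.enum k))

    Σ-distribˡ : ∀ c (f : X.Carrier → Carrier) → c * Σ[ X ] f ≈ Σ[ X ] (λ x → c * f x)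
    Σ-distribˡ c f = *-distribˡ-sum c (f ∘ X.enum)

    Σ-distribʳ : ∀ c (f : X.Carrier → Carrier) → Σ[ X ] f * c ≈ Σ[ X ] (λ x → f x * c)
    Σ-distribʳ c f = *-distribʳ-sum c (f ∘ X.enum)

    Σ-0 : ∀ {f : X.Carrier → Carrier} → (∀ x → f x ≈ 0#) → Σ[ X ] f ≈ 0#
    Σ-0 e = trans (Σ-cong e) (sum-replicate-zero X.size)

    -- The enumeration meets the class of `a` in one representative, which need not be `a` itself;
    -- hence the value is prescribed on the whole class.
    Σ-single : ∀ a (f : X.Carrier → Carrier) {s} → (∀ x → x X.≈ a → f x ≈ s) → (∀ x → ¬ (x X.≈ a) → f x ≈ 0#) → Σ[ X ] f ≈ s
    Σ-single a f on off = trans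
      (sum-single (E.from a) (f ∘ X.enum) (λ j j≢ → off _ λ e → j≢ (≡.sym (E.inverseʳ (X.sym e)))))
      (on _ (E.strictlyInverseˡ a))

    Σ-bijection : (σ σ⁻¹ : X.Carrier → X.Carrier) →
                  (∀ {x y} → x X.≈ y → σ x X.≈ σ y) → (∀ {x y} → x X.≈ y → σ⁻¹ x X.≈ σ⁻¹ y) →
                  (∀ x → σ (σ⁻¹ x) X.≈ x) → (∀ x → σ⁻¹ (σ x) X.≈ x) →
                  (f : X.Carrier → Carrier) → (∀ {x y} → x X.≈ y → f x ≈ f y) →
                  Σ[ X ] (f ∘ σ) ≈ Σ[ X ] f
    Σ-bijection σ σ⁻¹ σ-cong σ⁻¹-cong σσ⁻¹ σ⁻¹σ f f-cong = sym (trans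
      (sum-permute (f ∘ X.enum) π)
      (sum-cong-≋ λ k → f-cong (E.strictlyInverseˡ (σ (X.enum k)))))
      where
      π : Perm.Permutation X.size X.size
      π = Perm.permutation (E.from ∘ σ ∘ X.enum) (E.from ∘ σ⁻¹ ∘ X.enum)
        (λ k → E.inverseʳ (X.trans (σ-cong (E.strictlyInverseˡ _)) (σσ⁻¹ _)))
        (λ k → E.inverseʳ (X.trans (σ⁻¹-cong (E.strictlyInverseˡ _)) (σ⁻¹σ _)))

  Σ-comm : ∀ X Y (f : FiniteSet.Carrier X → FiniteSet.Carrier Y → Carrier) →
           Σ[ X ] (λ x → Σ[ Y ] (λ y → f x y)) ≈ Σ[ Y ] (λ y → Σ[ X ] (λ x → f x y))
  Σ-comm X Y f = ∑-comm (λ i j → f (FiniteSet.enum X i) (FiniteSet.enum Y j))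

  Σ-× : ∀ X Y (f : FiniteSet.Carrier X × FiniteSet.Carrier Y → Carrier) →
        Σ[ X ×ᶠ Y ] f ≈ Σ[ X ] (λ x → Σ[ Y ] (λ y → f (x , y)))
  Σ-× X Y f = sum-remQuot X.size Y.size (λ (i , j) → f (X.enum i , Y.enum j))
    where
    module X = FiniteSet X
    module Y = FiniteSet Y

  -- Expansion of a product of sums: one term for each function choosing a summand in every factor.
  -- The multiplicativity of tensor powers rests on it.
  Σ-^ : ∀ X N (f : Fin N → FiniteSet.Carrier X → Carrier) →
        Σ[ X ^ᶠ N ] (λ x → product (λ i → f i (x i))) ≈ product (λ i → Σ[ X ] (f i))
  Σ-^ X zero    f = +-identityʳ 1#
  Σ-^ X (suc N) f = begin
    Σ[ X ^ᶠ suc N ] (λ x → product (λ i → f i (x i)))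
      ≈⟨ sum-remQuot X.size (X.size ℕ.^ N) (λ (a , k) → f zero (X.enum a) * product (λ i → f (suc i) (X.enum (finToFun k i)))) ⟩
    Σ[ X ] (λ a → Σ[ X ^ᶠ N ] (λ x → f zero a * product (λ i → f (suc i) (x i))))
      ≈⟨ Σ-cong X (λ a → Σ-distribˡ (X ^ᶠ N) (f zero a) (λ x → product (λ i → f (suc i) (x i)))) ⟨
    Σ[ X ] (λ a → f zero a * Σ[ X ^ᶠ N ] (λ x → product (λ i → f (suc i) (x i))))
      ≈⟨ Σ-distribʳ X _ (f zero) ⟨
    Σ[ X ] (f zero) * Σ[ X ^ᶠ N ] (λ x → product (λ i → f (suc i) (x i)))
      ≈⟨ *-congˡ (Σ-^ X N (f ∘ suc)) ⟩
    product (λ i → Σ[ X ] (f i)) ∎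
    where module X = FiniteSet X

-- Matrices of linear maps

module Matrices (K : CommutativeRing 0ℓ 0ℓ) where
  open CommutativeRing K hiding (zero)
  open FiniteSums commutativeSemiring
  open Linear K
  open Algebra.Properties.CommutativeSemigroup *-commutativeSemigroup using (x∙yz≈y∙xz)
  open Relation.Binary.Reasoning.Setoid setoid

  sumᴹ : (M : Space) {n : ℕ} → (Fin n → LeftModule.Carrierᴹ M) → LeftModule.Carrierᴹ M
  sumᴹ M = Algebra.Properties.CommutativeMonoid.Sum.sum (LeftModule.+ᴹ-commutativeMonoid M)

  Matrix : FiniteSet → FiniteSet → Set
  Matrix X Y = FiniteSet.Carrier X → FiniteSet.Carrier Y → Carrier

  module _ (X : FiniteSet) where
    private module X = FiniteSet X

    δ : Matrix X X
    δ x y = ind (x X.≟ y)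

    δ-≈ : ∀ {x x′ y y′} → x X.≈ x′ → y X.≈ y′ → δ x y ≈ δ x′ y′
    δ-≈ p q = ind-⇔ (_ X.≟ _) (_ X.≟ _)
      (λ e → X.trans (X.sym p) (X.trans e q)) (λ e → X.trans p (X.trans e (X.sym q)))

    δ-sym : ∀ x y → δ x y ≈ δ y x
    δ-sym x y = ind-⇔ (x X.≟ y) (y X.≟ x) X.sym X.sym

    Σ-δ : ∀ a (f : X.Carrier → Carrier) → (∀ {x} → x X.≈ a → f x ≈ f a) → Σ[ X ] (λ x → f x * δ x a) ≈ f a
    Σ-δ a f f-cong = Σ-single X a _
      (λ x e → trans (*-congˡ (ind-yes (x X.≟ a) e)) (trans (*-identityʳ _) (f-cong e)))
      (λ x ¬e → trans (*-congˡ (ind-no (x X.≟ a) ¬e)) (zeroʳ _))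

  Free-sum : ∀ X {n} (f : Fin n → LeftModule.Carrierᴹ (Free X)) x →
             (sumᴹ (Free X) f ⟨$⟩ x) ≈ sum (λ k → f k ⟨$⟩ x)
  Free-sum X {zero}  f x = refl
  Free-sum X {suc n} f x = +-congˡ (Free-sum X (f ∘ suc) x)

  Hom-sum : ∀ M N {n} (f : Fin n → LinearMap M N) u →
            LeftModule._≈ᴹ_ N (sumᴹ (Hom M N) f $$ u) (sumᴹ N (λ k → f k $$ u))
  Hom-sum M N {zero}  f u = LeftModule.≈ᴹ-refl N
  Hom-sum M N {suc n} f u = LeftModule.+ᴹ-congˡ N (Hom-sum M N (f ∘ suc) u)

  $$-sum : ∀ M N (g : LinearMap M N) {n} (f : Fin n → LeftModule.Carrierᴹ M) →
           LeftModule._≈ᴹ_ N (g $$ sumᴹ M f) (sumᴹ N (λ k → g $$ f k))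
  $$-sum M N g {zero}  f = IsLeftModuleHomomorphism.0ᴹ-homo (LinearMap.isHomomorphism g)
  $$-sum M N g {suc n} f = LeftModule.≈ᴹ-trans N (LinearMap.+ᴹ-homo g (f zero) (sumᴹ M (f ∘ suc))) (LeftModule.+ᴹ-congˡ N ($$-sum M N g (f ∘ suc)))

  module _ (X Y : FiniteSet) where
    private
      module X = FiniteSet X
      module Y = FiniteSet Y

    matrix : LinearMap (Free X) (Free Y) → Matrix Y X
    matrix g y x = (g $$ basis X x) ⟨$⟩ y

    matrix-≈ : ∀ g {y y′ x x′} → y Y.≈ y′ → x X.≈ x′ → matrix g y x ≈ matrix g y′ x′
    matrix-≈ g {y′ = y′} p q = trans (Func.cong (g $$ basis X _) p) (LinearMap.⟦⟧-cong g (λ z → δ-≈ X q X.refl) y′)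

    extend-apply : ∀ F f y → (extend X {Free Y} F $$ f) ⟨$⟩ y ≈ Σ[ X ] (λ x → (f ⟨$⟩ x) * (F x ⟨$⟩ y))
    extend-apply F f y = Free-sum Y (λ k → LeftModule._*ₗ_ (Free Y) (f ⟨$⟩ X.enum k) (F (X.enum k))) y

    extend-basis : ∀ F → (∀ {x x′} y → x X.≈ x′ → (F x ⟨$⟩ y) ≈ (F x′ ⟨$⟩ y)) →
                   ∀ y x → matrix (extend X {Free Y} F) y x ≈ (F x ⟨$⟩ y)
    extend-basis F F-cong y x = begin
      matrix (extend X {Free Y} F) y x               ≈⟨ extend-apply F (basis X x) y ⟩
      Σ[ X ] (λ x′ → δ X x x′ * (F x′ ⟨$⟩ y))   ≈⟨ Σ-cong X (λ x′ → trans (*-comm (δ X x x′) (F x′ ⟨$⟩ y)) (*-congˡ (δ-sym X x x′))) ⟩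
      Σ[ X ] (λ x′ → (F x′ ⟨$⟩ y) * δ X x′ x)   ≈⟨ Σ-δ X x (λ x′ → F x′ ⟨$⟩ y) (F-cong y) ⟩
      (F x ⟨$⟩ y)                               ∎

    matrix-apply : ∀ g f y → (g $$ f) ⟨$⟩ y ≈ Σ[ X ] (λ x → (f ⟨$⟩ x) * matrix g y x)
    matrix-apply g f y = begin
      (g $$ f) ⟨$⟩ y                                   ≈⟨ LinearMap.⟦⟧-cong g f≈ y ⟩
      (g $$ (extend X {Free X} (basis X) $$ f)) ⟨$⟩ y  ≈⟨ $$-sum (Free X) (Free Y) g (λ k → LeftModule._*ₗ_ (Free X) (f ⟨$⟩ X.enum k) (basis X (X.enum k))) y ⟩
      sumᴹ (Free Y) (λ k → g $$ LeftModule._*ₗ_ (Free X) (f ⟨$⟩ X.enum k) (basis X (X.enum k))) ⟨$⟩ y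
        ≈⟨ Free-sum Y (λ k → g $$ LeftModule._*ₗ_ (Free X) (f ⟨$⟩ X.enum k) (basis X (X.enum k))) y ⟩
      sum (λ k → (g $$ LeftModule._*ₗ_ (Free X) (f ⟨$⟩ X.enum k) (basis X (X.enum k))) ⟨$⟩ y)
        ≈⟨ Σ-cong X (λ x → LinearMap.*ₗ-homo g (f ⟨$⟩ x) (basis X x) y) ⟩
      Σ[ X ] (λ x → (f ⟨$⟩ x) * matrix g y x)             ∎
      where
      f≈ : LeftModule._≈ᴹ_ (Free X) f (extend X {Free X} (basis X) $$ f)
      f≈ x = begin
        (f ⟨$⟩ x)                               ≈⟨ Σ-δ X x (f ⟨$⟩_) (Func.cong f) ⟨
        Σ[ X ] (λ z → (f ⟨$⟩ z) * δ X z x)      ≈⟨ Free-sum X (λ k → LeftModule._*ₗ_ (Free X) (f ⟨$⟩ X.enum k) (basis X (X.enum k))) x ⟨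
        (extend X {Free X} (basis X) $$ f) ⟨$⟩ x ∎

  -- The preimage of `T` under `φ`, as `φ-coefficients` confirms.
  coefficients : ∀ X → LinearMap (Free X) (Free X) → LeftModule.Carrierᴹ (Free (X ×ᶠ X))
  coefficients X T = record
    { to = λ (x , y) → matrix X X T x y
    ; cong = λ (e , e′) → matrix-≈ X X T e e′
    }

  infixl 9 _^⊗_
  _^⊗_ : {X Y : Set} → (X → Y → Carrier) → ∀ N → (Fin N → X) → (Fin N → Y) → Carrier
  (A ^⊗ N) x y = product (λ i → A (x i) (y i))

  module _ (X : FiniteSet) where
    private module X = FiniteSet X

    δ-^⊗ : ∀ N x y → (δ X ^⊗ N) x y ≈ δ (X ^ᶠ N) x y
    δ-^⊗ N x y = ind-∀ (λ i → x i X.≟ y i) (FiniteSet._≟_ (X ^ᶠ N) x y) (λ e → e) (λ e → e)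

    -- The mixed-product rule for Kronecker powers. The summed index is the second one in both
    -- matrices, so callers pass transposes where the rule calls for them.
    Σ-^⊗ : ∀ {Y Z : Set} (A : Y → X.Carrier → Carrier) (B : Z → X.Carrier → Carrier) N y z →
           Σ[ X ^ᶠ N ] (λ x → (A ^⊗ N) y x * (B ^⊗ N) z x) ≈ product (λ i → Σ[ X ] (λ x → A (y i) x * B (z i) x))
    Σ-^⊗ A B N y z = trans
      (Σ-cong (X ^ᶠ N) (λ x → sym (product-distrib-* (λ i → A (y i) (x i)) (λ i → B (z i) (x i)))))
      (Σ-^ X N (λ i a → A (y i) a * B (z i) a))

    tensorPower-apply : ∀ N g f y → (tensorPower X N g $$ f) ⟨$⟩ y ≈ Σ[ X ^ᶠ N ] (λ x → (f ⟨$⟩ x) * (matrix X X g ^⊗ N) y x)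
    tensorPower-apply N g f y = Free-sum (X ^ᶠ N) {n = FiniteSet.size (X ^ᶠ N)}
      (λ k → LeftModule._*ₗ_ (Free (X ^ᶠ N)) (f ⟨$⟩ FiniteSet.enum (X ^ᶠ N) k) (record
        { to = λ y → (matrix X X g ^⊗ N) y (FiniteSet.enum (X ^ᶠ N) k)
        ; cong = λ e → product-cong (λ i → Func.cong (g $$ basis X (FiniteSet.enum (X ^ᶠ N) k i)) (e i))
        })) y

    tensorPower-cong : ∀ N {g h : LinearMap (Free X) (Free X)} → LeftModule._≈ᴹ_ (End (Free X)) g h →
                       LeftModule._≈ᴹ_ (End (Free (X ^ᶠ N))) (tensorPower X N g) (tensorPower X N h)
    tensorPower-cong N {g} {h} e f y = begin
      (tensorPower X N g $$ f) ⟨$⟩ y                      ≈⟨ tensorPower-apply N g f y ⟩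
      Σ[ X ^ᶠ N ] (λ x → (f ⟨$⟩ x) * (matrix X X g ^⊗ N) y x)    ≈⟨ Σ-cong (X ^ᶠ N) (λ x → *-congˡ {x = f ⟨$⟩ x} (product-cong (λ i → e (basis X (x i)) (y i)))) ⟩
      Σ[ X ^ᶠ N ] (λ x → (f ⟨$⟩ x) * (matrix X X h ^⊗ N) y x)    ≈⟨ tensorPower-apply N h f y ⟨
      (tensorPower X N h $$ f) ⟨$⟩ y                      ∎

    tensorPower-id : ∀ N f → LeftModule._≈ᴹ_ (Free (X ^ᶠ N)) (tensorPower X N idᴸ $$ f) f
    tensorPower-id N f y = begin
      (tensorPower X N idᴸ $$ f) ⟨$⟩ y                      ≈⟨ tensorPower-apply N idᴸ f y ⟩
      Σ[ X ^ᶠ N ] (λ x → (f ⟨$⟩ x) * (matrix X X (idᴸ {Free X}) ^⊗ N) y x)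
        ≈⟨ Σ-cong (X ^ᶠ N) (λ x → *-congˡ {x = f ⟨$⟩ x} (δ-^⊗ N x y)) ⟩
      Σ[ X ^ᶠ N ] (λ x → (f ⟨$⟩ x) * δ (X ^ᶠ N) x y)        ≈⟨ Σ-δ (X ^ᶠ N) y (f ⟨$⟩_) (Func.cong f) ⟩
      (f ⟨$⟩ y)                                             ∎

    tensorPower-∘ : ∀ N g h f → LeftModule._≈ᴹ_ (Free (X ^ᶠ N))
                    (tensorPower X N (g ∘ᴸ h) $$ f) (tensorPower X N g $$ (tensorPower X N h $$ f))
    tensorPower-∘ N g h f y = begin
      (tensorPower X N (g ∘ᴸ h) $$ f) ⟨$⟩ y
        ≈⟨ tensorPower-apply N (g ∘ᴸ h) f y ⟩
      Σ[ Xᴺ ] (λ w → (f ⟨$⟩ w) * (matrix X X (g ∘ᴸ h) ^⊗ N) y w)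
        ≈⟨ Σ-cong Xᴺ (λ w → *-congˡ {x = f ⟨$⟩ w} (product-cong (λ i → matrix-apply X X g (h $$ basis X (w i)) (y i)))) ⟩
      Σ[ Xᴺ ] (λ w → (f ⟨$⟩ w) * product (λ i → Σ[ X ] (λ x → matrix X X h x (w i) * matrix X X g (y i) x)))
        ≈⟨ Σ-cong Xᴺ (λ w → *-congˡ {x = f ⟨$⟩ w} (Σ-^⊗ (λ w x → matrix X X h x w) (matrix X X g) N w y)) ⟨
      Σ[ Xᴺ ] (λ w → (f ⟨$⟩ w) * Σ[ Xᴺ ] (λ x → H x w * G y x))
        ≈⟨ Σ-cong Xᴺ (λ w → trans (Σ-distribˡ Xᴺ (f ⟨$⟩ w) (λ x → H x w * G y x)) (Σ-cong Xᴺ (λ x → sym (*-assoc (f ⟨$⟩ w) (H x w) (G y x))))) ⟩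
      Σ[ Xᴺ ] (λ w → Σ[ Xᴺ ] (λ x → (f ⟨$⟩ w) * H x w * G y x))
        ≈⟨ Σ-comm Xᴺ Xᴺ (λ w x → (f ⟨$⟩ w) * H x w * G y x) ⟩
      Σ[ Xᴺ ] (λ x → Σ[ Xᴺ ] (λ w → (f ⟨$⟩ w) * H x w * G y x))
        ≈⟨ Σ-cong Xᴺ (λ x → Σ-distribʳ Xᴺ (G y x) (λ w → (f ⟨$⟩ w) * H x w)) ⟨
      Σ[ Xᴺ ] (λ x → Σ[ Xᴺ ] (λ w → (f ⟨$⟩ w) * H x w) * G y x)
        ≈⟨ Σ-cong Xᴺ (λ x → *-congʳ {x = G y x} (tensorPower-apply N h f x)) ⟨
      Σ[ Xᴺ ] (λ x → ((tensorPower X N h $$ f) ⟨$⟩ x) * G y x)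
        ≈⟨ tensorPower-apply N g (tensorPower X N h $$ f) y ⟨
      (tensorPower X N g $$ (tensorPower X N h $$ f)) ⟨$⟩ y ∎
      where
      Xᴺ = X ^ᶠ N
      G = matrix X X g ^⊗ N
      H = matrix X X h ^⊗ N

    φ-apply : ∀ f u x → ((φ X $$ f) $$ u) ⟨$⟩ x ≈ Σ[ X ] (λ y → (u ⟨$⟩ y) * (f ⟨$⟩ (x , y)))
    φ-apply f u x = begin
      ((φ X $$ f) $$ u) ⟨$⟩ x
        ≈⟨ Hom-sum (Free X) (Free X) (λ k → term (FiniteSet.enum (X ×ᶠ X) k)) u x ⟩
      sumᴹ (Free X) (λ k → term (FiniteSet.enum (X ×ᶠ X) k) $$ u) ⟨$⟩ x
        ≈⟨ Free-sum X (λ k → term (FiniteSet.enum (X ×ᶠ X) k) $$ u) x ⟩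
      Σ[ X ×ᶠ X ] (λ (z , y) → (f ⟨$⟩ (z , y)) * ((u ⟨$⟩ y) * δ X z x))
        ≈⟨ Σ-× X X (λ (z , y) → (f ⟨$⟩ (z , y)) * ((u ⟨$⟩ y) * δ X z x)) ⟩
      Σ[ X ] (λ z → Σ[ X ] (λ y → (f ⟨$⟩ (z , y)) * ((u ⟨$⟩ y) * δ X z x)))
        ≈⟨ Σ-comm X X (λ z y → (f ⟨$⟩ (z , y)) * ((u ⟨$⟩ y) * δ X z x)) ⟩
      Σ[ X ] (λ y → Σ[ X ] (λ z → (f ⟨$⟩ (z , y)) * ((u ⟨$⟩ y) * δ X z x)))
        ≈⟨ Σ-cong X (λ y → Σ-cong X (λ z → trans (x∙yz≈y∙xz (f ⟨$⟩ (z , y)) (u ⟨$⟩ y) (δ X z x)) (sym (*-assoc _ _ _)))) ⟩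
      Σ[ X ] (λ y → Σ[ X ] (λ z → (u ⟨$⟩ y) * (f ⟨$⟩ (z , y)) * δ X z x))
        ≈⟨ Σ-cong X (λ y → Σ-δ X x (λ z → (u ⟨$⟩ y) * (f ⟨$⟩ (z , y))) (λ e → *-congˡ {x = u ⟨$⟩ y} (Func.cong f (e , X.refl)))) ⟩
      Σ[ X ] (λ y → (u ⟨$⟩ y) * (f ⟨$⟩ (x , y))) ∎
      where
      term : X.Carrier × X.Carrier → LinearMap (Free X) (Free X)
      term (z , y) = LeftModule._*ₗ_ (End (Free X)) (f ⟨$⟩ (z , y)) (rankOne (basis X z) (dualBasis X y))

    φ-coefficients : ∀ T → LeftModule._≈ᴹ_ (End (Free X)) T (φ X $$ coefficients X T)
    φ-coefficients T u x = trans (matrix-apply X X T u x) (sym (φ-apply (coefficients X T) u x))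

  -- B is the inverse transpose of A. Each identity serves one direction of the correspondence:
  -- `BᵀA` gives commutation from invariance, `ABᵀ` the converse.
  record Dual (X : FiniteSet) (A B : Matrix X X) : Set where
    private module X = FiniteSet X
    field
      ABᵀ : ∀ x y → Σ[ X ] (λ z → A x z * B y z) ≈ δ X x y
      BᵀA : ∀ x y → Σ[ X ] (λ z → B z x * A z y) ≈ δ X x y

  module _ (X : FiniteSet) where
    private module X = FiniteSet X

    Dual-^⊗ : ∀ {A B : Matrix X X} N → Dual X A B → Dual (X ^ᶠ N) (A ^⊗ N) (B ^⊗ N)
    Dual-^⊗ {A} {B} N D = record
      { ABᵀ = λ x y → trans (Σ-^⊗ X A B N x y) (trans (product-cong (λ i → ABᵀ (x i) (y i))) (δ-^⊗ X N x y))
      ; BᵀA = λ x y → trans (Σ-^⊗ X (λ x z → B z x) (λ y z → A z y) N x y) (trans (product-cong (λ i → BᵀA (x i) (y i))) (δ-^⊗ X N x y))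
      }
      where open Dual D

    module _ (A B F : Matrix X X) (D : Dual X A B) (F-≈ : ∀ {x x′ y y′} → x X.≈ x′ → y X.≈ y′ → F x y ≈ F x′ y′) where
      open Dual D

      -- The hypothesis reads A F Bᵀ = F. Multiplying by A on the right and cancelling BᵀA gives F A
      -- = A F.
      conjugation-fixed⇒commutes : (∀ x y → Σ[ X ] (λ w → Σ[ X ] (λ z → F w z * (A x w * B y z))) ≈ F x y) →
                       ∀ x v → Σ[ X ] (λ y → F x y * A y v) ≈ Σ[ X ] (λ w → A x w * F w v)
      conjugation-fixed⇒commutes fixed x v = begin
        Σ[ X ] (λ y → F x y * A y v)
          ≈⟨ Σ-cong X (λ y → *-congʳ {x = A y v} (fixed x y)) ⟨
        Σ[ X ] (λ y → Σ[ X ] (λ w → Σ[ X ] (λ z → F w z * (A x w * B y z))) * A y v)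
          ≈⟨ Σ-cong X (λ y → trans (Σ-distribʳ X (A y v) (λ w → Σ[ X ] (λ z → F w z * (A x w * B y z))))
               (Σ-cong X (λ w → trans (Σ-distribʳ X (A y v) (λ z → F w z * (A x w * B y z))) (Σ-cong X (λ z → shuffle (F w z) (A x w) (B y z) (A y v)))))) ⟩
        Σ[ X ] (λ y → Σ[ X ] (λ w → Σ[ X ] (λ z → A x w * F w z * (B y z * A y v))))
          ≈⟨ Σ-comm X X (λ y w → Σ[ X ] (λ z → A x w * F w z * (B y z * A y v))) ⟩
        Σ[ X ] (λ w → Σ[ X ] (λ y → Σ[ X ] (λ z → A x w * F w z * (B y z * A y v))))
          ≈⟨ Σ-cong X (λ w → Σ-comm X X (λ y z → A x w * F w z * (B y z * A y v))) ⟩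
        Σ[ X ] (λ w → Σ[ X ] (λ z → Σ[ X ] (λ y → A x w * F w z * (B y z * A y v))))
          ≈⟨ Σ-cong X (λ w → Σ-cong X (λ z → trans (sym (Σ-distribˡ X (A x w * F w z) (λ y → B y z * A y v))) (*-congˡ {x = A x w * F w z} (BᵀA z v)))) ⟩
        Σ[ X ] (λ w → Σ[ X ] (λ z → A x w * F w z * δ X z v))
          ≈⟨ Σ-cong X (λ w → Σ-δ X v (λ z → A x w * F w z) (λ e → *-congˡ {x = A x w} (F-≈ X.refl e))) ⟩
        Σ[ X ] (λ w → A x w * F w v) ∎
        where
        shuffle : ∀ f a b a′ → f * (a * b) * a′ ≈ a * f * (b * a′)
        shuffle f a b a′ = begin
          f * (a * b) * a′  ≈⟨ *-congʳ (x∙yz≈y∙xz f a b) ⟩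
          a * (f * b) * a′  ≈⟨ *-congʳ (*-assoc a f b) ⟨
          a * f * b * a′    ≈⟨ *-assoc (a * f) b a′ ⟩
          a * f * (b * a′)  ∎

      -- A F Bᵀ = F A Bᵀ = F.
      commutes⇒conjugation-fixed : (∀ x v → Σ[ X ] (λ y → F x y * A y v) ≈ Σ[ X ] (λ w → A x w * F w v)) →
                       ∀ x y → Σ[ X ] (λ w → Σ[ X ] (λ z → F w z * (A x w * B y z))) ≈ F x y
      commutes⇒conjugation-fixed commutes x y = begin
        Σ[ X ] (λ w → Σ[ X ] (λ z → F w z * (A x w * B y z)))
          ≈⟨ Σ-comm X X (λ w z → F w z * (A x w * B y z)) ⟩
        Σ[ X ] (λ z → Σ[ X ] (λ w → F w z * (A x w * B y z)))
          ≈⟨ Σ-cong X (λ z → Σ-cong X (λ w → trans (x∙yz≈y∙xz (F w z) (A x w) (B y z)) (sym (*-assoc (A x w) (F w z) (B y z))))) ⟩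
        Σ[ X ] (λ z → Σ[ X ] (λ w → A x w * F w z * B y z))
          ≈⟨ Σ-cong X (λ z → trans (sym (Σ-distribʳ X (B y z) (λ w → A x w * F w z))) (*-congʳ {x = B y z} (sym (commutes x z)))) ⟩
        Σ[ X ] (λ z → Σ[ X ] (λ w → F x w * A w z) * B y z)
          ≈⟨ Σ-cong X (λ z → trans (Σ-distribʳ X (B y z) (λ w → F x w * A w z)) (Σ-cong X (λ w → *-assoc (F x w) (A w z) (B y z)))) ⟩
        Σ[ X ] (λ z → Σ[ X ] (λ w → F x w * (A w z * B y z)))
          ≈⟨ Σ-comm X X (λ z w → F x w * (A w z * B y z)) ⟩
        Σ[ X ] (λ w → Σ[ X ] (λ z → F x w * (A w z * B y z)))
          ≈⟨ Σ-cong X (λ w → trans (sym (Σ-distribˡ X (F x w) (λ z → A w z * B y z))) (*-congˡ {x = F x w} (ABᵀ w y))) ⟩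
        Σ[ X ] (λ w → F x w * δ X w y)
          ≈⟨ Σ-δ X y (F x) (F-≈ X.refl) ⟩
        F x y ∎

  -- Since B is the inverse transpose of A, the isomorphism φ carries g′ to conjugation by the N-th tensor power of g.
  record ConjugationLift (X : FiniteSet) (N : ℕ) (g : LinearMap (Free X) (Free X))
                         (g′ : LinearMap (Free ((X ^ᶠ N) ×ᶠ (X ^ᶠ N))) (Free ((X ^ᶠ N) ×ᶠ (X ^ᶠ N)))) : Set where
    field
      A B      : Matrix X X
      dual     : Dual X A B
      g-matrix : ∀ x w → matrix X X g x w ≈ A x w
      g′-matrix : ∀ x y w z → matrix ((X ^ᶠ N) ×ᶠ (X ^ᶠ N)) ((X ^ᶠ N) ×ᶠ (X ^ᶠ N)) g′ (x , y) (w , z) ≈ (A ^⊗ N) x w * (B ^⊗ N) y z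

  -- `T` is any map with the values of φ(f) rather than φ(f) itself, because one half of the theorem
  -- starts from a vector f and the other from an endomorphism T.
  module _ (X : FiniteSet) (N : ℕ) (f : LeftModule.Carrierᴹ (Free ((X ^ᶠ N) ×ᶠ (X ^ᶠ N))))
           (T : LinearMap (Free (X ^ᶠ N)) (Free (X ^ᶠ N)))
           (T-matrix : ∀ u x → (T $$ u) ⟨$⟩ x ≈ Σ[ X ^ᶠ N ] (λ y → (u ⟨$⟩ y) * (f ⟨$⟩ (x , y))))
           {g : LinearMap (Free X) (Free X)} {g′ : LinearMap (Free ((X ^ᶠ N) ×ᶠ (X ^ᶠ N))) (Free ((X ^ᶠ N) ×ᶠ (X ^ᶠ N)))}
           (L : ConjugationLift X N g g′) where
    private
      module X = FiniteSet X
      open ConjugationLift L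
      Xᴺ = X ^ᶠ N
      module Xᴺ = FiniteSet Xᴺ
      Aᴺ = A ^⊗ N
      Bᴺ = B ^⊗ N
      F : Matrix Xᴺ Xᴺ
      F x y = f ⟨$⟩ (x , y)

      gᴺ-apply : ∀ u y → (tensorPower X N g $$ u) ⟨$⟩ y ≈ Σ[ Xᴺ ] (λ x → (u ⟨$⟩ x) * Aᴺ y x)
      gᴺ-apply u y = trans (tensorPower-apply X N g u y) (Σ-cong Xᴺ (λ x → *-congˡ {x = u ⟨$⟩ x} (product-cong (λ i → g-matrix (y i) (x i)))))

      gᴺ-basis : ∀ v y → (tensorPower X N g $$ basis Xᴺ v) ⟨$⟩ y ≈ Aᴺ y v
      gᴺ-basis v y = begin
        (tensorPower X N g $$ basis Xᴺ v) ⟨$⟩ y     ≈⟨ tensorPower-apply X N g (basis Xᴺ v) y ⟩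
        Σ[ Xᴺ ] (λ x → δ Xᴺ v x * (matrix X X g ^⊗ N) y x)  ≈⟨ Σ-cong Xᴺ (λ x → trans (*-comm (δ Xᴺ v x) ((matrix X X g ^⊗ N) y x)) (*-congˡ {x = (matrix X X g ^⊗ N) y x} (δ-sym Xᴺ v x))) ⟩
        Σ[ Xᴺ ] (λ x → (matrix X X g ^⊗ N) y x * δ Xᴺ x v)  ≈⟨ Σ-δ Xᴺ v ((matrix X X g ^⊗ N) y) (λ e → product-cong (λ i → matrix-≈ X X g X.refl (e i))) ⟩
        (matrix X X g ^⊗ N) y v                     ≈⟨ product-cong (λ i → g-matrix (y i) (v i)) ⟩
        Aᴺ y v                                      ∎

      T-basis : ∀ v x → (T $$ basis Xᴺ v) ⟨$⟩ x ≈ F x v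
      T-basis v x = begin
        (T $$ basis Xᴺ v) ⟨$⟩ x                  ≈⟨ T-matrix (basis Xᴺ v) x ⟩
        Σ[ Xᴺ ] (λ y → δ Xᴺ v y * F x y)         ≈⟨ Σ-cong Xᴺ (λ y → trans (*-comm (δ Xᴺ v y) (F x y)) (*-congˡ {x = F x y} (δ-sym Xᴺ v y))) ⟩
        Σ[ Xᴺ ] (λ y → F x y * δ Xᴺ y v)         ≈⟨ Σ-δ Xᴺ v (F x) (λ e → Func.cong f (Xᴺ.refl , e)) ⟩
        F x v                                    ∎

      g′-apply : ∀ x y → (g′ $$ f) ⟨$⟩ (x , y) ≈ Σ[ Xᴺ ] (λ w → Σ[ Xᴺ ] (λ z → F w z * (Aᴺ x w * Bᴺ y z)))
      g′-apply x y = begin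
        (g′ $$ f) ⟨$⟩ (x , y)
          ≈⟨ matrix-apply (Xᴺ ×ᶠ Xᴺ) (Xᴺ ×ᶠ Xᴺ) g′ f (x , y) ⟩
        Σ[ Xᴺ ×ᶠ Xᴺ ] (λ p → (f ⟨$⟩ p) * matrix (Xᴺ ×ᶠ Xᴺ) (Xᴺ ×ᶠ Xᴺ) g′ (x , y) p)
          ≈⟨ Σ-× Xᴺ Xᴺ (λ p → (f ⟨$⟩ p) * matrix (Xᴺ ×ᶠ Xᴺ) (Xᴺ ×ᶠ Xᴺ) g′ (x , y) p) ⟩
        Σ[ Xᴺ ] (λ w → Σ[ Xᴺ ] (λ z → F w z * matrix (Xᴺ ×ᶠ Xᴺ) (Xᴺ ×ᶠ Xᴺ) g′ (x , y) (w , z)))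
          ≈⟨ Σ-cong Xᴺ (λ w → Σ-cong Xᴺ (λ z → *-congˡ {x = F w z} (g′-matrix x y w z))) ⟩
        Σ[ Xᴺ ] (λ w → Σ[ Xᴺ ] (λ z → F w z * (Aᴺ x w * Bᴺ y z))) ∎

      F-≈ : ∀ {x x′ y y′} → x Xᴺ.≈ x′ → y Xᴺ.≈ y′ → F x y ≈ F x′ y′
      F-≈ e e′ = Func.cong f (e , e′)

    commutes-matrix : (∀ x v → Σ[ Xᴺ ] (λ y → F x y * Aᴺ y v) ≈ Σ[ Xᴺ ] (λ w → Aᴺ x w * F w v)) →
                      ∀ u x → (T $$ (tensorPower X N g $$ u)) ⟨$⟩ x ≈ (tensorPower X N g $$ (T $$ u)) ⟨$⟩ x
    commutes-matrix commutes u x = begin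
      (T $$ (tensorPower X N g $$ u)) ⟨$⟩ x
        ≈⟨ T-matrix (tensorPower X N g $$ u) x ⟩
      Σ[ Xᴺ ] (λ y → ((tensorPower X N g $$ u) ⟨$⟩ y) * F x y)
        ≈⟨ Σ-cong Xᴺ (λ y → trans (*-congʳ {x = F x y} (gᴺ-apply u y)) (Σ-distribʳ Xᴺ (F x y) (λ v → (u ⟨$⟩ v) * Aᴺ y v))) ⟩
      Σ[ Xᴺ ] (λ y → Σ[ Xᴺ ] (λ v → (u ⟨$⟩ v) * Aᴺ y v * F x y))
        ≈⟨ Σ-comm Xᴺ Xᴺ (λ y v → (u ⟨$⟩ v) * Aᴺ y v * F x y) ⟩
      Σ[ Xᴺ ] (λ v → Σ[ Xᴺ ] (λ y → (u ⟨$⟩ v) * Aᴺ y v * F x y))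
        ≈⟨ Σ-cong Xᴺ (λ v → trans (Σ-cong Xᴺ (λ y → trans (*-assoc (u ⟨$⟩ v) (Aᴺ y v) (F x y)) (*-congˡ {x = u ⟨$⟩ v} (*-comm (Aᴺ y v) (F x y))))) (sym (Σ-distribˡ Xᴺ (u ⟨$⟩ v) (λ y → F x y * Aᴺ y v)))) ⟩
      Σ[ Xᴺ ] (λ v → (u ⟨$⟩ v) * Σ[ Xᴺ ] (λ y → F x y * Aᴺ y v))
        ≈⟨ Σ-cong Xᴺ (λ v → *-congˡ {x = u ⟨$⟩ v} (commutes x v)) ⟩
      Σ[ Xᴺ ] (λ v → (u ⟨$⟩ v) * Σ[ Xᴺ ] (λ w → Aᴺ x w * F w v))
        ≈⟨ Σ-cong Xᴺ (λ v → trans (Σ-distribˡ Xᴺ (u ⟨$⟩ v) (λ w → Aᴺ x w * F w v)) (Σ-cong Xᴺ (λ w → trans (*-congˡ {x = u ⟨$⟩ v} (*-comm (Aᴺ x w) (F w v))) (sym (*-assoc (u ⟨$⟩ v) (F w v) (Aᴺ x w)))))) ⟩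
      Σ[ Xᴺ ] (λ v → Σ[ Xᴺ ] (λ w → (u ⟨$⟩ v) * F w v * Aᴺ x w))
        ≈⟨ Σ-comm Xᴺ Xᴺ (λ v w → (u ⟨$⟩ v) * F w v * Aᴺ x w) ⟩
      Σ[ Xᴺ ] (λ w → Σ[ Xᴺ ] (λ v → (u ⟨$⟩ v) * F w v * Aᴺ x w))
        ≈⟨ Σ-cong Xᴺ (λ w → trans (*-congʳ {x = Aᴺ x w} (T-matrix u w)) (Σ-distribʳ Xᴺ (Aᴺ x w) (λ v → (u ⟨$⟩ v) * F w v))) ⟨
      Σ[ Xᴺ ] (λ w → ((T $$ u) ⟨$⟩ w) * Aᴺ x w)
        ≈⟨ gᴺ-apply (T $$ u) x ⟨
      (tensorPower X N g $$ (T $$ u)) ⟨$⟩ x ∎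

    lift-fixes⇒commutes : LeftModule._≈ᴹ_ (Free ((X ^ᶠ N) ×ᶠ (X ^ᶠ N))) (g′ $$ f) f →
                          ∀ u → LeftModule._≈ᴹ_ (Free (X ^ᶠ N)) (T $$ (tensorPower X N g $$ u)) (tensorPower X N g $$ (T $$ u))
    lift-fixes⇒commutes fixed = commutes-matrix
      (conjugation-fixed⇒commutes Xᴺ Aᴺ Bᴺ F (Dual-^⊗ X N dual) F-≈ (λ x y → trans (sym (g′-apply x y)) (fixed (x , y))))

    commutes⇒lift-fixes : (∀ u → LeftModule._≈ᴹ_ (Free (X ^ᶠ N)) (T $$ (tensorPower X N g $$ u)) (tensorPower X N g $$ (T $$ u))) →
                          LeftModule._≈ᴹ_ (Free ((X ^ᶠ N) ×ᶠ (X ^ᶠ N))) (g′ $$ f) f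
    commutes⇒lift-fixes commutes (x , y) = trans (g′-apply x y) (commutes⇒conjugation-fixed Xᴺ Aᴺ Bᴺ F (Dual-^⊗ X N dual) F-≈ entries x y)
      where
      -- Commutation evaluated at the basis vector v is column v of the matrix identity.
      entries : ∀ x v → Σ[ Xᴺ ] (λ y → F x y * Aᴺ y v) ≈ Σ[ Xᴺ ] (λ w → Aᴺ x w * F w v)
      entries x v = begin
        Σ[ Xᴺ ] (λ y → F x y * Aᴺ y v)
          ≈⟨ Σ-cong Xᴺ (λ y → trans (*-congʳ {x = F x y} (gᴺ-basis v y)) (*-comm (Aᴺ y v) (F x y))) ⟨
        Σ[ Xᴺ ] (λ y → ((tensorPower X N g $$ basis Xᴺ v) ⟨$⟩ y) * F x y)
          ≈⟨ T-matrix (tensorPower X N g $$ basis Xᴺ v) x ⟨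
        (T $$ (tensorPower X N g $$ basis Xᴺ v)) ⟨$⟩ x
          ≈⟨ commutes (basis Xᴺ v) x ⟩
        (tensorPower X N g $$ (T $$ basis Xᴺ v)) ⟨$⟩ x
          ≈⟨ gᴺ-apply (T $$ basis Xᴺ v) x ⟩
        Σ[ Xᴺ ] (λ w → ((T $$ basis Xᴺ v) ⟨$⟩ w) * Aᴺ x w)
          ≈⟨ Σ-cong Xᴺ (λ w → trans (*-congʳ {x = Aᴺ x w} (T-basis v w)) (*-comm (F w v) (Aᴺ x w))) ⟩
        Σ[ Xᴺ ] (λ w → Aᴺ x w * F w v) ∎

-- Closure of the two conditions under the group operations

module TensorPowers (K : CommutativeRing 0ℓ 0ℓ) where
  open CommutativeRing K using (trans; sym)
  open Linear K
  open Matrices K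

  module _ (Y : FiniteSet) (f : LeftModule.Carrierᴹ (Free Y)) (g h : LinearMap (Free Y) (Free Y)) where

    fixed-∘ : LeftModule._≈ᴹ_ (Free Y) (g $$ f) f → LeftModule._≈ᴹ_ (Free Y) (h $$ f) f → LeftModule._≈ᴹ_ (Free Y) ((g ∘ᴸ h) $$ f) f
    fixed-∘ c d x = trans (LinearMap.⟦⟧-cong g {h $$ f} {f} d x) (c x)

    fixed-inverse : (∀ u → LeftModule._≈ᴹ_ (Free Y) (h $$ (g $$ u)) u) → LeftModule._≈ᴹ_ (Free Y) (g $$ f) f → LeftModule._≈ᴹ_ (Free Y) (h $$ f) f
    fixed-inverse hg≈1 c x = trans (LinearMap.⟦⟧-cong h {f} {g $$ f} (λ y → sym (c y)) x) (hg≈1 f x)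

    fixed-resp : (∀ u → LeftModule._≈ᴹ_ (Free Y) (g $$ u) (h $$ u)) → LeftModule._≈ᴹ_ (Free Y) (g $$ f) f → LeftModule._≈ᴹ_ (Free Y) (h $$ f) f
    fixed-resp e c x = trans (sym (e f x)) (c x)

  module _ (X : FiniteSet) (N : ℕ) (T : LinearMap (Free (X ^ᶠ N)) (Free (X ^ᶠ N))) where

    Commutes : LinearMap (Free X) (Free X) → Set
    Commutes g = ∀ u → LeftModule._≈ᴹ_ (Free (X ^ᶠ N)) (T $$ (tensorPower X N g $$ u)) (tensorPower X N g $$ (T $$ u))

    Commutes-id : Commutes idᴸ
    Commutes-id u x = trans (LinearMap.⟦⟧-cong T {tensorPower X N idᴸ $$ u} {u} (tensorPower-id X N u) x)
      (sym (tensorPower-id X N (T $$ u) x))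

    module _ (g h : LinearMap (Free X) (Free X)) where
      private
        gᴺ = tensorPower X N g
        hᴺ = tensorPower X N h

      Commutes-∘ : Commutes g → Commutes h → Commutes (g ∘ᴸ h)
      Commutes-∘ c d u x =
        trans (LinearMap.⟦⟧-cong T {tensorPower X N (g ∘ᴸ h) $$ u} {gᴺ $$ (hᴺ $$ u)} (tensorPower-∘ X N g h u) x)
        (trans (c (hᴺ $$ u) x)
        (trans (LinearMap.⟦⟧-cong gᴺ {T $$ (hᴺ $$ u)} {hᴺ $$ (T $$ u)} (d u) x)
        (sym (tensorPower-∘ X N g h (T $$ u) x))))

      tensorPower-inverse : (∀ u → LeftModule._≈ᴹ_ (Free X) (g $$ (h $$ u)) u) →
                            ∀ u → LeftModule._≈ᴹ_ (Free (X ^ᶠ N)) (gᴺ $$ (hᴺ $$ u)) u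
      tensorPower-inverse e u x = trans (sym (tensorPower-∘ X N g h u x))
        (trans (tensorPower-cong X N {g ∘ᴸ h} {idᴸ} e u x) (tensorPower-id X N u x))

      Commutes-resp : (∀ u → LeftModule._≈ᴹ_ (Free X) (g $$ u) (h $$ u)) → Commutes g → Commutes h
      Commutes-resp e c u x = trans (LinearMap.⟦⟧-cong T {hᴺ $$ u} {gᴺ $$ u} (λ y → sym (tensorPower-cong X N {g} {h} e u y)) x)
        (trans (c u x) (tensorPower-cong X N {g} {h} e (T $$ u) x))

    -- T hᴺ = hᴺ gᴺ T hᴺ = hᴺ T gᴺ hᴺ = hᴺ T.
    Commutes-inverse : ∀ g h → (∀ u → LeftModule._≈ᴹ_ (Free X) (g $$ (h $$ u)) u) → (∀ u → LeftModule._≈ᴹ_ (Free X) (h $$ (g $$ u)) u) →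
                       Commutes g → Commutes h
    Commutes-inverse g h gh≈1 hg≈1 c u x =
      trans (sym (tensorPower-inverse h g hg≈1 (T $$ (hᴺ $$ u)) x))
      (LinearMap.⟦⟧-cong hᴺ {gᴺ $$ (T $$ (hᴺ $$ u))} {T $$ u} (λ y →
        trans (sym (c (hᴺ $$ u) y)) (LinearMap.⟦⟧-cong T {gᴺ $$ (hᴺ $$ u)} {u} (tensorPower-inverse g h gh≈1 u) y)) x)
      where
      gᴺ = tensorPower X N g
      hᴺ = tensorPower X N h

-- Applied to an enumeration of the module, this finds out whether a character is trivial and
-- otherwise yields a point where it is not.
∀⊎∃ : ∀ {n} {P Q : Fin n → Set} → (∀ i → P i ⊎ Q i) → (∀ i → P i) ⊎ ∃[ i ] Q i
∀⊎∃ {zero}  f = inj₁ λ ()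
∀⊎∃ {suc n} f with f zero | ∀⊎∃ (f ∘ suc)
... | inj₂ q | _             = inj₂ (zero , q)
... | inj₁ _ | inj₂ (i , q)  = inj₂ (suc i , q)
... | inj₁ p | inj₁ ps       = inj₁ λ { zero → p ; (suc i) → ps i }

-- Orthogonality of characters

-- What the argument uses of ℂ. Faithfulness of `e` on ℚ/ℤ takes the strong form `e-nontrivial`:
-- outside ℤ the element e(q) - 1 has an inverse, so that it can be cancelled without deciding
-- equality in `K`.
record FourierScalars (K : CommutativeRing 0ℓ 0ℓ) : Set where
  open CommutativeRing K hiding (zero)
  open Algebra.Properties.Monoid.Mult +-monoid using () renaming (_×_ to _times_)
  field
    e            : ℚ → Carrier
    e-cong       : ∀ {p q} → p ≡ℤ q → e p ≈ e q
    e-0          : e ℚ.0ℚ ≈ 1#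
    e-+          : ∀ p q → e (p ℚ.+ q) ≈ e p * e q
    e-nontrivial : ∀ q → (q ≡ℤ ℚ.0ℚ) ⊎ ∃[ w ] w * (e q - 1#) ≈ 1#
    √⁻¹          : ℕ → Carrier
    √⁻¹-1        : √⁻¹ 1 ≈ 1#
    √⁻¹-*        : ∀ m n → √⁻¹ (m ℕ.* n) ≈ √⁻¹ m * √⁻¹ n
    √⁻¹-square   : ∀ n → √⁻¹ (suc n) * √⁻¹ (suc n) * (suc n times 1#) ≈ 1#

module Kernels {K : CommutativeRing 0ℓ 0ℓ} (scalars : FourierScalars K) where
  open FourierScalars scalars
  open CommutativeRing K hiding (zero)
  open FiniteSums commutativeSemiring
  open Matrices K
  open Linear K
  open Algebra.Properties.CommutativeSemigroup *-commutativeSemigroup using (x∙yz≈y∙xz) renaming (interchange to medial)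
  open Algebra.Properties.Ring ring using (-‿distribˡ-*; -‿distribʳ-*; x[y-z]≈xy-xz)
  open Relation.Binary.Reasoning.Setoid setoid

  e-inverse : ∀ p → e (ℚ.- p) * e p ≈ 1#
  e-inverse p = trans (sym (e-+ (ℚ.- p) p)) (trans (e-cong (ℚ/ℤ.inverseˡ p)) e-0)

  module _ {R : Ring 0ℓ 0ℓ} (V : FiniteModule R) where
    private
      module R = Ring R
      module V = FiniteModule V
      module VG = Algebra.Properties.AbelianGroup V.+ᴹ-abelianGroup
      X = V.finiteSet
      open FiniteSet X using (_≟_)

    Σ-shift : ∀ a (f : V.Carrierᴹ → Carrier) → (∀ {x y} → x V.≈ᴹ y → f x ≈ f y) →
              Σ[ X ] (λ x → f (x V.+ᴹ a)) ≈ Σ[ X ] f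
    Σ-shift a = Σ-bijection X (V._+ᴹ a) (V._+ᴹ V.-ᴹ a) V.+ᴹ-congʳ V.+ᴹ-congʳ
      (λ x → cancel x (V.-ᴹ‿inverseˡ a)) (λ x → cancel x (V.-ᴹ‿inverseʳ a))
      where
      cancel : ∀ x {b c} → b V.+ᴹ c V.≈ᴹ V.0ᴹ → x V.+ᴹ b V.+ᴹ c V.≈ᴹ x
      cancel x e = V.≈ᴹ-trans (V.+ᴹ-assoc x _ _) (V.≈ᴹ-trans (V.+ᴹ-congˡ e) (V.+ᴹ-identityʳ x))

    -- A permutation matrix is its own inverse transpose.
    m-dual : ∀ r s → r R.* s R.≈ R.1# → s R.* r R.≈ R.1# →
             Dual X (λ x w → δ X (r V.*ₗ w) x) (λ x w → δ X (r V.*ₗ w) x)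
    m-dual r s rs≈1 sr≈1 = record
      { ABᵀ = λ x y → Σ-single X (s V.*ₗ x) _
          (λ z z≈ → let rz≈x = V.≈ᴹ-trans (V.*ₗ-congˡ z≈) (cancel rs≈1 x) in
            trans (*-cong (ind-yes (r V.*ₗ z ≟ x) rz≈x) (δ-≈ X rz≈x V.≈ᴹ-refl)) (*-identityˡ _))
          (λ z z≉ → trans (*-congʳ (ind-no (r V.*ₗ z ≟ x) (λ rz≈x → z≉ (V.≈ᴹ-trans (V.≈ᴹ-sym (cancel sr≈1 z)) (V.*ₗ-congˡ rz≈x))))) (zeroˡ _))
      ; BᵀA = λ x y → Σ-single X (r V.*ₗ x) _
          (λ z z≈ → trans (*-cong (ind-yes (r V.*ₗ x ≟ z) (V.≈ᴹ-sym z≈))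
            (ind-⇔ (r V.*ₗ y ≟ z) (x ≟ y)
              (λ ry≈z → V.≈ᴹ-trans (V.≈ᴹ-sym (cancel sr≈1 x)) (V.≈ᴹ-trans (V.*ₗ-congˡ (V.≈ᴹ-trans (V.≈ᴹ-sym z≈) (V.≈ᴹ-sym ry≈z))) (cancel sr≈1 y)))
              (λ x≈y → V.≈ᴹ-trans (V.*ₗ-congˡ (V.≈ᴹ-sym x≈y)) (V.≈ᴹ-sym z≈))))
            (*-identityˡ _))
          (λ z z≉ → trans (*-congʳ (ind-no (r V.*ₗ x ≟ z) (λ rx≈z → z≉ (V.≈ᴹ-sym rx≈z)))) (zeroˡ _))
      }
      where
      cancel : ∀ {a b} → a R.* b R.≈ R.1# → ∀ x → a V.*ₗ (b V.*ₗ x) V.≈ᴹ x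
      cancel ab≈1 x = V.≈ᴹ-trans (V.≈ᴹ-sym (V.*ₗ-assoc _ _ x)) (V.≈ᴹ-trans (V.*ₗ-congʳ ab≈1) (V.*ₗ-identityˡ x))

    -- A diagonal matrix is symmetric, so its inverse transpose has the inverse entries, here e(-Q).
    d-dual : (Q : V.Carrierᴹ → ℚ) → (∀ {x y} → x V.≈ᴹ y → Q x ℚ/ℤ.≈ Q y) →
             Dual X (λ x w → e (Q w) * δ X w x) (λ x w → e (ℚ.- Q w) * δ X w x)
    d-dual Q Q-cong = record
      { ABᵀ = λ x y → Σ-single X x _
          (λ z z≈x → begin
            e (Q z) * δ X z x * (e (ℚ.- Q z) * δ X z y)    ≈⟨ medial (e (Q z)) (δ X z x) (e (ℚ.- Q z)) (δ X z y) ⟩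
            e (Q z) * e (ℚ.- Q z) * (δ X z x * δ X z y)    ≈⟨ *-cong (trans (*-comm _ _) (e-inverse (Q z))) (*-cong (ind-yes (z ≟ x) z≈x) (δ-≈ X z≈x V.≈ᴹ-refl)) ⟩
            1# * (1# * δ X x y)                            ≈⟨ trans (*-identityˡ _) (*-identityˡ _) ⟩
            δ X x y                                        ∎)
          (λ z z≉x → trans (*-congʳ (trans (*-congˡ (ind-no (z ≟ x) z≉x)) (zeroʳ _))) (zeroˡ _))
      ; BᵀA = λ x y → Σ-single X x _
          (λ z z≈x → begin
            e (ℚ.- Q x) * δ X x z * (e (Q y) * δ X y z)    ≈⟨ medial (e (ℚ.- Q x)) (δ X x z) (e (Q y)) (δ X y z) ⟩
            e (ℚ.- Q x) * e (Q y) * (δ X x z * δ X y z)    ≈⟨ *-congˡ (*-cong (ind-yes (x ≟ z) (V.≈ᴹ-sym z≈x)) (trans (δ-≈ X V.≈ᴹ-refl z≈x) (δ-sym X y x))) ⟩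
            e (ℚ.- Q x) * e (Q y) * (1# * δ X x y)         ≈⟨ *-congˡ (*-identityˡ _) ⟩
            e (ℚ.- Q x) * e (Q y) * δ X x y                ≈⟨ diagonal x y ⟩
            δ X x y                                        ∎)
          (λ z z≉x → trans (*-congʳ (trans (*-congˡ (ind-no (x ≟ z) (λ x≈z → z≉x (V.≈ᴹ-sym x≈z)))) (zeroʳ _))) (zeroˡ _))
      }
      where
      diagonal : ∀ x y → e (ℚ.- Q x) * e (Q y) * δ X x y ≈ δ X x y
      diagonal x y with x ≟ y
      ... | no  _   = zeroʳ _
      ... | yes x≈y = trans (*-identityʳ _) (trans (*-congˡ (e-cong (Q-cong (V.≈ᴹ-sym x≈y)))) (e-inverse (Q x)))

    module _ (ι : R.Carrier) (ι-idem : ι R.* ι R.≈ ι) where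

      private
        -- The complementary projections onto ιV and (1 - ι)V; in particular ιV is the kernel of
        -- `q`.
        p q : V.Carrierᴹ → V.Carrierᴹ
        p x = ι V.*ₗ x
        q x = (R.1# R.- ι) V.*ₗ x

      p+q : ∀ x → p x V.+ᴹ q x V.≈ᴹ x
      p+q x = V.≈ᴹ-trans (V.≈ᴹ-sym (V.*ₗ-distribʳ x ι (R.1# R.- ι)))
        (V.≈ᴹ-trans (V.*ₗ-congʳ (R.trans (R.+-comm _ _) (R.trans (R.+-assoc _ _ _) (R.trans (R.+-congˡ (R.-‿inverseˡ ι)) (R.+-identityʳ _))))) (V.*ₗ-identityˡ x))

      pp : ∀ x → p (p x) V.≈ᴹ p x
      pp x = V.≈ᴹ-trans (V.≈ᴹ-sym (V.*ₗ-assoc ι ι x)) (V.*ₗ-congʳ ι-idem)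

      qp : ∀ x → q (p x) V.≈ᴹ V.0ᴹ
      qp x = V.≈ᴹ-trans (V.≈ᴹ-sym (V.*ₗ-assoc _ ι x)) (V.≈ᴹ-trans (V.*ₗ-congʳ (R.trans ([y-z]x≈yx-zx ι R.1# ι)
        (R.trans (R.+-cong (R.*-identityˡ ι) (R.-‿cong ι-idem)) (R.-‿inverseʳ ι)))) (V.*ₗ-zeroˡ x))
        where open Algebra.Properties.Ring R using ([y-z]x≈yx-zx)

      pq : ∀ x → p (q x) V.≈ᴹ V.0ᴹ
      pq x = VG.identityʳ-unique (p x) (p (q x)) (V.≈ᴹ-trans (V.+ᴹ-congʳ (V.≈ᴹ-sym (pp x)))
        (V.≈ᴹ-trans (V.≈ᴹ-sym (V.*ₗ-distribˡ ι (p x) (q x))) (V.*ₗ-congˡ (p+q x))))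

      q-+ : ∀ x y → q (x V.+ᴹ y) V.≈ᴹ q x V.+ᴹ q y
      q-+ = V.*ₗ-distribˡ (R.1# R.- ι)

      -- The matrix of h: b_w goes to c times the sum of e(B(x, w)) b_x over the coset w + ιV, and x
      -- lies in this coset exactly when q x = q w.
      kernel : Carrier → (V.Carrierᴹ → V.Carrierᴹ → ℚ) → Matrix X X
      kernel c B x w = c * (δ X (q x) (q w) * e (B x w))

      -- With d = y - x the entry is c² times the sum of e(B(z, d)) over the z in both x + ιV and y
      -- + ιV. For x = y this counts one coset. For x ≠ y either the character z ↦ B(z, d) is
      -- trivial, so that p d = 0 and the two cosets are disjoint, or a translation multiplies the
      -- sum by a factor u for which u - 1 is invertible.
      kernel-columns : ∀ c → c * c * Σ[ X ] (λ x → δ X (q x) V.0ᴹ) ≈ 1# →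
                       ∀ B → IsBiadditive V.+ᴹ-abelianGroup V.+ᴹ-abelianGroup ℚ/ℤ B →
                       (∀ x y → B (p x) y ℚ/ℤ.≈ B x y) →
                       (∀ y → (∀ x → B x y ℚ/ℤ.≈ ℚ/ℤ.0#) → p y V.≈ᴹ V.0ᴹ) →
                       ∀ x y → Σ[ X ] (λ z → kernel c (λ z x → ℚ.- B z x) z x * kernel c B z y) ≈ δ X x y
      kernel-columns c c-norm B B-biadditive B-p nondegenerate x y = trans (Σ-cong X regroup) (trans (sym (Σ-distribˡ X (c * c) g)) main)
        where
        module B = IsBiadditive B-biadditive
        d = y V.+ᴹ V.-ᴹ x
        g : V.Carrierᴹ → Carrier
        g z = δ X (q z) (q x) * δ X (q z) (q y) * e (B z d)

        regroup : ∀ z → kernel c (λ z x → ℚ.- B z x) z x * kernel c B z y ≈ c * c * g z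
        regroup z = begin
          c * (δ X (q z) (q x) * e (ℚ.- B z x)) * (c * (δ X (q z) (q y) * e (B z y)))
            ≈⟨ medial c _ c _ ⟩
          c * c * (δ X (q z) (q x) * e (ℚ.- B z x) * (δ X (q z) (q y) * e (B z y)))
            ≈⟨ *-congˡ (medial (δ X (q z) (q x)) (e (ℚ.- B z x)) (δ X (q z) (q y)) (e (B z y))) ⟩
          c * c * (δ X (q z) (q x) * δ X (q z) (q y) * (e (ℚ.- B z x) * e (B z y)))
            ≈⟨ *-congˡ (*-congˡ (begin
              e (ℚ.- B z x) * e (B z y)       ≈⟨ *-comm _ _ ⟩
              e (B z y) * e (ℚ.- B z x)       ≈⟨ e-+ (B z y) (ℚ.- B z x) ⟨
              e (B z y ℚ.+ ℚ.- B z x)         ≈⟨ e-cong (ℚ/ℤ.+-cong (ℚ/ℤ.refl {B z y}) (ℚ/ℤ.sym (Additive.-‿homo (B.additiveʳ z) x))) ⟩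
              e (B z y ℚ.+ B z (V.-ᴹ x))      ≈⟨ e-cong (ℚ/ℤ.sym (Additive.+-homo (B.additiveʳ z) y (V.-ᴹ x))) ⟩
              e (B z d)                       ∎)) ⟩
          c * c * g z ∎

        g-cong : ∀ {z z′} → z V.≈ᴹ z′ → g z ≈ g z′
        g-cong z≈ = *-cong (*-cong (δ-≈ X (V.*ₗ-congˡ z≈) V.≈ᴹ-refl) (δ-≈ X (V.*ₗ-congˡ z≈) V.≈ᴹ-refl)) (e-cong (Additive.cong (B.additiveˡ d) z≈))

        p0⇒≈ : p d V.≈ᴹ V.0ᴹ → q x V.≈ᴹ q y → x V.≈ᴹ y
        p0⇒≈ pd≈0 qx≈qy = V.≈ᴹ-sym (VG.x∙y⁻¹≈ε⇒x≈y y x (V.≈ᴹ-trans (V.≈ᴹ-sym (p+q d)) (V.≈ᴹ-trans (V.+ᴹ-cong pd≈0 qd≈0) (V.+ᴹ-identityˡ _))))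
          where
          qd≈0 : q d V.≈ᴹ V.0ᴹ
          qd≈0 = V.≈ᴹ-trans (q-+ y (V.-ᴹ x)) (V.≈ᴹ-trans (V.+ᴹ-cong (V.≈ᴹ-sym qx≈qy) (Additive.-‿homo (*ₗ-additive V.leftModule (R.1# R.- ι)) x)) (V.-ᴹ‿inverseʳ (q x)))

        main : c * c * Σ[ X ] g ≈ δ X x y
        main with x ≟ y
        ... | yes x≈y = begin
          c * c * Σ[ X ] g                                      ≈⟨ *-congˡ (Σ-cong X on-diagonal) ⟩
          -- Translating by x replaces the coset by the kernel of `q`, whose size `c-norm` controls.
          c * c * Σ[ X ] (λ z → δ X (q z) (q x))                ≈⟨ *-congˡ (Σ-shift x (λ z → δ X (q z) (q x)) (λ z≈ → δ-≈ X (V.*ₗ-congˡ z≈) V.≈ᴹ-refl)) ⟨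
          c * c * Σ[ X ] (λ z → δ X (q (z V.+ᴹ x)) (q x))       ≈⟨ *-congˡ (Σ-cong X (λ z → ind-⇔ (q (z V.+ᴹ x) ≟ q x) (q z ≟ V.0ᴹ)
              (λ eq → VG.identityˡ-unique (q z) (q x) (V.≈ᴹ-trans (V.≈ᴹ-sym (q-+ z x)) eq))
              (λ eq → V.≈ᴹ-trans (q-+ z x) (V.≈ᴹ-trans (V.+ᴹ-congʳ eq) (V.+ᴹ-identityˡ _))))) ⟩
          c * c * Σ[ X ] (λ z → δ X (q z) V.0ᴹ)                 ≈⟨ c-norm ⟩
          1#                                                    ∎
          where
          on-diagonal : ∀ z → g z ≈ δ X (q z) (q x)
          on-diagonal z = begin
            g z                                          ≈⟨ *-cong (*-congˡ (δ-≈ X V.≈ᴹ-refl (V.*ₗ-congˡ (V.≈ᴹ-sym x≈y))))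
                 (trans (e-cong (ℚ/ℤ.trans (Additive.cong (B.additiveʳ z) (V.≈ᴹ-trans (V.+ᴹ-congʳ (V.≈ᴹ-sym x≈y)) (V.-ᴹ‿inverseʳ x))) (Additive.0-homo (B.additiveʳ z)))) e-0) ⟩
            δ X (q z) (q x) * δ X (q z) (q x) * 1#       ≈⟨ *-identityʳ _ ⟩
            δ X (q z) (q x) * δ X (q z) (q x)            ≈⟨ ind-idem (q z ≟ q x) ⟩
            δ X (q z) (q x)                              ∎
        -- The search runs through all of V; by `B-p` the value at z depends only on p z, so it
        -- tests the character on ιV.
        ... | no x≉y with ∀⊎∃ (λ k → e-nontrivial (B (FiniteSet.enum X k) d))
        ...   | inj₁ trivial = trans (*-congˡ (Σ-0 X (λ z → trans (*-congʳ {x = e (B z d)} (off z)) (zeroˡ _)))) (zeroʳ _)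
          where
          pd≈0 : p d V.≈ᴹ V.0ᴹ
          pd≈0 = nondegenerate d (λ z → ℚ/ℤ.trans
            (Additive.cong (B.additiveˡ d) (V.≈ᴹ-sym (Inverse.strictlyInverseˡ (FiniteSet.enumeration X) z)))
            (trivial (Inverse.from (FiniteSet.enumeration X) z)))

          off : ∀ z → δ X (q z) (q x) * δ X (q z) (q y) ≈ 0#
          off z with q z ≟ q x
          ... | no _ = zeroˡ _
          ... | yes qz≈qx = trans (*-congˡ (ind-no (q z ≟ q y) (λ qz≈qy → x≉y (p0⇒≈ pd≈0 (V.≈ᴹ-trans (V.≈ᴹ-sym qz≈qx) qz≈qy))))) (zeroʳ _)
        ...   | inj₂ (k , w , w*≈1) = trans (*-congˡ S≈0) (zeroʳ _)
          where
          z₀ = FiniteSet.enum X k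
          S = Σ[ X ] g
          u = e (B z₀ d)

          -- Translation by p z₀ instead of z₀ preserves the cosets of ιV, and by `B-p` it still
          -- changes the exponent by B(z₀, d).
          shifted : ∀ z → g (z V.+ᴹ p z₀) ≈ g z * u
          shifted z = trans (*-cong (*-cong (δ-≈ X q≈ V.≈ᴹ-refl) (δ-≈ X q≈ V.≈ᴹ-refl)) (trans
              (e-cong (ℚ/ℤ.trans (Additive.+-homo (B.additiveˡ d) z (p z₀)) (ℚ/ℤ.+-cong (ℚ/ℤ.refl {B z d}) (B-p z₀ d))))
              (e-+ (B z d) (B z₀ d))))
            (sym (*-assoc _ _ _))
            where
            q≈ : q (z V.+ᴹ p z₀) V.≈ᴹ q z
            q≈ = V.≈ᴹ-trans (q-+ z (p z₀)) (V.≈ᴹ-trans (V.+ᴹ-congˡ (qp z₀)) (V.+ᴹ-identityʳ _))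

          S≈Su : S ≈ S * u
          S≈Su = trans (sym (Σ-shift (p z₀) g g-cong)) (trans (Σ-cong X shifted) (sym (Σ-distribʳ X u g)))

          S≈0 : S ≈ 0#
          S≈0 = begin
            S                        ≈⟨ *-identityʳ S ⟨
            S * 1#                   ≈⟨ *-congˡ w*≈1 ⟨
            S * (w * (u - 1#))       ≈⟨ x∙yz≈y∙xz S w (u - 1#) ⟩
            w * (S * (u - 1#))       ≈⟨ *-congˡ (x[y-z]≈xy-xz S u 1#) ⟩
            w * (S * u - S * 1#)     ≈⟨ *-congˡ (+-cong (sym S≈Su) (-‿cong (*-identityʳ S))) ⟩
            w * (S - S)              ≈⟨ *-congˡ (-‿inverseʳ S) ⟩
            w * 0#                   ≈⟨ zeroʳ w ⟩
            0#                       ∎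

      -- Rows for `B` are columns for the transposed form, so `ABᵀ` is `kernel-columns` again with x
      -- and y exchanged. Hence nondegeneracy is asked for in both arguments.
      kernel-dual : ∀ c → c * c * Σ[ X ] (λ x → δ X (q x) V.0ᴹ) ≈ 1# →
                    ∀ B → IsBiadditive V.+ᴹ-abelianGroup V.+ᴹ-abelianGroup ℚ/ℤ B →
                    (∀ x y → B (p x) y ℚ/ℤ.≈ B x y) → (∀ x y → B x (p y) ℚ/ℤ.≈ B x y) →
                    (∀ x → (∀ y → B x y ℚ/ℤ.≈ ℚ/ℤ.0#) → p x V.≈ᴹ V.0ᴹ) →
                    (∀ y → (∀ x → B x y ℚ/ℤ.≈ ℚ/ℤ.0#) → p y V.≈ᴹ V.0ᴹ) →
                    Dual X (kernel c B) (kernel c (λ x y → ℚ.- B x y))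
      kernel-dual c c-norm B B-biadditive B-pˡ B-pʳ nondegenerateˡ nondegenerateʳ = record
        { ABᵀ = λ x y → begin
            Σ[ X ] (λ z → kernel c B x z * kernel c (λ x y → ℚ.- B x y) y z)
              ≈⟨ Σ-cong X (λ z → trans (*-comm _ _) (*-cong (*-congˡ (*-congʳ {x = e (ℚ.- B y z)} (δ-sym X (q y) (q z)))) (*-congˡ (*-congʳ {x = e (B x z)} (δ-sym X (q x) (q z)))))) ⟩
            Σ[ X ] (λ z → kernel c (λ z y → ℚ.- B y z) z y * kernel c (λ z x → B x z) z x)
              ≈⟨ kernel-columns c c-norm (λ z x → B x z) (record { additiveˡ = B.additiveʳ ; additiveʳ = B.additiveˡ })
                   (λ z x → B-pʳ x z) nondegenerateˡ y x ⟩
            δ X y x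
              ≈⟨ δ-sym X y x ⟩
            δ X x y ∎
        ; BᵀA = kernel-columns c c-norm B B-biadditive B-pˡ nondegenerateʳ
        }
        where module B = IsBiadditive B-biadditive

-- The exponential function and inverse square roots

module RealProperties (ℝ : RealNumbers) where
  open RealNumbers ℝ using (heytingField; _<_; isStrictPartialOrder; #⇔<⊎>; 0<1; +-mono-<; *-pos; √; √-pos; √-square; recip; fromℕ; fromℕ-pos; fromInteger; fromℚ; invSqrt)
  open HeytingField heytingField using (_#_; #⇒invertible; heytingCommutativeRing) renaming (#-cotrans to cotrans)
  open CommutativeRing (RealNumbers.commutativeRing ℝ) hiding (zero)
  open Algebra.Properties.Ring ring using (-‿distribˡ-*; -‿distribʳ-*; -0#≈0#; [y-z]x≈yx-zx; x[y-z]≈xy-xz)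
  open Algebra.Properties.AbelianGroup +-abelianGroup using (⁻¹-∙-comm; ⁻¹-involutive; xyx⁻¹≈y)
  open Algebra.Apartness.Properties.HeytingCommutativeRing heytingCommutativeRing using (x-0≈x; invertibleˡ⇒#)
  open Algebra.Solver.Ring.NaturalCoefficients.Default commutativeSemiring
  open Algebra.Properties.Semiring.Mult semiring using (×-homo-+; ×1-homo-*; ×-homo-1)
  open IsStrictPartialOrder isStrictPartialOrder using (irrefl; <-respʳ-≈; <-respˡ-≈) renaming (trans to <-trans)
  open Relation.Binary.Reasoning.Setoid setoid

  neg-pos : ∀ {x} → x < 0# → 0# < - x
  neg-pos {x} x<0 = <-respʳ-≈ (+-identityˡ _) (<-respˡ-≈ (-‿inverseʳ x) (+-mono-< (- x) x<0))

  +-pos : ∀ {x y} → 0# < x → 0# < y → 0# < x + y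
  +-pos {x} {y} 0<x 0<y = <-trans 0<y (<-respˡ-≈ (+-identityˡ y) (+-mono-< y 0<x))

  ¬0<-1 : ¬ (0# < - 1#)
  ¬0<-1 0<-1 = irrefl refl (<-respʳ-≈ (-‿inverseʳ 1#) (+-pos 0<1 0<-1))

  #0⇒square-pos : ∀ {x} → x # 0# → 0# < x * x
  #0⇒square-pos {x} x#0 with Equivalence.to (#⇔<⊎> x 0#) x#0
  ... | inj₂ 0<x = *-pos 0<x 0<x
  ... | inj₁ x<0 = <-respʳ-≈ (trans (sym (-‿distribˡ-* x (- x))) (trans (-‿cong (sym (-‿distribʳ-* x x))) (⁻¹-involutive _)))
                     (*-pos (neg-pos x<0) (neg-pos x<0))

  invertible⇒#0 : ∀ {x y} → y * x ≈ 1# → x # 0#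
  invertible⇒#0 {x} {y} e = invertibleˡ⇒# (y , trans (*-congˡ (x-0≈x x)) e)

  square-#0⇒pos : ∀ {x} → x * x # 0# → 0# < x * x
  square-#0⇒pos {x} xx#0 =
    let y , y*xx≈1 , _ = #⇒invertible xx#0 in
    #0⇒square-pos (invertible⇒#0 {x} {y * x} (trans (*-assoc y x x) (trans (*-congˡ (sym (x-0≈x (x * x)))) y*xx≈1)))

  +-cancel-# : ∀ {x y} → x + y # y → x # 0#
  +-cancel-# {x} {y} p = let z , z*≈1 , _ = #⇒invertible p in
    invertible⇒#0 {x} {z} (trans (*-congˡ (sym (trans (+-assoc x y (- y)) (trans (+-congˡ (-‿inverseʳ y)) (+-identityʳ x))))) z*≈1)

  -- There is no case distinction on whether x vanishes. Cotransitivity applied to 0 and y yields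
  -- either x² + y apart from y, so that x² is apart from 0 and hence positive, or x² + y apart from
  -- 0, where a negative sign would force x² < 0.
  square+pos : ∀ x {y} → 0# < y → 0# < x * x + y
  square+pos x {y} 0<y with cotrans (Equivalence.from (#⇔<⊎> 0# y) (inj₁ 0<y)) (x * x + y)
  ... | inj₂ p = +-pos (square-#0⇒pos (+-cancel-# p)) 0<y
  ... | inj₁ p with Equivalence.to (#⇔<⊎> 0# (x * x + y)) p
  ...   | inj₁ 0<s = 0<s
  ...   | inj₂ s<0 = contradiction (square-#0⇒pos (Equivalence.from (#⇔<⊎> (x * x) 0#) (inj₁ xx<0))) (λ 0<xx → irrefl refl (<-trans 0<xx xx<0))
    where
    xx<0 : x * x < 0#
    xx<0 = <-trans (<-respˡ-≈ (+-identityˡ _) (<-respʳ-≈ (+-comm y (x * x)) (+-mono-< (x * x) 0<y))) s<0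

  recip-inverse : ∀ x 0<x → recip x 0<x * x ≈ 1#
  recip-inverse x 0<x = trans (*-congˡ (sym (x-0≈x x)))
    (proj₁ (proj₂ (#⇒invertible (Equivalence.from (#⇔<⊎> x 0#) (inj₂ 0<x)))))

  recip-pos : ∀ x 0<x → 0# < recip x 0<x
  recip-pos x 0<x with Equivalence.to (#⇔<⊎> _ 0#) (invertible⇒#0 {recip x 0<x} {x} (trans (*-comm _ _) (recip-inverse x 0<x)))
  ... | inj₂ 0<r = 0<r
  ... | inj₁ r<0 = contradiction
    (<-respʳ-≈ (trans (sym (-‿distribˡ-* _ x)) (-‿cong (recip-inverse x 0<x))) (*-pos (neg-pos r<0) 0<x)) ¬0<-1

  *-cancelʳ-pos : ∀ {x y z} → 0# < x → y * x ≈ z * x → y ≈ z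
  *-cancelʳ-pos {x} {y} {z} 0<x e = begin
    y                        ≈⟨ undo y ⟨
    y * x * recip x 0<x      ≈⟨ *-congʳ e ⟩
    z * x * recip x 0<x      ≈⟨ undo z ⟩
    z                        ∎
    where
    undo : ∀ w → w * x * recip x 0<x ≈ w
    undo w = trans (*-assoc w x _) (trans (*-congˡ (trans (*-comm x _) (recip-inverse x 0<x))) (*-identityʳ w))

  square-injective : ∀ {x y} → 0# < x → 0# < y → x * x ≈ y * y → x ≈ y
  square-injective {x} {y} 0<x 0<y e = *-cancelʳ-pos (+-pos 0<x 0<y) (begin
    x * (x + y)     ≈⟨ distribˡ x x y ⟩
    x * x + x * y   ≈⟨ +-cong e (*-comm x y) ⟩
    y * y + y * x   ≈⟨ +-comm _ _ ⟩
    y * x + y * y   ≈⟨ distribˡ y x y ⟨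
    y * (x + y)     ∎)

  fromℕ-* : ∀ m n → fromℕ (m ℕ.* n) ≈ fromℕ m * fromℕ n
  fromℕ-* = ×1-homo-*

  fromℕ-1 : fromℕ 1 ≈ 1#
  fromℕ-1 = ×-homo-1 1#

  invSqrt-pos : ∀ n → 0# < invSqrt (suc n)
  invSqrt-pos n = recip-pos (√ _ (fromℕ-pos n)) (√-pos _ _)

  invSqrt-square : ∀ n → invSqrt (suc n) * invSqrt (suc n) * fromℕ (suc n) ≈ 1#
  invSqrt-square n = begin
    r * r * fromℕ (suc n)  ≈⟨ *-congˡ (√-square _ (fromℕ-pos n)) ⟨
    r * r * (s * s)        ≈⟨ solve 2 (λ r s → r :* r :* (s :* s) := r :* s :* (r :* s)) refl r s ⟩
    r * s * (r * s)        ≈⟨ *-cong (recip-inverse s _) (recip-inverse s _) ⟩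
    1# * 1#                ≈⟨ *-identityˡ 1# ⟩
    1#                     ∎
    where
    r = invSqrt (suc n)
    s = √ (fromℕ (suc n)) (fromℕ-pos n)

  -- `√` is known only through its positivity and its square, so every identity for `invSqrt` comes
  -- from the uniqueness of positive roots.
  invSqrt-unique : ∀ n {x} → 0# < x → x * x * fromℕ (suc n) ≈ 1# → invSqrt (suc n) ≈ x
  invSqrt-unique n 0<x e = square-injective (invSqrt-pos n) 0<x
    (*-cancelʳ-pos (fromℕ-pos n) (trans (invSqrt-square n) (sym e)))

  invSqrt-* : ∀ m n → invSqrt (m ℕ.* n) ≈ invSqrt m * invSqrt n
  -- The default value 0 at 0 keeps the rule valid there.
  invSqrt-* zero    n = sym (zeroˡ _)
  invSqrt-* (suc m) zero = trans (reflexive (≡.cong invSqrt (ℕ.*-zeroʳ m))) (sym (zeroʳ _))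
  invSqrt-* (suc m) (suc n) = invSqrt-unique (n ℕ.+ m ℕ.* suc n) (*-pos (invSqrt-pos m) (invSqrt-pos n)) (begin
    a * b * (a * b) * fromℕ (suc m ℕ.* suc n)         ≈⟨ *-congˡ (fromℕ-* (suc m) (suc n)) ⟩
    a * b * (a * b) * (fromℕ (suc m) * fromℕ (suc n))
      ≈⟨ solve 4 (λ a b x y → a :* b :* (a :* b) :* (x :* y) := a :* a :* x :* (b :* b :* y)) refl a b (fromℕ (suc m)) (fromℕ (suc n)) ⟩
    a * a * fromℕ (suc m) * (b * b * fromℕ (suc n))   ≈⟨ *-cong (invSqrt-square m) (invSqrt-square n) ⟩
    1# * 1#                                           ≈⟨ *-identityˡ 1# ⟩
    1#                                                ∎)
    where
    a = invSqrt (suc m)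
    b = invSqrt (suc n)

  invSqrt-1 : invSqrt 1 ≈ 1#
  invSqrt-1 = invSqrt-unique 0 0<1 (trans (*-cong (*-identityˡ 1#) fromℕ-1) (*-identityˡ 1#))

  fromInteger-⊖ : ∀ m n → fromInteger (m ℤ.⊖ n) ≈ fromℕ m - fromℕ n
  fromInteger-⊖ m zero = sym (trans (+-congˡ -0#≈0#) (+-identityʳ _))
  fromInteger-⊖ zero (suc n) = sym (+-identityˡ _)
  fromInteger-⊖ (suc m) (suc n) = begin
    fromInteger (suc m ℤ.⊖ suc n)           ≈⟨ reflexive (≡.cong fromInteger (ℤ.[1+m]⊖[1+n]≡m⊖n m n)) ⟩
    fromInteger (m ℤ.⊖ n)                   ≈⟨ fromInteger-⊖ m n ⟩
    fromℕ m - fromℕ n                       ≈⟨ +-congʳ (xyx⁻¹≈y 1# (fromℕ m)) ⟨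
    1# + fromℕ m - 1# - fromℕ n             ≈⟨ +-assoc _ _ _ ⟩
    1# + fromℕ m + (- 1# - fromℕ n)         ≈⟨ +-congˡ (⁻¹-∙-comm _ _) ⟩
    fromℕ (suc m) - fromℕ (suc n)           ∎

  fromInteger-+ : ∀ k l → fromInteger (k ℤ.+ l) ≈ fromInteger k + fromInteger l
  fromInteger-+ (ℤ.+ m)      (ℤ.+ n)      = ×-homo-+ 1# m n
  fromInteger-+ (ℤ.+ m)      ℤ.-[1+ n ]   = fromInteger-⊖ m (suc n)
  fromInteger-+ ℤ.-[1+ m ]   (ℤ.+ n)      = trans (fromInteger-⊖ n (suc m)) (+-comm _ _)
  fromInteger-+ ℤ.-[1+ m ]   ℤ.-[1+ n ]   = begin
    - fromℕ (suc (suc (m ℕ.+ n)))         ≈⟨ -‿cong (reflexive (≡.cong (fromℕ ∘ suc) (ℕ.+-suc m n))) ⟨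
    - fromℕ (suc m ℕ.+ suc n)             ≈⟨ -‿cong (×-homo-+ 1# (suc m) (suc n)) ⟩
    - (fromℕ (suc m) + fromℕ (suc n))     ≈⟨ ⁻¹-∙-comm _ _ ⟨
    - fromℕ (suc m) - fromℕ (suc n)       ∎

  fromInteger-* : ∀ k n → fromInteger (k ℤ.* ℤ.+ n) ≈ fromInteger k * fromℕ n
  fromInteger-* k zero = trans (reflexive (≡.cong fromInteger (ℤ.*-zeroʳ k))) (sym (zeroʳ _))
  fromInteger-* k (suc n) = begin
    fromInteger (k ℤ.* ℤ.+ suc n)                    ≈⟨ reflexive (≡.cong fromInteger (ℤ.*-suc k (ℤ.+ n))) ⟩
    fromInteger (k ℤ.+ k ℤ.* ℤ.+ n)                  ≈⟨ fromInteger-+ k (k ℤ.* ℤ.+ n) ⟩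
    fromInteger k + fromInteger (k ℤ.* ℤ.+ n)        ≈⟨ +-cong (sym (*-identityʳ _)) (fromInteger-* k n) ⟩
    fromInteger k * 1# + fromInteger k * fromℕ n     ≈⟨ distribˡ _ _ _ ⟨
    fromInteger k * fromℕ (suc n)                    ∎

  -- Additivity is proved on unnormalised fractions, whose sum is given by a formula without
  -- reduction to lowest terms.
  fromℚᵘ : ℚᵘ → Carrier
  fromℚᵘ (mkℚᵘ n d) = fromInteger n * recip (fromℕ (suc d)) (fromℕ-pos d)

  fromℚᵘ-denominator : ∀ n d → fromℚᵘ (mkℚᵘ n d) * fromℕ (suc d) ≈ fromInteger n
  fromℚᵘ-denominator n d = trans (*-assoc _ _ _) (trans (*-congˡ (recip-inverse _ _)) (*-identityʳ _))

  fromℚᵘ-unique : ∀ n d {x} → x * fromℕ (suc d) ≈ fromInteger n → fromℚᵘ (mkℚᵘ n d) ≈ x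
  fromℚᵘ-unique n d e = *-cancelʳ-pos (fromℕ-pos d) (trans (fromℚᵘ-denominator n d) (sym e))

  fromℚᵘ-cong : ∀ {p q} → p ℚᵘ.≃ q → fromℚᵘ p ≈ fromℚᵘ q
  fromℚᵘ-cong {mkℚᵘ m c} {mkℚᵘ n d} (*≡* e) = fromℚᵘ-unique m c (*-cancelʳ-pos (fromℕ-pos d) (begin
    fromℚᵘ (mkℚᵘ n d) * fromℕ (suc c) * fromℕ (suc d)  ≈⟨ solve 3 (λ x y z → x :* y :* z := x :* z :* y) refl _ _ _ ⟩
    fromℚᵘ (mkℚᵘ n d) * fromℕ (suc d) * fromℕ (suc c)  ≈⟨ *-congʳ (fromℚᵘ-denominator n d) ⟩
    fromInteger n * fromℕ (suc c)                      ≈⟨ fromInteger-* n (suc c) ⟨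
    fromInteger (n ℤ.* ℤ.+ suc c)                      ≈⟨ reflexive (≡.cong fromInteger e) ⟨
    fromInteger (m ℤ.* ℤ.+ suc d)                      ≈⟨ fromInteger-* m (suc d) ⟩
    fromInteger m * fromℕ (suc d)                      ∎))

  fromℚᵘ-+ : ∀ p q → fromℚᵘ (p ℚᵘ.+ q) ≈ fromℚᵘ p + fromℚᵘ q
  fromℚᵘ-+ p@(mkℚᵘ m c) q@(mkℚᵘ n d) = fromℚᵘ-unique (m ℤ.* ℤ.+ suc d ℤ.+ n ℤ.* ℤ.+ suc c) (d ℕ.+ c ℕ.* suc d) (begin
    (fromℚᵘ p + fromℚᵘ q) * fromℕ (suc c ℕ.* suc d)           ≈⟨ *-congˡ (fromℕ-* (suc c) (suc d)) ⟩
    (fromℚᵘ p + fromℚᵘ q) * (fromℕ (suc c) * fromℕ (suc d))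
      ≈⟨ solve 4 (λ x y c d → (x :+ y) :* (c :* d) := x :* c :* d :+ y :* d :* c) refl (fromℚᵘ p) (fromℚᵘ q) (fromℕ (suc c)) (fromℕ (suc d)) ⟩
    fromℚᵘ p * fromℕ (suc c) * fromℕ (suc d) + fromℚᵘ q * fromℕ (suc d) * fromℕ (suc c)
      ≈⟨ +-cong (*-congʳ (fromℚᵘ-denominator m c)) (*-congʳ (fromℚᵘ-denominator n d)) ⟩
    fromInteger m * fromℕ (suc d) + fromInteger n * fromℕ (suc c)
      ≈⟨ +-cong (fromInteger-* m (suc d)) (fromInteger-* n (suc c)) ⟨
    fromInteger (m ℤ.* ℤ.+ suc d) + fromInteger (n ℤ.* ℤ.+ suc c)
      ≈⟨ fromInteger-+ (m ℤ.* ℤ.+ suc d) (n ℤ.* ℤ.+ suc c) ⟨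
    fromInteger (m ℤ.* ℤ.+ suc d ℤ.+ n ℤ.* ℤ.+ suc c) ∎)

  fromℚ≈fromℚᵘ : ∀ q → fromℚ q ≈ fromℚᵘ (ℚ.toℚᵘ q)
  fromℚ≈fromℚᵘ (mkℚ _ _ _) = refl

  fromℚ-+ : ∀ p q → fromℚ (p ℚ.+ q) ≈ fromℚ p + fromℚ q
  fromℚ-+ p q = begin
    fromℚ (p ℚ.+ q)                             ≈⟨ fromℚ≈fromℚᵘ (p ℚ.+ q) ⟩
    fromℚᵘ (ℚ.toℚᵘ (p ℚ.+ q))                   ≈⟨ fromℚᵘ-cong (ℚ.toℚᵘ-homo-+ p q) ⟩
    fromℚᵘ (ℚ.toℚᵘ p ℚᵘ.+ ℚ.toℚᵘ q)             ≈⟨ fromℚᵘ-+ (ℚ.toℚᵘ p) (ℚ.toℚᵘ q) ⟩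
    fromℚᵘ (ℚ.toℚᵘ p) + fromℚᵘ (ℚ.toℚᵘ q)       ≈⟨ +-cong (fromℚ≈fromℚᵘ p) (fromℚ≈fromℚᵘ q) ⟨
    fromℚ p + fromℚ q                           ∎

  fromℚ-fromℤ : ∀ k → fromℚ (fromℤ k) ≈ fromInteger k
  fromℚ-fromℤ k = trans (fromℚ≈fromℚᵘ (fromℤ k)) (trans (fromℚᵘ-cong (ℚ.toℚᵘ-fromℚᵘ (mkℚᵘ k 0))) (fromℚᵘ-unique k 0 (trans (*-congˡ fromℕ-1) (*-identityʳ _))))

  -- Division of the numerator by the denominator with remainder. The strict bounds on t are those
  -- under which the sine of πt is known to be positive.
  fractionalPart : ∀ q → (q ≡ℤ ℚ.0ℚ) ⊎ ∃[ k ] ∃[ t ] 0# < t × 0# < 1# - t × fromℚ q ≈ t + fromInteger k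
  fractionalPart q@(mkℚ n d _) with n ℤ.%ℕ suc d | n ℤ./ℕ suc d | ℤ.a≡a%ℕn+[a/ℕn]*n n (suc d) | ℤ.n%ℕd<d n (suc d)
  ... | zero  | k | e | _ = inj₁ (shift k (≡.trans (ℚ.toℚᵘ-injective integer) (≡.sym (ℚ.+-identityˡ _))))
    where
    integer : ℚ.toℚᵘ q ℚᵘ.≃ ℚ.toℚᵘ (fromℤ k)
    integer = ℚᵘ-trans (*≡* (≡.trans (ℤ.*-identityʳ n) (≡.trans e (ℤ.+-identityˡ _)))) (ℚᵘ-sym (ℚ.toℚᵘ-fromℚᵘ (mkℚᵘ k 0)))
      where open import Data.Rational.Unnormalised.Properties using () renaming (≃-trans to ℚᵘ-trans; ≃-sym to ℚᵘ-sym)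
  ... | suc r | k | e | ℕ.s≤s r<d = inj₂ (k , t , *-pos (fromℕ-pos r) 0<D⁻¹ , 0<1-t , fromℚᵘ-unique n d (begin
      (t + fromInteger k) * D                  ≈⟨ distribʳ D t (fromInteger k) ⟩
      t * D + fromInteger k * D                ≈⟨ +-cong (fromℚᵘ-denominator (ℤ.+ suc r) d) (sym (fromInteger-* k (suc d))) ⟩
      fromℕ (suc r) + fromInteger (k ℤ.* ℤ.+ suc d)  ≈⟨ fromInteger-+ (ℤ.+ suc r) (k ℤ.* ℤ.+ suc d) ⟨
      fromInteger (ℤ.+ suc r ℤ.+ k ℤ.* ℤ.+ suc d)   ≈⟨ reflexive (≡.cong fromInteger e) ⟨
      fromInteger n                            ∎))
    where
    D = fromℕ (suc d)
    D⁻¹ = recip D (fromℕ-pos d)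
    0<D⁻¹ = recip-pos D (fromℕ-pos d)
    t = fromℕ (suc r) * D⁻¹

    -- The remainder is r + 1 and the denominator d + 1, so 1 - t = (m + 1)/(d + 1) with m = d - (r
    -- + 1).
    d-r : ∃[ m ] d ≡ m ℕ.+ suc r
    d-r = d ℕ.∸ suc r , ≡.sym (ℕ.m∸n+n≡m r<d)

    0<1-t : 0# < 1# - t
    0<1-t = <-respʳ-≈ (begin
      fromℕ (suc m) * D⁻¹                                         ≈⟨ xyx⁻¹≈y t _ ⟨
      t + fromℕ (suc m) * D⁻¹ - t                                 ≈⟨ +-congʳ (distribʳ D⁻¹ (fromℕ (suc r)) (fromℕ (suc m))) ⟨
      (fromℕ (suc r) + fromℕ (suc m)) * D⁻¹ - t                   ≈⟨ +-congʳ (*-congʳ (+-comm _ _)) ⟩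
      (fromℕ (suc m) + fromℕ (suc r)) * D⁻¹ - t                   ≈⟨ +-congʳ (*-congʳ (×-homo-+ 1# (suc m) (suc r))) ⟨
      fromℕ (suc m ℕ.+ suc r) * D⁻¹ - t                           ≈⟨ +-congʳ (*-congʳ (reflexive (≡.cong (fromℕ ∘ suc) (proj₂ d-r)))) ⟨
      D * D⁻¹ - t                                                 ≈⟨ +-congʳ (trans (*-comm D D⁻¹) (recip-inverse D _)) ⟩
      1# - t                                                      ∎)
      (*-pos (fromℕ-pos m) 0<D⁻¹)
      where m = proj₁ d-r

-- Values of exp(2πi q)

module ComplexProperties (𝒞 : ComplexNumbers) where
  open ComplexNumbers 𝒞 using (exp; exp-cong; exp-+; π; 0<π; exp-iπ; sin-pos; exp2πi; invSqrt) renaming (ℝ to reals)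
  open Complex reals
  open RealProperties reals
  private
    module ℝ where
      open RealNumbers reals public using (_<_; fromℚ; fromInteger; fromℕ; isStrictPartialOrder; +-mono-<; *-pos)
      open CommutativeRing (RealNumbers.commutativeRing reals) public
      open IsStrictPartialOrder isStrictPartialOrder public using (<-respʳ-≈; <-respˡ-≈)
  open Algebra.Properties.Ring ring using (x[y-z]≈xy-xz; -1*x≈-x)
  open Algebra.Properties.Monoid.Mult +-monoid using () renaming (_×_ to _times_)
  open Algebra.Properties.AbelianGroup +-abelianGroup using (⁻¹-involutive)
  open Relation.Binary.Reasoning.Setoid setoid

  IsInvertible : Carrier → Set
  IsInvertible z = ∃[ w ] w * z ≈ 1#

  -- The inverse is the conjugate divided by the squared norm, which is positive by `square+pos`
  -- whatever the real part is.
  Im-pos⇒invertible : ∀ z → ℝ.0# ℝ.< Im z → IsInvertible z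
  Im-pos⇒invertible (a , b) 0<b = (r ℝ.* a , ℝ.- (r ℝ.* b)) , re , im
    where
    open Algebra.Properties.Ring ℝ.ring using () renaming (-‿distribˡ-* to negˡ)
    open Algebra.Properties.AbelianGroup ℝ.+-abelianGroup renaming (⁻¹-involutive to neg-neg)
    open Algebra.Solver.Ring.NaturalCoefficients.Default ℝ.commutativeSemiring
    n = a ℝ.* a ℝ.+ b ℝ.* b
    0<n = square+pos a (ℝ.*-pos 0<b 0<b)
    r = RealNumbers.recip reals n 0<n
    re : r ℝ.* a ℝ.* a ℝ.- ℝ.- (r ℝ.* b) ℝ.* b ℝ.≈ ℝ.1#
    re = ℝ.trans (ℝ.+-congˡ (ℝ.trans (ℝ.-‿cong (ℝ.sym (negˡ _ b))) (neg-neg _)))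
      (ℝ.trans (solve 3 (λ r a b → r :* a :* a :+ r :* b :* b := r :* (a :* a :+ b :* b)) ℝ.refl r a b) (recip-inverse n 0<n))
    im : r ℝ.* a ℝ.* b ℝ.+ ℝ.- (r ℝ.* b) ℝ.* a ℝ.≈ ℝ.0#
    im = ℝ.trans (ℝ.+-congˡ (ℝ.trans (ℝ.sym (negˡ _ a)) (ℝ.-‿cong (solve 3 (λ r a b → r :* b :* a := r :* a :* b) ℝ.refl r a b)))) (ℝ.-‿inverseʳ _)

  -- The half angle: exp(2πi q) is the square of `cis` at q, while the axioms on `exp` give the
  -- value of `cis` at 1 and the sign of its imaginary part on (0, 1).
  cis : ℝ.Carrier → Carrier
  cis t = exp (i· (π ℝ.* t))

  cis-cong : ∀ {s t} → s ℝ.≈ t → cis s ≈ cis t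
  cis-cong e = exp-cong (ℝ.refl , ℝ.*-congˡ e)

  cis-+ : ∀ s t → cis (s ℝ.+ t) ≈ cis s * cis t
  cis-+ s t = trans (exp-cong (ℝ.sym (ℝ.+-identityʳ _) , ℝ.distribˡ π s t)) (exp-+ _ _)

  cis-1 : cis ℝ.1# ≈ - 1#
  cis-1 = trans (exp-cong (ℝ.refl , ℝ.*-identityʳ π)) exp-iπ

  -- Here exp 0 = 1 is derived: cis 1 times cis 0 equals cis 1, and cis 1 = -1 can be cancelled.
  cis-0 : cis ℝ.0# ≈ 1#
  cis-0 = begin
    cis ℝ.0#               ≈⟨ ⁻¹-involutive _ ⟨
    - - cis ℝ.0#           ≈⟨ -‿cong (-1*x≈-x _) ⟨
    - (- 1# * cis ℝ.0#)    ≈⟨ -‿cong (*-congʳ cis-1) ⟨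
    - (cis ℝ.1# * cis ℝ.0#) ≈⟨ -‿cong (cis-+ ℝ.1# ℝ.0#) ⟨
    - cis (ℝ.1# ℝ.+ ℝ.0#)  ≈⟨ -‿cong (cis-cong (ℝ.+-identityʳ _)) ⟩
    - cis ℝ.1#             ≈⟨ -‿cong cis-1 ⟩
    - - 1#                 ≈⟨ ⁻¹-involutive _ ⟩
    1#                     ∎

  cis-neg : ∀ t → cis t * cis (ℝ.- t) ≈ 1#
  cis-neg t = trans (sym (cis-+ t (ℝ.- t))) (trans (cis-cong (ℝ.-‿inverseʳ t)) cis-0)

  double : ℝ.Carrier → Carrier
  double t = cis t * cis t

  double-cong : ∀ {s t} → s ℝ.≈ t → double s ≈ double t
  double-cong e = *-cong (cis-cong e) (cis-cong e)

  double-+ : ∀ s t → double (s ℝ.+ t) ≈ double s * double t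
  double-+ s t = trans (*-cong (cis-+ s t) (cis-+ s t)) (medial (cis s) (cis t) (cis s) (cis t))
    where open Algebra.Properties.CommutativeSemigroup *-commutativeSemigroup using () renaming (interchange to medial)

  double-fromℕ : ∀ n → double (ℝ.fromℕ n) ≈ 1#
  double-fromℕ zero    = trans (*-cong cis-0 cis-0) (*-identityˡ 1#)
  double-fromℕ (suc n) = begin
    double (ℝ.1# ℝ.+ ℝ.fromℕ n)          ≈⟨ double-+ ℝ.1# (ℝ.fromℕ n) ⟩
    double ℝ.1# * double (ℝ.fromℕ n)     ≈⟨ *-cong (trans (*-cong cis-1 cis-1) (trans (-1*x≈-x (- 1#)) (⁻¹-involutive 1#))) (double-fromℕ n) ⟩
    1# * 1#                              ≈⟨ *-identityˡ 1# ⟩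
    1#                                   ∎

  double-fromInteger : ∀ k → double (ℝ.fromInteger k) ≈ 1#
  double-fromInteger (ℤ.+ n)    = double-fromℕ n
  double-fromInteger ℤ.-[1+ n ] = begin
    double (ℝ.- x)               ≈⟨ *-identityˡ _ ⟨
    1# * double (ℝ.- x)          ≈⟨ *-congʳ (double-fromℕ (suc n)) ⟨
    double x * double (ℝ.- x)    ≈⟨ double-+ x (ℝ.- x) ⟨
    double (x ℝ.- x)             ≈⟨ double-cong (ℝ.-‿inverseʳ x) ⟩
    double ℝ.0#                  ≈⟨ double-fromℕ 0 ⟩
    1#                           ∎
    where x = ℝ.fromℕ (suc n)

  exp2πi≈double : ∀ q → exp2πi q ≈ double (ℝ.fromℚ q)
  exp2πi≈double q = trans
    (exp-cong (ℝ.sym (ℝ.+-identityʳ _) , solve 2 (λ p x → (con 1 :+ con 1) :* p :* x := p :* x :+ p :* x) ℝ.refl π (ℝ.fromℚ q)))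
    (exp-+ _ _)
    where open Algebra.Solver.Ring.NaturalCoefficients.Default ℝ.commutativeSemiring

  exp2πi-+ : ∀ p q → exp2πi (p ℚ.+ q) ≈ exp2πi p * exp2πi q
  exp2πi-+ p q = begin
    exp2πi (p ℚ.+ q)                         ≈⟨ exp2πi≈double (p ℚ.+ q) ⟩
    double (ℝ.fromℚ (p ℚ.+ q))               ≈⟨ double-cong (fromℚ-+ p q) ⟩
    double (ℝ.fromℚ p ℝ.+ ℝ.fromℚ q)         ≈⟨ double-+ _ _ ⟩
    double (ℝ.fromℚ p) * double (ℝ.fromℚ q)  ≈⟨ *-cong (exp2πi≈double p) (exp2πi≈double q) ⟨
    exp2πi p * exp2πi q                      ∎

  exp2πi-fromℤ : ∀ k → exp2πi (fromℤ k) ≈ 1#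
  exp2πi-fromℤ k = trans (exp2πi≈double (fromℤ k)) (trans (double-cong (fromℚ-fromℤ k)) (double-fromInteger k))

  exp2πi-cong : ∀ {p q} → p ≡ℤ q → exp2πi p ≈ exp2πi q
  exp2πi-cong {_} {q} (shift k ≡.refl) = begin
    exp2πi (q ℚ.+ fromℤ k)        ≈⟨ exp2πi-+ q (fromℤ k) ⟩
    exp2πi q * exp2πi (fromℤ k)   ≈⟨ *-congˡ (exp2πi-fromℤ k) ⟩
    exp2πi q * 1#                 ≈⟨ *-identityʳ _ ⟩
    exp2πi q                      ∎

  -- With h = exp(iπt), h² - 1 = h (h - h⁻¹) and h⁻¹ = - exp(iπ(1 - t)), so that
  -- h - h⁻¹ has imaginary part sin(πt) + sin(π(1 - t)) > 0.
  double-1-invertible : ∀ t → ℝ.0# ℝ.< t → ℝ.0# ℝ.< ℝ.1# ℝ.- t → IsInvertible (double t - 1#)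
  double-1-invertible t 0<t 0<1-t =
    let w , wz≈1 = Im-pos⇒invertible z (+-pos (Im-cis-pos t 0<t 0<1-t) (Im-cis-pos (ℝ.1# ℝ.- t) 0<1-t (ℝ.<-respʳ-≈ (ℝ.sym 1-[1-t]) 0<t))) in
    w * cis (ℝ.- t) , (begin
      w * cis (ℝ.- t) * (double t - 1#)     ≈⟨ *-congˡ factor ⟩
      w * cis (ℝ.- t) * (cis t * z)         ≈⟨ *-assoc w _ _ ⟩
      w * (cis (ℝ.- t) * (cis t * z))       ≈⟨ *-congˡ (*-assoc (cis (ℝ.- t)) (cis t) z) ⟨
      w * (cis (ℝ.- t) * cis t * z)         ≈⟨ *-congˡ (*-congʳ (trans (*-comm (cis (ℝ.- t)) (cis t)) (cis-neg t))) ⟩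
      w * (1# * z)                          ≈⟨ *-congˡ (*-identityˡ z) ⟩
      w * z                                 ≈⟨ wz≈1 ⟩
      1#                                    ∎)
    where
    z = cis t + cis (ℝ.1# ℝ.- t)

    1-[1-t] : ℝ.1# ℝ.- (ℝ.1# ℝ.- t) ℝ.≈ t
    1-[1-t] = ℝ.trans (ℝ.+-congˡ (ℝ.trans (ℝ.sym (⁻¹-∙-comm′ ℝ.1# (ℝ.- t))) (ℝ.+-congˡ (⁻¹-involutive′ t))))
      (ℝ.trans (ℝ.sym (ℝ.+-assoc _ _ _)) (ℝ.trans (ℝ.+-congʳ (ℝ.-‿inverseʳ _)) (ℝ.+-identityˡ t)))
      where open Algebra.Properties.AbelianGroup ℝ.+-abelianGroup renaming (⁻¹-∙-comm to ⁻¹-∙-comm′; ⁻¹-involutive to ⁻¹-involutive′)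

    Im-cis-pos : ∀ s → ℝ.0# ℝ.< s → ℝ.0# ℝ.< ℝ.1# ℝ.- s → ℝ.0# ℝ.< Im (cis s)
    Im-cis-pos s 0<s 0<1-s = sin-pos (π ℝ.* s) (ℝ.*-pos 0<π 0<s)
      (ℝ.<-respʳ-≈ sum≈π (ℝ.<-respˡ-≈ (ℝ.+-identityˡ _) (ℝ.+-mono-< (π ℝ.* s) (ℝ.*-pos 0<π 0<1-s))))
      where
      sum≈π : π ℝ.* (ℝ.1# ℝ.- s) ℝ.+ π ℝ.* s ℝ.≈ π
      sum≈π = ℝ.trans (ℝ.sym (ℝ.distribˡ π _ s)) (ℝ.trans
        (ℝ.*-congˡ (ℝ.trans (ℝ.+-assoc _ _ _) (ℝ.trans (ℝ.+-congˡ (ℝ.-‿inverseˡ s)) (ℝ.+-identityʳ _)))) (ℝ.*-identityʳ π))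

    factor : double t - 1# ≈ cis t * z
    factor = begin
      double t - 1#                              ≈⟨ +-congˡ {x = double t} (-‿cong (cis-neg t)) ⟨
      double t - cis t * cis (ℝ.- t)             ≈⟨ x[y-z]≈xy-xz (cis t) (cis t) (cis (ℝ.- t)) ⟨
      cis t * (cis t - cis (ℝ.- t))              ≈⟨ *-congˡ (+-congˡ {x = cis t} (-1*x≈-x (cis (ℝ.- t)))) ⟨
      cis t * (cis t + - 1# * cis (ℝ.- t))       ≈⟨ *-congˡ (+-congˡ {x = cis t} (*-congʳ cis-1)) ⟨
      cis t * (cis t + cis ℝ.1# * cis (ℝ.- t))   ≈⟨ *-congˡ (+-congˡ {x = cis t} (cis-+ ℝ.1# (ℝ.- t))) ⟨
      cis t * z                                  ∎

  exp2πi-nontrivial : ∀ q → (q ≡ℤ ℚ.0ℚ) ⊎ IsInvertible (exp2πi q - 1#)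
  exp2πi-nontrivial q with fractionalPart q
  ... | inj₁ q≡0 = inj₁ q≡0
  ... | inj₂ (k , t , 0<t , 0<1-t , e) =
    let w , w*≈1 = double-1-invertible t 0<t 0<1-t in
    inj₂ (w , trans (*-congˡ (+-congʳ (begin
      exp2πi q                                   ≈⟨ exp2πi≈double q ⟩
      double (ℝ.fromℚ q)                         ≈⟨ double-cong e ⟩
      double (t ℝ.+ ℝ.fromInteger k)             ≈⟨ double-+ t _ ⟩
      double t * double (ℝ.fromInteger k)        ≈⟨ *-congˡ (double-fromInteger k) ⟩
      double t * 1#                              ≈⟨ *-identityʳ _ ⟩
      double t                                   ∎))) w*≈1)

  ofReal-* : ∀ x y → ofReal (x ℝ.* y) ≈ ofReal x * ofReal y
  ofReal-* x y =
      ℝ.sym (ℝ.trans (ℝ.+-congˡ (ℝ.trans (ℝ.-‿cong (ℝ.zeroˡ _)) -0≈0)) (ℝ.+-identityʳ _))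
    , ℝ.sym (ℝ.trans (ℝ.+-cong (ℝ.zeroʳ x) (ℝ.zeroˡ y)) (ℝ.+-identityˡ _))
    where open Algebra.Properties.Ring ℝ.ring using () renaming (-0#≈0# to -0≈0)

  ofReal-fromℕ : ∀ n → ofReal (ℝ.fromℕ n) ≈ n times 1#
  ofReal-fromℕ zero    = refl
  ofReal-fromℕ (suc n) = trans (ℝ.refl , ℝ.sym (ℝ.+-identityˡ _)) (+-congˡ {x = 1#} (ofReal-fromℕ n))

  ℂ-scalars : FourierScalars (Complex.ℂ-ring reals)
  ℂ-scalars = record
    { e            = exp2πi
    ; e-cong       = exp2πi-cong
    ; e-0          = exp2πi-fromℤ ℤ.0ℤ
    ; e-+          = exp2πi-+
    ; e-nontrivial = exp2πi-nontrivial
    ; √⁻¹          = invSqrt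
    ; √⁻¹-1        = invSqrt-1 , ℝ.refl
    ; √⁻¹-*        = λ m n → trans (invSqrt-* m n , ℝ.refl) (ofReal-* _ _)
    ; √⁻¹-square   = λ n → begin
        invSqrt (suc n) * invSqrt (suc n) * (suc n times 1#)
          ≈⟨ *-cong (ofReal-* _ _) (ofReal-fromℕ (suc n)) ⟨
        ofReal (r n ℝ.* r n) * ofReal (ℝ.fromℕ (suc n))
          ≈⟨ ofReal-* (r n ℝ.* r n) (ℝ.fromℕ (suc n)) ⟨
        ofReal (r n ℝ.* r n ℝ.* ℝ.fromℕ (suc n))
          ≈⟨ invSqrt-square n , ℝ.refl ⟩
        1# ∎
    }
    where
    r : ℕ → ℝ.Carrier
    r n = RealNumbers.invSqrt reals (suc n)

-- Generators of Clifford-Weil groups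

module Σℕ = FiniteSums ℕ.+-*-commutativeSemiring

module _ (X : FiniteSet) (N : ℕ) where
  private
    module X = FiniteSet X
    Xᴺ = X ^ᶠ N

  -- For `P` the image of ι on V and `P′` that on V^(2N) this says that the second has |ιV|^N |ιV|^N
  -- elements. Powers appear as constant products, the shape in which the normalising constants of
  -- the tensor factors arise.
  cardinality-power² : {P : Pred X.Carrier 0ℓ} (P? : Decidable P) {P′ : Pred (FiniteSet.Carrier (Xᴺ ×ᶠ Xᴺ)) 0ℓ} (P′? : Decidable P′) →
                       (∀ {x y} → (∀ i → P (x i)) × (∀ i → P (y i)) → P′ (x , y)) →
                       (∀ {x y} → P′ (x , y) → (∀ i → P (x i)) × (∀ i → P (y i))) →
                       cardinality (Xᴺ ×ᶠ Xᴺ) P′? ≡ Σℕ.product {N} (λ _ → cardinality X P?) ℕ.* Σℕ.product {N} (λ _ → cardinality X P?)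
  cardinality-power² P? P′? ⇒P′ P′⇒ = begin
    Σℕ.Σ[ Xᴺ ×ᶠ Xᴺ ] (λ xy → Σℕ.ind (P′? xy))
      ≡⟨ Σℕ.Σ-cong (Xᴺ ×ᶠ Xᴺ) split ⟩
    Σℕ.Σ[ Xᴺ ×ᶠ Xᴺ ] (λ (x , y) → I x ℕ.* I y)
      ≡⟨ Σℕ.Σ-× Xᴺ Xᴺ (λ (x , y) → I x ℕ.* I y) ⟩
    Σℕ.Σ[ Xᴺ ] (λ x → Σℕ.Σ[ Xᴺ ] (λ y → I x ℕ.* I y))
      ≡⟨ Σℕ.Σ-cong Xᴺ (λ x → Σℕ.Σ-distribˡ Xᴺ (I x) I) ⟨
    Σℕ.Σ[ Xᴺ ] (λ x → I x ℕ.* Σℕ.Σ[ Xᴺ ] I)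
      ≡⟨ Σℕ.Σ-distribʳ Xᴺ (Σℕ.Σ[ Xᴺ ] I) I ⟨
    Σℕ.Σ[ Xᴺ ] I ℕ.* Σℕ.Σ[ Xᴺ ] I
      ≡⟨ ≡.cong₂ ℕ._*_ (Σℕ.Σ-^ X N (λ _ x → Σℕ.ind (P? x))) (Σℕ.Σ-^ X N (λ _ x → Σℕ.ind (P? x))) ⟩
    Σℕ.product {N} (λ _ → cardinality X P?) ℕ.* Σℕ.product {N} (λ _ → cardinality X P?) ∎
    where
    open ≡.≡-Reasoning
    I : (Fin N → X.Carrier) → ℕ
    I x = Σℕ.product (λ i → Σℕ.ind (P? (x i)))

    split : ∀ xy → Σℕ.ind (P′? xy) ≡ I (proj₁ xy) ℕ.* I (proj₂ xy)
    split (x , y) = ≡.sym (≡.trans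
      (≡.cong₂ ℕ._*_ (Σℕ.ind-∀ (λ i → P? (x i)) (Fin.all? (λ i → P? (x i))) id id) (Σℕ.ind-∀ (λ i → P? (y i)) (Fin.all? (λ i → P? (y i))) id id))
      (Σℕ.ind-∧ (Fin.all? (λ i → P? (x i))) (Fin.all? (λ i → P? (y i))) (P′? (x , y)) ⇒P′ P′⇒))

module _ {F : FormRing} (ρ : FiniteRep F) where
  open FormRing F
  open FiniteRep ρ
  private
    module b m = BilinearForm (TensorHom.to ρM m)

  β-biadditive : IsBiadditive V.+ᴹ-abelianGroup V.+ᴹ-abelianGroup ℚ/ℤ β
  β-biadditive = b.isBiadditive ψ1

  private module β = IsBiadditive β-biadditive

  bil-cong : ∀ {m m′} → m M.≈ m′ → ∀ x y → bil m x y ℚ/ℤ.≈ bil m′ x y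
  bil-cong = Additive.cong (TensorHom.additive ρM)

  ψ-linear₁ : ∀ r → Inverse.to ψ r M.≈ ψ1 M.· R.1# ⊗ r
  ψ-linear₁ r = M.trans (Inverse.to-cong ψ (R.sym (R.*-identityˡ r))) (ψ-linear R.1# r)

  bil-ψ : ∀ r x y → bil (Inverse.to ψ r) x y ℚ/ℤ.≈ β x (r V.*ₗ y)
  bil-ψ r x y = ℚ/ℤ.trans (bil-cong (ψ-linear₁ r) x y)
    (ℚ/ℤ.trans (TensorHom.·-homo ρM ψ1 R.1# r x y) (Additive.cong (β.additiveˡ (r V.*ₗ y)) (V.*ₗ-identityˡ x)))

  -- The definition of `ᴶ` amounts to ψ(rᴶ) = ψ(1)(r ⊗ 1); applying ρ_M to both sides gives the
  -- adjunction.
  β-adjoint : ∀ r x y → β (r V.*ₗ x) y ℚ/ℤ.≈ β x ((r ᴶ) V.*ₗ y)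
  β-adjoint r x y = begin
    β (r V.*ₗ x) y                                  ≈⟨ Additive.cong (β.additiveʳ (r V.*ₗ x)) (V.*ₗ-identityˡ y) ⟨
    β (r V.*ₗ x) (R.1# V.*ₗ y)                      ≈⟨ TensorHom.·-homo ρM ψ1 r R.1# x y ⟨
    bil (ψ1 M.· r ⊗ R.1#) x y                       ≈⟨ bil-cong (Inverse.strictlyInverseˡ ψ _) x y ⟨
    bil (Inverse.to ψ (r ᴶ)) x y                    ≈⟨ bil-ψ (r ᴶ) x y ⟩
    β x ((r ᴶ) V.*ₗ y)                              ∎
    where open Relation.Binary.Reasoning.Setoid ℚ/ℤ.setoid

  β-nondegenerateˡ : ∀ x → (∀ y → β x y ℚ/ℤ.≈ ℚ/ℤ.0#) → x V.≈ᴹ V.0ᴹ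
  β-nondegenerateˡ x e = NonSingular.injective β-nonsingular x V.0ᴹ
    (λ y → ℚ/ℤ.trans (e y) (ℚ/ℤ.sym (Additive.0-homo (β.additiveˡ y))))

  -- β(x, y) = β(y, ε x) for the unit ε = ψ⁻¹(τ(ψ(1))).
  β-nondegenerateʳ : ∀ y → (∀ x → β x y ℚ/ℤ.≈ ℚ/ℤ.0#) → y V.≈ᴹ V.0ᴹ
  β-nondegenerateʳ y e = β-nondegenerateˡ y λ x → begin
    β y x                                ≈⟨ Additive.cong (β.additiveʳ y) (V.≈ᴹ-trans (V.≈ᴹ-sym (V.*ₗ-assoc ε ε⁻¹ x)) (V.≈ᴹ-trans (V.*ₗ-congʳ (proj₁ (proj₂ τ-unit))) (V.*ₗ-identityˡ x))) ⟨
    β y (ε V.*ₗ (ε⁻¹ V.*ₗ x))            ≈⟨ bil-ψ ε y (ε⁻¹ V.*ₗ x) ⟨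
    bil (Inverse.to ψ ε) y (ε⁻¹ V.*ₗ x)  ≈⟨ bil-cong (Inverse.strictlyInverseˡ ψ (τ ψ1)) y (ε⁻¹ V.*ₗ x) ⟩
    bil (τ ψ1) y (ε⁻¹ V.*ₗ x)            ≈⟨ bil-τ ψ1 y (ε⁻¹ V.*ₗ x) ⟩
    β (ε⁻¹ V.*ₗ x) y                     ≈⟨ e (ε⁻¹ V.*ₗ x) ⟩
    ℚ/ℤ.0#                               ∎
    where
    open Relation.Binary.Reasoning.Setoid ℚ/ℤ.setoid
    ε = Inverse.from ψ (τ ψ1)
    ε⁻¹ = proj₁ τ-unit

  -- The exponent in h extended to a form on all of V: the u in ιV that contributes to b_x is ιx.
  β-ιv : (ι v : R.Carrier) → V.Carrierᴹ → V.Carrierᴹ → ℚ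
  β-ιv ι v x w = β (ι V.*ₗ x) (v V.*ₗ w)

  module _ {ι u v : R.Carrier} (ι-idem : ι R.* ι R.≈ ι) (v∈ : ∃[ r ] v R.≈ ι ᴶ R.* r R.* ι)
           (uv≈ι : u R.* v R.≈ ι) (vu≈ιᴶ : v R.* u R.≈ ι ᴶ) where

    β-ιv-biadditive : IsBiadditive V.+ᴹ-abelianGroup V.+ᴹ-abelianGroup ℚ/ℤ (β-ιv ι v)
    β-ιv-biadditive = ∘-biadditive β-biadditive (*ₗ-additive V.leftModule ι) (*ₗ-additive V.leftModule v)

    private
      act : ∀ {r s t} → r R.* s R.≈ t → ∀ x → r V.*ₗ (s V.*ₗ x) V.≈ᴹ t V.*ₗ x
      act e x = V.≈ᴹ-trans (V.≈ᴹ-sym (V.*ₗ-assoc _ _ x)) (V.*ₗ-congʳ e)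

      vι≈v : v R.* ι R.≈ v
      vι≈v = let r , v≈ = v∈ in
        R.trans (R.*-congʳ v≈) (R.trans (R.*-assoc _ ι ι) (R.trans (R.*-congˡ ι-idem) (R.sym v≈)))

    β-ιv-ˡ : ∀ x y → β-ιv ι v (ι V.*ₗ x) y ℚ/ℤ.≈ β-ιv ι v x y
    β-ιv-ˡ x y = Additive.cong (β.additiveˡ (v V.*ₗ y)) (act ι-idem x)

    β-ιv-ʳ : ∀ x y → β-ιv ι v x (ι V.*ₗ y) ℚ/ℤ.≈ β-ιv ι v x y
    β-ιv-ʳ x y = Additive.cong (β.additiveʳ (ι V.*ₗ x)) (act vι≈v y)

    -- β(ιx, y) = β(ιx, ιᴶy) = β(ιx, v u y) because ι is idempotent and v u = ιᴶ, so every value of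
    -- β(ιx, ·) is a value of the restricted form.
    β-ιv-nondegenerateˡ : ∀ x → (∀ y → β-ιv ι v x y ℚ/ℤ.≈ ℚ/ℤ.0#) → ι V.*ₗ x V.≈ᴹ V.0ᴹ
    β-ιv-nondegenerateˡ x e = β-nondegenerateˡ (ι V.*ₗ x) λ y → begin
      β (ι V.*ₗ x) y                   ≈⟨ Additive.cong (β.additiveˡ y) (act ι-idem x) ⟨
      β (ι V.*ₗ (ι V.*ₗ x)) y          ≈⟨ β-adjoint ι (ι V.*ₗ x) y ⟩
      β (ι V.*ₗ x) ((ι ᴶ) V.*ₗ y)      ≈⟨ Additive.cong (β.additiveʳ (ι V.*ₗ x)) (act vu≈ιᴶ y) ⟨
      β-ιv ι v x (u V.*ₗ y)                ≈⟨ e (u V.*ₗ y) ⟩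
      ℚ/ℤ.0#                           ∎
      where open Relation.Binary.Reasoning.Setoid ℚ/ℤ.setoid

    -- Moving ι across β shows that ιᴶ v y is orthogonal to everything, hence 0; applying u gives ιy
    -- = 0, as u ιᴶ v = ι.
    β-ιv-nondegenerateʳ : ∀ y → (∀ x → β-ιv ι v x y ℚ/ℤ.≈ ℚ/ℤ.0#) → ι V.*ₗ y V.≈ᴹ V.0ᴹ
    β-ιv-nondegenerateʳ y e = begin
      ι V.*ₗ y                             ≈⟨ V.*ₗ-congʳ ι≈ ⟩
      ((u R.* ι ᴶ) R.* v) V.*ₗ y             ≈⟨ V.*ₗ-assoc (u R.* ι ᴶ) v y ⟩
      (u R.* ι ᴶ) V.*ₗ (v V.*ₗ y)          ≈⟨ V.*ₗ-assoc u (ι ᴶ) (v V.*ₗ y) ⟩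
      u V.*ₗ ((ι ᴶ) V.*ₗ (v V.*ₗ y))       ≈⟨ V.*ₗ-congˡ (β-nondegenerateʳ _ (λ x → ℚ/ℤ.trans (ℚ/ℤ.sym (β-adjoint ι x (v V.*ₗ y))) (e x))) ⟩
      u V.*ₗ V.0ᴹ                          ≈⟨ V.*ₗ-zeroʳ u ⟩
      V.0ᴹ                                 ∎
      where
      open Relation.Binary.Reasoning.Setoid V.≈ᴹ-setoid
      ι≈ : ι R.≈ (u R.* ι ᴶ) R.* v
      ι≈ = R.sym (R.trans (R.*-congʳ (R.trans (R.*-congˡ (R.sym vu≈ιᴶ)) (R.trans (R.sym (R.*-assoc u v u)) (R.*-congʳ uv≈ι))))
        (R.trans (R.*-assoc ι u v) (R.trans (R.*-congˡ uv≈ι) ι-idem)))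

-- Matrices of the generators and their lifts to ρ^(N,N)

module GeneratorLifts {K : CommutativeRing 0ℓ 0ℓ} (scalars : FourierScalars K) where
  open FourierScalars scalars
  open CommutativeRing K hiding (zero)
  open FiniteSums commutativeSemiring
  open Matrices K
  open Linear K
  open Kernels scalars
  open Algebra.Properties.CommutativeSemigroup *-commutativeSemigroup using () renaming (interchange to medial)
  open Algebra.Properties.Monoid.Mult +-monoid using (×-homo-+) renaming (_×_ to _times_)
  open Relation.Binary.Reasoning.Setoid setoid

  module _ {F : FormRing} (ρ : FiniteRep F) where
    open FormRing F using (module R; module Φ)
    open FiniteRep ρ
    private
      X = V.finiteSet
      open FiniteSet X using (_≟_)

    -- Opaque, since unfolding makes comparison of these operators over ℂ intractable.
    opaque
      mOp : R.Carrier → LinearMap (Free X) (Free X)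
      mOp r = extend X λ w → basis X (r V.*ₗ w)

      dOp : Φ.Carrier → LinearMap (Free X) (Free X)
      dOp φ = extend X λ w → LeftModule._*ₗ_ (Free X) (e (quad φ w)) (basis X w)

      hColumn : (ι v : R.Carrier) {P : Pred V.Carrierᴹ 0ℓ} → Decidable P → V.Carrierᴹ → LeftModule.Carrierᴹ (Free X)
      hColumn ι v P? w = LeftModule._*ₗ_ (Free X)
        (√⁻¹ (cardinality X P?))
        (∑-in X (LeftModule.+ᴹ-commutativeMonoid (Free X)) P? λ u →
          LeftModule._*ₗ_ (Free X) (e (β u (v V.*ₗ w))) (basis X (u V.+ᴹ (R.1# R.- ι) V.*ₗ w)))

      hOp : (ι v : R.Carrier) {P : Pred V.Carrierᴹ 0ℓ} → Decidable P → LinearMap (Free X) (Free X)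
      hOp ι v P? = extend X (hColumn ι v P?)

    opaque
      unfolding mOp

      mOp-matrix : ∀ r x w → matrix X X (mOp r) x w ≈ δ X (r V.*ₗ w) x
      mOp-matrix r x w = extend-basis X X (λ w → basis X (r V.*ₗ w)) (λ x e → δ-≈ X (V.*ₗ-congˡ e) V.≈ᴹ-refl) x w

      dOp-matrix : ∀ φ x w → matrix X X (dOp φ) x w ≈ e (quad φ w) * δ X w x
      dOp-matrix φ x w = extend-basis X X (λ w → LeftModule._*ₗ_ (Free X) (e (quad φ w)) (basis X w))
        (λ x eq → *-cong (e-cong (QuadraticForm.cong (QHom.to ρΦ φ) eq)) (δ-≈ X eq V.≈ᴹ-refl)) x w

    -- `P` is membership in ιV in any decidable presentation: the predicate in the definition of the
    -- group is tied to the complex numbers, whereas `K` is arbitrary here.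
    module _ {ι v : R.Carrier} (ι-idem : ι R.* ι R.≈ ι) {P : Pred V.Carrierᴹ 0ℓ} (P? : Decidable P)
             (P⇒ : ∀ {x} → P x → ∃[ y ] x V.≈ᴹ ι V.*ₗ y) (⇒P : ∀ {x} → (∃[ y ] x V.≈ᴹ ι V.*ₗ y) → P x) where

      private
        c = √⁻¹ (cardinality X P?)
        p q : V.Carrierᴹ → V.Carrierᴹ
        p x = ι V.*ₗ x
        q x = (R.1# R.- ι) V.*ₗ x
        module β = IsBiadditive (β-biadditive ρ)
        module VG = Algebra.Properties.AbelianGroup V.+ᴹ-abelianGroup

        P⇒q0 : ∀ {x} → P x → q x V.≈ᴹ V.0ᴹ
        P⇒q0 Px = let y , x≈ιy = P⇒ Px in V.≈ᴹ-trans (V.*ₗ-congˡ x≈ιy) (qp V ι ι-idem y)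

        q0⇒P : ∀ {x} → q x V.≈ᴹ V.0ᴹ → P x
        q0⇒P {x} qx≈0 = ⇒P (x , V.≈ᴹ-trans (V.≈ᴹ-sym (p+q V ι ι-idem x)) (V.≈ᴹ-trans (V.+ᴹ-congˡ qx≈0) (V.+ᴹ-identityʳ _)))

        P⇒p : ∀ {x} → P x → p x V.≈ᴹ x
        P⇒p {x} Px = V.≈ᴹ-trans (V.≈ᴹ-sym (V.≈ᴹ-trans (V.+ᴹ-congˡ (P⇒q0 Px)) (V.+ᴹ-identityʳ _))) (p+q V ι ι-idem x)

        -- Apply ι and 1 - ι to u + q w = x.
        decompose : ∀ {x w u} → P u → u V.+ᴹ q w V.≈ᴹ x → u V.≈ᴹ p x × q x V.≈ᴹ q w
        decompose {x} {w} {u} Pu u+qw≈x =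
            V.≈ᴹ-trans (V.≈ᴹ-sym (P⇒p Pu)) (V.≈ᴹ-trans (V.≈ᴹ-sym (V.+ᴹ-identityʳ _)) (V.≈ᴹ-trans (V.+ᴹ-congˡ (V.≈ᴹ-sym (pq V ι ι-idem w)))
              (V.≈ᴹ-trans (V.≈ᴹ-sym (V.*ₗ-distribˡ ι u (q w))) (V.*ₗ-congˡ u+qw≈x))))
          , V.≈ᴹ-trans (V.*ₗ-congˡ (V.≈ᴹ-sym u+qw≈x)) (V.≈ᴹ-trans (q-+ V ι ι-idem u (q w)) (V.≈ᴹ-trans (V.+ᴹ-cong (P⇒q0 Pu) qq) (V.+ᴹ-identityˡ _)))
          where
          qq : q (q w) V.≈ᴹ q w
          qq = V.≈ᴹ-trans (V.≈ᴹ-sym (V.+ᴹ-identityˡ _)) (V.≈ᴹ-trans (V.+ᴹ-congʳ (V.≈ᴹ-sym (pq V ι ι-idem w))) (p+q V ι ι-idem (q w)))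

      opaque
        unfolding hColumn

        -- V is the direct sum of ιV and (1 - ι)V, so among the u in ιV only u = p x can contribute
        -- to b_x, and it does so exactly when q x = q w.
        hColumn-≈ : ∀ w x → (hColumn ι v P? w ⟨$⟩ x) ≈ kernel V ι ι-idem c (β-ιv ρ ι v) x w
        hColumn-≈ w x = *-congˡ {x = c} (trans (Free-sum X (λ k → summand (FiniteSet.enum X k)) x) (total (q x ≟ q w)))
          where
          scaled : V.Carrierᴹ → LeftModule.Carrierᴹ (Free X)
          scaled u = LeftModule._*ₗ_ (Free X) (e (β u (v V.*ₗ w))) (basis X (u V.+ᴹ q w))

          summand : V.Carrierᴹ → LeftModule.Carrierᴹ (Free X)
          summand u = if does (P? u) then scaled u else LeftModule.0ᴹ (Free X)

          summand-0 : ∀ u → (P u → ¬ (u V.+ᴹ q w V.≈ᴹ x)) → (summand u ⟨$⟩ x) ≈ 0#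
          summand-0 u off with P? u
          ... | no _   = refl
          ... | yes Pu = trans (*-congˡ (ind-no (u V.+ᴹ q w ≟ x) (off Pu))) (zeroʳ _)

          summand-1 : ∀ u → P u → u V.+ᴹ q w V.≈ᴹ x → (summand u ⟨$⟩ x) ≈ e (β u (v V.*ₗ w))
          summand-1 u Pu on with P? u
          ... | no ¬Pu = contradiction Pu ¬Pu
          ... | yes _  = trans (*-congˡ (ind-yes (u V.+ᴹ q w ≟ x) on)) (*-identityʳ _)

          total : Dec (q x V.≈ᴹ q w) → Σ[ X ] (λ u → summand u ⟨$⟩ x) ≈ δ X (q x) (q w) * e (β (p x) (v V.*ₗ w))
          total (yes qx≈qw) = trans
            (Σ-single X (p x) _
              (λ u u≈px → trans
                (summand-1 u (⇒P (x , u≈px)) (V.≈ᴹ-trans (V.+ᴹ-cong u≈px (V.≈ᴹ-sym qx≈qw)) (p+q V ι ι-idem x)))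
                (e-cong (Additive.cong (β.additiveˡ (v V.*ₗ w)) u≈px)))
              (λ u u≉px → summand-0 u (λ Pu e → u≉px (proj₁ (decompose Pu e)))))
            (sym (trans (*-congʳ (ind-yes (q x ≟ q w) qx≈qw)) (*-identityˡ _)))
          total (no qx≉qw) = trans
            (Σ-0 X (λ u → summand-0 u (λ Pu e → qx≉qw (proj₂ (decompose Pu e)))))
            (sym (trans (*-congʳ (ind-no (q x ≟ q w) qx≉qw)) (zeroˡ _)))

      opaque
        unfolding hOp

        hOp-matrix : ∀ x w → matrix X X (hOp ι v P?) x w ≈ kernel V ι ι-idem c (β-ιv ρ ι v) x w
        hOp-matrix x w = trans
          (extend-basis X X (hColumn ι v P?) (λ {w} {w′} x w≈ → trans (hColumn-≈ w x) (trans
            (*-congˡ {x = c} (*-cong (δ-≈ X V.≈ᴹ-refl (V.*ₗ-congˡ w≈)) (e-cong (Additive.cong (β.additiveʳ (p x)) (V.*ₗ-congˡ w≈)))))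
            (sym (hColumn-≈ w′ x)))) x w)
          (hColumn-≈ w x)

      -- As ιV is the kernel of `q`, the sum is |ιV|. It is not 0 since ιV contains the zero vector,
      -- so `√⁻¹-square` applies.
      √⁻¹-norm : c * c * Σ[ X ] (λ x → δ X (q x) V.0ᴹ) ≈ 1#
      √⁻¹-norm = trans (*-congˡ (sym card-times)) (norm (cardinality X P?) card≢0)
        where
        times-sum : ∀ {n} (f : Fin n → ℕ) → Σℕ.sum f times 1# ≈ sum (λ k → f k times 1#)
        times-sum {zero}  f = refl
        times-sum {suc n} f = trans (×-homo-+ 1# (f zero) _) (+-congˡ (times-sum (f ∘ suc)))

        card-times : cardinality X P? times 1# ≈ Σ[ X ] (λ x → δ X (q x) V.0ᴹ)
        card-times = trans (times-sum (λ k → Σℕ.ind (P? (FiniteSet.enum X k)))) (Σ-cong X count)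
          where
          count : ∀ x → Σℕ.ind (P? x) times 1# ≈ δ X (q x) V.0ᴹ
          count x with P? x
          ... | yes Px = trans (+-identityʳ 1#) (sym (ind-yes (q x ≟ V.0ᴹ) (P⇒q0 Px)))
          ... | no ¬Px = sym (ind-no (q x ≟ V.0ᴹ) (λ q0 → ¬Px (q0⇒P q0)))

        sum≡0⇒ : ∀ {n} (f : Fin n → ℕ) → Σℕ.sum f ≡ 0 → ∀ k → f k ≡ 0
        sum≡0⇒ f e zero    = ℕ.m+n≡0⇒m≡0 (f zero) e
        sum≡0⇒ f e (suc k) = sum≡0⇒ (f ∘ suc) (ℕ.m+n≡0⇒n≡0 (f zero) e) k

        card≢0 : ¬ (cardinality X P? ≡ 0)
        card≢0 e = contradiction (≡.trans (≡.sym (Σℕ.ind-yes (P? _) (⇒P (V.0ᴹ , V.≈ᴹ-trans (Inverse.strictlyInverseˡ (FiniteSet.enumeration X) V.0ᴹ) (V.≈ᴹ-sym (V.*ₗ-zeroʳ ι))))))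
          (sum≡0⇒ (λ k → Σℕ.ind (P? (FiniteSet.enum X k))) e (Inverse.from (FiniteSet.enumeration X) V.0ᴹ))) λ ()

        norm : ∀ n → ¬ (n ≡ 0) → √⁻¹ n * √⁻¹ n * (n times 1#) ≈ 1#
        norm zero    n≢0 = contradiction ≡.refl n≢0
        norm (suc n) _   = √⁻¹-square n

  e-∑ : ∀ {n} (a : Fin n → ℚ) → e (∑ a) ≈ product (λ i → e (a i))
  e-∑ {zero}  a = e-0
  e-∑ {suc n} a = trans (e-+ (a zero) (∑ (a ∘ suc))) (*-congˡ (e-∑ (a ∘ suc)))

  √⁻¹-product : ∀ {n} (f : Fin n → ℕ) → √⁻¹ (Σℕ.product f) ≈ product (λ i → √⁻¹ (f i))
  √⁻¹-product {zero}  f = √⁻¹-1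
  √⁻¹-product {suc n} f = trans (√⁻¹-* (f zero) (Σℕ.product (f ∘ suc))) (*-congˡ (√⁻¹-product (f ∘ suc)))

  δ-pair : ∀ X N (x y w z : Fin N → FiniteSet.Carrier X) →
           δ ((X ^ᶠ N) ×ᶠ (X ^ᶠ N)) (x , y) (w , z) ≈ (δ X ^⊗ N) x w * (δ X ^⊗ N) y z
  δ-pair X N x y w z = sym (trans (*-cong (δ-^⊗ X N x w) (δ-^⊗ X N y z))
    (ind-∧ (FiniteSet._≟_ (X ^ᶠ N) x w) (FiniteSet._≟_ (X ^ᶠ N) y z) (FiniteSet._≟_ ((X ^ᶠ N) ×ᶠ (X ^ᶠ N)) (x , y) (w , z)) id id))

  module _ {F : FormRing} (ρ : FiniteRep F) (N : ℕ) where
    open FormRing F using (module R; module Φ; _ᴶ)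
    open FiniteRep ρ
    private
      X = V.finiteSet
      ρ′ = ρ ^⟨ N ,- N ⟩
      module V′ = FiniteModule (FiniteRep.V (ρ ^⟨ N ,- N ⟩))

    m-lift : ∀ r → IsUnit (FormRing.R F) r → ConjugationLift V.finiteSet N (mOp ρ r) (mOp (ρ ^⟨ N ,- N ⟩) r)
    m-lift r (s , rs≈1 , sr≈1) = record
      { dual = m-dual V r s rs≈1 sr≈1
      ; g-matrix = mOp-matrix ρ r
      ; g′-matrix = λ x y w z → trans (mOp-matrix ρ′ r (x , y) (w , z)) (δ-pair X N (λ i → r V.*ₗ w i) (λ i → r V.*ₗ z i) x y)
      }

    -- The quadratic maps of ρ^(N,N) carry a minus sign on the last N coordinates, and `e` turns it
    -- into the inverse transpose factor.
    d-lift : ∀ φ → ConjugationLift V.finiteSet N (dOp ρ φ) (dOp (ρ ^⟨ N ,- N ⟩) φ)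
    d-lift φ = record
      { dual = d-dual V (quad φ) (QuadraticForm.cong (QHom.to ρΦ φ))
      ; g-matrix = dOp-matrix ρ φ
      ; g′-matrix = λ x y w z → begin
          matrix V′.finiteSet V′.finiteSet (dOp ρ′ φ) (x , y) (w , z)
            ≈⟨ dOp-matrix ρ′ φ (x , y) (w , z) ⟩
          e (∑ (λ i → quad φ (w i)) ℚ.+ ∑ (λ i → ℚ.- quad φ (z i))) * δ V′.finiteSet (w , z) (x , y)
            ≈⟨ *-cong (trans (e-+ _ _) (*-cong (e-∑ (λ i → quad φ (w i))) (e-∑ (λ i → ℚ.- quad φ (z i))))) (δ-pair X N w z x y) ⟩
          product (λ i → e (quad φ (w i))) * product (λ i → e (ℚ.- quad φ (z i))) * ((δ X ^⊗ N) w x * (δ X ^⊗ N) z y)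
            ≈⟨ medial _ _ _ _ ⟩
          product (λ i → e (quad φ (w i))) * (δ X ^⊗ N) w x * (product (λ i → e (ℚ.- quad φ (z i))) * (δ X ^⊗ N) z y)
            ≈⟨ *-cong (product-distrib-* (λ i → e (quad φ (w i))) (λ i → δ X (w i) (x i))) (product-distrib-* (λ i → e (ℚ.- quad φ (z i))) (λ i → δ X (z i) (y i))) ⟨
          product (λ i → e (quad φ (w i)) * δ X (w i) (x i)) * product (λ i → e (ℚ.- quad φ (z i)) * δ X (z i) (y i)) ∎
      }

    module _ {ι u v : R.Carrier} (ι-idem : ι R.* ι R.≈ ι) (v∈ : ∃[ r ] v R.≈ ι ᴶ R.* r R.* ι)
             (uv≈ι : u R.* v R.≈ ι) (vu≈ιᴶ : v R.* u R.≈ ι ᴶ)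
             {P : Pred V.Carrierᴹ 0ℓ} (P? : Decidable P)
             (P⇒ : ∀ {x} → P x → ∃[ y ] x V.≈ᴹ ι V.*ₗ y) (⇒P : ∀ {x} → (∃[ y ] x V.≈ᴹ ι V.*ₗ y) → P x)
             {P′ : Pred V′.Carrierᴹ 0ℓ} (P′? : Decidable P′)
             (P′⇒ : ∀ {x} → P′ x → ∃[ y ] x V′.≈ᴹ ι V′.*ₗ y) (⇒P′ : ∀ {x} → (∃[ y ] x V′.≈ᴹ ι V′.*ₗ y) → P′ x) where

      private
        Xᴺ = X ^ᶠ N
        κ = cardinality X P?
        c = √⁻¹ κ
        q : V.Carrierᴹ → V.Carrierᴹ
        q x = (R.1# R.- ι) V.*ₗ x
        B = β-ιv ρ ι v
        Cᴺ = product {N} (λ _ → c)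

        cardinality-split : cardinality V′.finiteSet P′? ≡ Σℕ.product {N} (λ _ → κ) ℕ.* Σℕ.product {N} (λ _ → κ)
        cardinality-split = cardinality-power² X N P? P′?
          (λ (Px , Py) → ⇒P′ (((λ i → proj₁ (P⇒ (Px i))) , (λ i → proj₁ (P⇒ (Py i)))) , (λ i → proj₂ (P⇒ (Px i))) , (λ i → proj₂ (P⇒ (Py i)))))
          (λ P′xy → let (x′ , y′) , ex , ey = P′⇒ P′xy in (λ i → ⇒P (x′ i , ex i)) , (λ i → ⇒P (y′ i , ey i)))

        √⁻¹-split : √⁻¹ (cardinality V′.finiteSet P′?) ≈ product {N} (λ _ → c) * product {N} (λ _ → c)
        √⁻¹-split = trans (reflexive (≡.cong √⁻¹ cardinality-split)) (trans (√⁻¹-* _ _)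
          (*-cong (√⁻¹-product {N} (λ _ → κ)) (√⁻¹-product {N} (λ _ → κ))))

        kernel-^⊗ : ∀ (B : V.Carrierᴹ → V.Carrierᴹ → ℚ) (x w : Fin N → V.Carrierᴹ) →
                    (kernel V ι ι-idem c B ^⊗ N) x w ≈
                    product {N} (λ _ → c) * ((δ X ^⊗ N) (q ∘ x) (q ∘ w) * product (λ i → e (B (x i) (w i))))
        kernel-^⊗ B x w = trans
          (product-distrib-* (λ _ → c) (λ i → δ X (q (x i)) (q (w i)) * e (B (x i) (w i))))
          (*-congˡ (product-distrib-* (λ i → δ X (q (x i)) (q (w i))) (λ i → e (B (x i) (w i)))))

      h-lift : ConjugationLift V.finiteSet N (hOp ρ ι v P?) (hOp (ρ ^⟨ N ,- N ⟩) ι v P′?)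
      h-lift = record
        { A = kernel V ι ι-idem c B
        ; B = kernel V ι ι-idem c (λ x y → ℚ.- B x y)
        ; dual = kernel-dual V ι ι-idem c (√⁻¹-norm ρ {ι} {v} ι-idem P? P⇒ ⇒P) B
            (β-ιv-biadditive ρ ι-idem v∈ uv≈ι vu≈ιᴶ) (β-ιv-ˡ ρ ι-idem v∈ uv≈ι vu≈ιᴶ) (β-ιv-ʳ ρ ι-idem v∈ uv≈ι vu≈ιᴶ)
            (β-ιv-nondegenerateˡ ρ ι-idem v∈ uv≈ι vu≈ιᴶ) (β-ιv-nondegenerateʳ ρ ι-idem v∈ uv≈ι vu≈ιᴶ)
        ; g-matrix = hOp-matrix ρ ι-idem P? P⇒ ⇒P
        ; g′-matrix = λ x y w z → begin
            matrix V′.finiteSet V′.finiteSet (hOp ρ′ ι v P′?) (x , y) (w , z)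
              ≈⟨ hOp-matrix ρ′ ι-idem P′? P′⇒ ⇒P′ (x , y) (w , z) ⟩
            √⁻¹ (cardinality V′.finiteSet P′?) * (δ V′.finiteSet ((q ∘ x) , (q ∘ y)) ((q ∘ w) , (q ∘ z)) *
              e (∑ (λ i → B (x i) (w i)) ℚ.+ ∑ (λ i → ℚ.- B (y i) (z i))))
              ≈⟨ *-cong √⁻¹-split (*-cong (δ-pair X N (q ∘ x) (q ∘ y) (q ∘ w) (q ∘ z))
                   (trans (e-+ _ _) (*-cong (e-∑ (λ i → B (x i) (w i))) (e-∑ (λ i → ℚ.- B (y i) (z i)))))) ⟩
            product {N} (λ _ → c) * product {N} (λ _ → c) * ((δ X ^⊗ N) (q ∘ x) (q ∘ w) * (δ X ^⊗ N) (q ∘ y) (q ∘ z) *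
              (product (λ i → e (B (x i) (w i))) * product (λ i → e (ℚ.- B (y i) (z i)))))
              -- One constant, one indicator and one character go to the N copies of ρ (in x, w),
              -- the others to the N copies of its negative (in y, z).
              ≈⟨ trans (*-congˡ {x = Cᴺ * Cᴺ} (medial _ _ _ _)) (medial _ _ _ _) ⟩
            product {N} (λ _ → c) * ((δ X ^⊗ N) (q ∘ x) (q ∘ w) * product (λ i → e (B (x i) (w i)))) *
              (product {N} (λ _ → c) * ((δ X ^⊗ N) (q ∘ y) (q ∘ z) * product (λ i → e (ℚ.- B (y i) (z i)))))
              ≈⟨ *-cong (kernel-^⊗ B x w) (kernel-^⊗ (λ y z → ℚ.- B y z) y z) ⟨
            (kernel V ι ι-idem c B ^⊗ N) x w * (kernel V ι ι-idem c (λ x y → ℚ.- B x y) ^⊗ N) y z ∎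
        }

-- Spans of vectors and of operators

module _ (K : CommutativeRing 0ℓ 0ℓ) where
  open CommutativeRing K using (Carrier; _≈_; _+_; _*_; 0#; +-cong; *-congˡ; trans; sym; commutativeSemiring)

  -- The conjecture spans by all codes of the Type, the theorem by a list; `h` will select for each
  -- code a member of the list with the same words.
  Span-reindex : ∀ {i j} {I : Set i} {J : Set j} (M : Linear.Space K)
                 (x : I → LeftModule.Carrierᴹ M) (y : J → LeftModule.Carrierᴹ M) (h : I → J) →
                 (∀ i → LeftModule._≈ᴹ_ M (x i) (y (h i))) → ∀ {m} → Linear.Span K M x m → Linear.Span K M y m
  Span-reindex M x y h e (cs , m≈) = List.map (map₂ h) cs , M.≈ᴹ-trans m≈ (reindex cs)
    where
    module M = LeftModule M
    reindex : ∀ cs → Linear.combination K M x cs M.≈ᴹ Linear.combination K M y (List.map (map₂ h) cs)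
    reindex []             = M.≈ᴹ-refl
    reindex ((c , i) ∷ cs) = M.+ᴹ-cong (M.*ₗ-congˡ (e i)) (reindex cs)

  linearSum : {I : Set} → (I → Carrier) → List (Carrier × I) → Carrier
  linearSum g []             = 0#
  linearSum g ((c , i) ∷ cs) = c * g i + linearSum g cs

  -- A family Z of functionals separating the points of W suffices to recognise a linear combination of operators.
  End-span : ∀ (W : Linear.Space K) {I : Set} (y : I → Linear.LinearMap K W W) (T : Linear.LinearMap K W W) →
             {Z : Set} (ev : LeftModule.Carrierᴹ W → Z → Carrier) →
             (∀ a b → (∀ z → ev a z ≈ ev b z) → LeftModule._≈ᴹ_ W a b) →
             (∀ z → ev (LeftModule.0ᴹ W) z ≈ 0#) →
             (∀ c a b z → ev (LeftModule._+ᴹ_ W (LeftModule._*ₗ_ W c a) b) z ≈ c * ev a z + ev b z) →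
             (Q : I → Linear.LinearMap K W W → Set) (G : I → LeftModule.Carrierᴹ W → Z → Carrier) →
             (∀ i S → Q i S → ∀ u z → ev (S Linear.$$ u) z ≈ G i u z) →
             (∀ i → Q i (y i)) × (∃[ cs ] ∀ u z → ev (T Linear.$$ u) z ≈ linearSum (λ i → G i u z) cs) →
             Linear.Span K (Linear.End K W) y T
  End-span W y T ev separating ev-0 ev-linear Q G values (Qy , cs , e) = cs , λ u →
    separating (T Linear.$$ u) (Linear.combination K (Linear.End K W) y cs Linear.$$ u) (λ z → trans (e u z) (sym (evaluate cs u z)))
    where
    evaluate : ∀ cs u z → ev (Linear.combination K (Linear.End K W) y cs Linear.$$ u) z ≈ linearSum (λ i → G i u z) cs
    evaluate []             u z = ev-0 z
    evaluate ((c , i) ∷ cs) u z = trans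
      (ev-linear c (y i Linear.$$ u) (Linear.combination K (Linear.End K W) y cs Linear.$$ u) z)
      (+-cong (*-congˡ (values i (y i) (Qy i) u z)) (evaluate cs u z))

  -- `φ` is applied to a combination that represents the coefficients of `T`. The outcome is
  -- recorded through values at vectors, the form that `End-span` takes.
  φ-span : ∀ X {I : Set} (x : I → LeftModule.Carrierᴹ (Linear.Free K (X ×ᶠ X))) (T : Linear.LinearMap K (Linear.Free K X) (Linear.Free K X)) →
           Linear.Span K (Linear.Free K (X ×ᶠ X)) x (Matrices.coefficients K X T) →
           ∃[ cs ] ∀ u z → (T Linear.$$ u) ⟨$⟩ z ≈ linearSum (λ i → FiniteSums.Σ[_] commutativeSemiring X (λ y → (u ⟨$⟩ y) * (x i ⟨$⟩ (z , y)))) cs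
  φ-span X x T (cs , e) = cs , λ u z → trans (φ-coefficients X T u z) (trans
      (LinearMap.⟦⟧-cong (φ X) {coefficients X T} {combination (Free (X ×ᶠ X)) x cs} e u z) (φ-combination cs u z))
    where
    open Linear K
    open Matrices K
    φ-combination : ∀ cs u z → ((φ X $$ combination (Free (X ×ᶠ X)) x cs) $$ u) ⟨$⟩ z ≈
                    linearSum (λ i → FiniteSums.Σ[_] commutativeSemiring X (λ y → (u ⟨$⟩ y) * (x i ⟨$⟩ (z , y)))) cs
    φ-combination []             u z = IsLeftModuleHomomorphism.0ᴹ-homo (LinearMap.isHomomorphism (φ X)) u z
    φ-combination ((c , i) ∷ cs) u z = trans
      (LinearMap.+ᴹ-homo (φ X) (LeftModule._*ₗ_ (Free (X ×ᶠ X)) c (x i)) (combination (Free (X ×ᶠ X)) x cs) u z)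
      (+-cong (trans (LinearMap.*ₗ-homo (φ X) c (x i) u z) (*-congˡ (φ-apply X (x i) u z))) (φ-combination cs u z))

-- A signature mentions ComplexNumbers.ℂ-ring 𝒞 as such, whereas an argument of a lemma is the unfolded
-- Complex.ℂ-ring (ℝ 𝒞). Comparing operators over the two forms descends into their linearity proofs, which is
-- intractable; at-ℂ produces instances of lemmas in the first form.
at-ℂ : ∀ {ℓ} (𝒞 : ComplexNumbers) (P : CommutativeRing 0ℓ 0ℓ → Set ℓ) → (∀ K → P K) → P (ComplexNumbers.ℂ-ring 𝒞)
at-ℂ 𝒞 P h = h (ComplexNumbers.ℂ-ring 𝒞)

-- Fixed vectors and commuting operators

module _ (𝒞 : ComplexNumbers) {F : FormRing} (S : SymmetricIdempotents F) (ρ : FiniteRep F) (N : ℕ) where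
  open Linear (ComplexNumbers.ℂ-ring 𝒞)
  open Matrices (ComplexNumbers.ℂ-ring 𝒞)
  open TensorPowers (ComplexNumbers.ℂ-ring 𝒞)
  open SymmetricIdempotents S
  open FiniteRep ρ using (V; module V)
  private
    module ℂ = CommutativeRing (ComplexNumbers.ℂ-ring 𝒞)

  open GeneratorLifts (ComplexProperties.ℂ-scalars 𝒞)

  fwe-cong : ∀ (σ : FiniteRep F) (C D : Code σ) → Code._∈C C ≐ Code._∈C D → LeftModule._≈ᴹ_ (ℂV 𝒞 σ) (fwe 𝒞 σ C) (fwe 𝒞 σ D)
  fwe-cong σ C D (C⊆D , D⊆C) = sum-cong-≋ (λ k → agree (FiniteSet.enum Y k))
    where
    Y = FiniteModule.finiteSet (FiniteRep.V σ)
    open LeftModule (Free Y)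
    open Algebra.Properties.CommutativeMonoid.Sum +ᴹ-commutativeMonoid using (sum-cong-≋)
    agree : ∀ v → (if does (Code._∈C? C v) then basis Y v else 0ᴹ) ≈ᴹ (if does (Code._∈C? D v) then basis Y v else 0ᴹ)
    agree v with Code._∈C? C v | Code._∈C? D v
    ... | yes _  | yes _  = λ _ → ℂ.refl
    ... | no _   | no _   = λ _ → ℂ.refl
    ... | yes v∈ | no v∉  = contradiction (C⊆D v∈) v∉
    ... | no v∉  | yes v∈ = contradiction (D⊆C v∈) v∉

  opaque
    unfolding mOp

    m-op≈mOp : ∀ (σ : FiniteRep F) r f x → ((m-op 𝒞 {F} σ r $$ f) ⟨$⟩ x) ℂ.≈ ((mOp {F} σ r $$ f) ⟨$⟩ x)
    m-op≈mOp σ r f x = ℂ.refl {(m-op 𝒞 {F} σ r $$ f) ⟨$⟩ x}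

    d-op≈dOp : ∀ (σ : FiniteRep F) φ f x → ((d-op 𝒞 {F} σ φ $$ f) ⟨$⟩ x) ℂ.≈ ((dOp {F} σ φ $$ f) ⟨$⟩ x)
    d-op≈dOp σ φ f x = ℂ.refl {(d-op 𝒞 {F} σ φ $$ f) ⟨$⟩ x}

    h-op≈hOp : ∀ (σ : FiniteRep F) ι v f x → ((h-op 𝒞 {F} σ ι v $$ f) ⟨$⟩ x) ℂ.≈ ((hOp {F} σ ι v {Image 𝒞 {F} σ ι} (image? 𝒞 {F} σ ι) $$ f) ⟨$⟩ x)
    h-op≈hOp σ ι v f x = ℂ.refl {(h-op 𝒞 {F} σ ι v $$ f) ⟨$⟩ x}

  generator-m : ∀ r → IsUnit (FormRing.R F) r → ConjugationLift V.finiteSet N (mOp {F} ρ r) (mOp {F} (ρ ^⟨ N ,- N ⟩) r)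
  generator-m r r-unit = m-lift {F} ρ N r r-unit

  generator-d : ∀ φ → ConjugationLift V.finiteSet N (dOp {F} ρ φ) (dOp {F} (ρ ^⟨ N ,- N ⟩) φ)
  generator-d φ = d-lift {F} ρ N φ

  generator-h : ∀ i → ConjugationLift V.finiteSet N (hOp {F} ρ (ι i) (v i) {Image 𝒞 {F} ρ (ι i)} (image? 𝒞 {F} ρ (ι i)))
    (hOp {F} (ρ ^⟨ N ,- N ⟩) (ι i) (v i) {Image 𝒞 {F} (ρ ^⟨ N ,- N ⟩) (ι i)} (image? 𝒞 {F} (ρ ^⟨ N ,- N ⟩) (ι i)))
  generator-h i = h-lift {F} ρ N {ι i} {u i} {v i} (IsSymmetricIdempotent.idempotent (symmetric i)) (v∈ιᴶRι i) (uv≈ι i) (vu≈ιᴶ i)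
      {Image 𝒞 {F} ρ (ι i)} (image? 𝒞 {F} ρ (ι i)) id id {Image 𝒞 {F} (ρ ^⟨ N ,- N ⟩) (ι i)} (image? 𝒞 {F} (ρ ^⟨ N ,- N ⟩) (ι i)) id id

  module _ (f : LeftModule.Carrierᴹ (Free ((V.finiteSet ^ᶠ N) ×ᶠ (V.finiteSet ^ᶠ N)))) (T : LinearMap (Free (V.finiteSet ^ᶠ N)) (Free (V.finiteSet ^ᶠ N)))
           (T-matrix : ∀ u x → ((T $$ u) ⟨$⟩ x) ℂ.≈
              (FiniteSums.Σ[_] ℂ.commutativeSemiring (V.finiteSet ^ᶠ N) (λ y → (u ⟨$⟩ y) ℂ.* (f ⟨$⟩ (x , y))))) where

    -- Induction on the derivation of g. Each generator has a namesake with the same r, φ or ι in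
    -- the group of ρ^(N,N), to which the hypothesis applies; the other constructors preserve
    -- `Commutes`.
    fixed⇒commutes : Fixed 𝒞 {F} (ρ ^⟨ N ,- N ⟩) S f → ∀ g → CliffordWeil 𝒞 {F} ρ S g → Commutes V.finiteSet N T g
    fixed⇒commutes fixed _ (m-gen r r-unit) =
      Commutes-resp V.finiteSet N T (mOp {F} ρ r) (m-op 𝒞 {F} ρ r) (λ u x → ℂ.sym (m-op≈mOp ρ r u x))
        (lift-fixes⇒commutes V.finiteSet N f T T-matrix {mOp {F} ρ r} {mOp {F} (ρ ^⟨ N ,- N ⟩) r} (generator-m r r-unit)
          (λ x → ℂ.trans (ℂ.sym (m-op≈mOp (ρ ^⟨ N ,- N ⟩) r f x)) (fixed (m-op 𝒞 {F} (ρ ^⟨ N ,- N ⟩) r) (m-gen r r-unit) x)))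
    fixed⇒commutes fixed _ (d-gen φ) =
      Commutes-resp V.finiteSet N T (dOp {F} ρ φ) (d-op 𝒞 {F} ρ φ) (λ u x → ℂ.sym (d-op≈dOp ρ φ u x))
        (lift-fixes⇒commutes V.finiteSet N f T T-matrix {dOp {F} ρ φ} {dOp {F} (ρ ^⟨ N ,- N ⟩) φ} (generator-d φ)
          (λ x → ℂ.trans (ℂ.sym (d-op≈dOp (ρ ^⟨ N ,- N ⟩) φ f x)) (fixed (d-op 𝒞 {F} (ρ ^⟨ N ,- N ⟩) φ) (d-gen φ) x)))
    fixed⇒commutes fixed _ (h-gen i) =
      Commutes-resp V.finiteSet N T (hOp {F} ρ (ι i) (v i) {Image 𝒞 {F} ρ (ι i)} (image? 𝒞 {F} ρ (ι i))) (h-op 𝒞 {F} ρ (ι i) (v i)) (λ u x → ℂ.sym (h-op≈hOp ρ (ι i) (v i) u x))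
        (lift-fixes⇒commutes V.finiteSet N f T T-matrix {hOp {F} ρ (ι i) (v i) {Image 𝒞 {F} ρ (ι i)} (image? 𝒞 {F} ρ (ι i))}
          {hOp {F} (ρ ^⟨ N ,- N ⟩) (ι i) (v i) {Image 𝒞 {F} (ρ ^⟨ N ,- N ⟩) (ι i)} (image? 𝒞 {F} (ρ ^⟨ N ,- N ⟩) (ι i))} (generator-h i)
          (λ x → ℂ.trans (ℂ.sym (h-op≈hOp (ρ ^⟨ N ,- N ⟩) (ι i) (v i) f x)) (fixed (h-op 𝒞 {F} (ρ ^⟨ N ,- N ⟩) (ι i) (v i)) (h-gen i) x)))
    fixed⇒commutes fixed _ one              = Commutes-id V.finiteSet N T
    fixed⇒commutes fixed _ (mul {g} {h} c d) = Commutes-∘ V.finiteSet N T g h (fixed⇒commutes fixed g c) (fixed⇒commutes fixed h d)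
    fixed⇒commutes fixed _ (inv {g} {h} c gh≈1 hg≈1) = Commutes-inverse V.finiteSet N T g h gh≈1 hg≈1 (fixed⇒commutes fixed g c)
    fixed⇒commutes fixed _ (resp {g} {h} e c) = Commutes-resp V.finiteSet N T g h e (fixed⇒commutes fixed g c)

    -- The induction now runs over the group of ρ^(N,N), each of whose generators is the lift of a
    -- generator for ρ.
    commutes⇒fixed : (∀ g → CliffordWeil 𝒞 {F} ρ S g → Commutes V.finiteSet N T g) → Fixed 𝒞 {F} (ρ ^⟨ N ,- N ⟩) S f
    commutes⇒fixed commuting _ (m-gen r r-unit) x = ℂ.trans (m-op≈mOp (ρ ^⟨ N ,- N ⟩) r f x)
      (commutes⇒lift-fixes V.finiteSet N f T T-matrix {mOp {F} ρ r} {mOp {F} (ρ ^⟨ N ,- N ⟩) r} (generator-m r r-unit)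
        (Commutes-resp V.finiteSet N T (m-op 𝒞 {F} ρ r) (mOp {F} ρ r) (m-op≈mOp ρ r) (commuting (m-op 𝒞 {F} ρ r) (m-gen r r-unit))) x)
    commutes⇒fixed commuting _ (d-gen φ) x = ℂ.trans (d-op≈dOp (ρ ^⟨ N ,- N ⟩) φ f x)
      (commutes⇒lift-fixes V.finiteSet N f T T-matrix {dOp {F} ρ φ} {dOp {F} (ρ ^⟨ N ,- N ⟩) φ} (generator-d φ)
        (Commutes-resp V.finiteSet N T (d-op 𝒞 {F} ρ φ) (dOp {F} ρ φ) (d-op≈dOp ρ φ) (commuting (d-op 𝒞 {F} ρ φ) (d-gen φ))) x)
    commutes⇒fixed commuting _ (h-gen i) x = ℂ.trans (h-op≈hOp (ρ ^⟨ N ,- N ⟩) (ι i) (v i) f x)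
      (commutes⇒lift-fixes V.finiteSet N f T T-matrix {hOp {F} ρ (ι i) (v i) {Image 𝒞 {F} ρ (ι i)} (image? 𝒞 {F} ρ (ι i))}
          {hOp {F} (ρ ^⟨ N ,- N ⟩) (ι i) (v i) {Image 𝒞 {F} (ρ ^⟨ N ,- N ⟩) (ι i)} (image? 𝒞 {F} (ρ ^⟨ N ,- N ⟩) (ι i))} (generator-h i)
        (Commutes-resp V.finiteSet N T (h-op 𝒞 {F} ρ (ι i) (v i)) (hOp {F} ρ (ι i) (v i) {Image 𝒞 {F} ρ (ι i)} (image? 𝒞 {F} ρ (ι i)))
          (h-op≈hOp ρ (ι i) (v i)) (commuting (h-op 𝒞 {F} ρ (ι i) (v i)) (h-gen i))) x)
    commutes⇒fixed commuting _ one x = ℂ.refl {f ⟨$⟩ x}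
    commutes⇒fixed commuting _ (mul {g} {h} c d) = fixed-∘ (FiniteModule.finiteSet (FiniteRep.V (ρ ^⟨ N ,- N ⟩))) f g h (commutes⇒fixed commuting g c) (commutes⇒fixed commuting h d)
    commutes⇒fixed commuting _ (inv {g} {h} c _ hg≈1) = fixed-inverse (FiniteModule.finiteSet (FiniteRep.V (ρ ^⟨ N ,- N ⟩))) f g h hg≈1 (commutes⇒fixed commuting g c)
    commutes⇒fixed commuting _ (resp {g} {h} e c) = fixed-resp (FiniteModule.finiteSet (FiniteRep.V (ρ ^⟨ N ,- N ⟩))) f g h e (commutes⇒fixed commuting g c)

-- The endomorphisms attached to the weight enumerators

EndSpan : CommutativeRing 0ℓ 0ℓ → Set₁
EndSpan K = ∀ (W : Linear.Space K) {I : Set} (y : I → Linear.LinearMap K W W) (T : Linear.LinearMap K W W) →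
  {Z : Set} (ev : LeftModule.Carrierᴹ W → Z → CommutativeRing.Carrier K) →
  (∀ a b → (∀ z → CommutativeRing._≈_ K (ev a z) (ev b z)) → LeftModule._≈ᴹ_ W a b) →
  (∀ z → CommutativeRing._≈_ K (ev (LeftModule.0ᴹ W) z) (CommutativeRing.0# K)) →
  (∀ c a b z → CommutativeRing._≈_ K (ev (LeftModule._+ᴹ_ W (LeftModule._*ₗ_ W c a) b) z) (CommutativeRing._+_ K (CommutativeRing._*_ K c (ev a z)) (ev b z))) →
  (Q : I → Linear.LinearMap K W W → Set) (G : I → LeftModule.Carrierᴹ W → Z → CommutativeRing.Carrier K) →
  (∀ i S → Q i S → ∀ u z → CommutativeRing._≈_ K (ev (S Linear.$$ u) z) (G i u z)) →
  (∀ i → Q i (y i)) × (∃[ cs ] ∀ u z → CommutativeRing._≈_ K (ev (T Linear.$$ u) z) (linearSum K (λ i → G i u z) cs)) →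
  Linear.Span K (Linear.End K W) y T

φ-Apply : CommutativeRing 0ℓ 0ℓ → Set₁
φ-Apply K = ∀ X (f : LeftModule.Carrierᴹ (Linear.Free K (X ×ᶠ X))) u z → CommutativeRing._≈_ K ((Linear.φ K X Linear.$$ f) Linear.$$ u ⟨$⟩ z)
  (FiniteSums.Σ[_] (CommutativeRing.commutativeSemiring K) X (λ y → CommutativeRing._*_ K (u ⟨$⟩ y) (f ⟨$⟩ (z , y))))

-- A datatype rather than a function, so that only T and not its values are compared.
data Represents (𝒞 : ComplexNumbers) (X : FiniteSet) (f : LeftModule.Carrierᴹ (Linear.Free (ComplexNumbers.ℂ-ring 𝒞) (X ×ᶠ X)))
                (T : Linear.LinearMap (ComplexNumbers.ℂ-ring 𝒞) (Linear.Free (ComplexNumbers.ℂ-ring 𝒞) X) (Linear.Free (ComplexNumbers.ℂ-ring 𝒞) X)) : Set where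
  represents : (∀ u z → CommutativeRing._≈_ (ComplexNumbers.ℂ-ring 𝒞) ((T Linear.$$ u) ⟨$⟩ z)
    (FiniteSums.Σ[_] (CommutativeRing.commutativeSemiring (ComplexNumbers.ℂ-ring 𝒞)) X (λ y → CommutativeRing._*_ (ComplexNumbers.ℂ-ring 𝒞) (u ⟨$⟩ y) (f ⟨$⟩ (z , y))))) → Represents 𝒞 X f T

values : ∀ 𝒞 X f T → Represents 𝒞 X f T → ∀ u z → CommutativeRing._≈_ (ComplexNumbers.ℂ-ring 𝒞) ((T Linear.$$ u) ⟨$⟩ z)
    (FiniteSums.Σ[_] (CommutativeRing.commutativeSemiring (ComplexNumbers.ℂ-ring 𝒞)) X (λ y → CommutativeRing._*_ (ComplexNumbers.ℂ-ring 𝒞) (u ⟨$⟩ y) (f ⟨$⟩ (z , y))))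
values 𝒞 X f T (represents e) = e

φ-apply-ℂ : ∀ 𝒞 X f u z → CommutativeRing._≈_ (ComplexNumbers.ℂ-ring 𝒞) ((Linear.φ (ComplexNumbers.ℂ-ring 𝒞) X Linear.$$ f) Linear.$$ u ⟨$⟩ z)
    (FiniteSums.Σ[_] (CommutativeRing.commutativeSemiring (ComplexNumbers.ℂ-ring 𝒞)) X (λ y → CommutativeRing._*_ (ComplexNumbers.ℂ-ring 𝒞) (u ⟨$⟩ y) (f ⟨$⟩ (z , y))))
φ-apply-ℂ 𝒞 = at-ℂ 𝒞 φ-Apply (λ K X → Matrices.φ-apply K X)

φ-represents : ∀ 𝒞 X f → Represents 𝒞 X f (Linear.φ (ComplexNumbers.ℂ-ring 𝒞) X Linear.$$ f)
φ-represents 𝒞 X f = represents (φ-apply-ℂ 𝒞 X f)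

module _ (𝒞 : ComplexNumbers) {F : FormRing} (S : SymmetricIdempotents F)
         (conjecture : WeightEnumeratorConjecture 𝒞 F S) (ρ : FiniteRep F) (N : ℕ)
         {t : ℕ} (C : Fin t → Code (ρ ^⟨ N ,- N ⟩)) (C-complete : IsCompleteList (ρ ^⟨ N ,- N ⟩) C) where

  -- The underlying set of ρ^(N,N) is by construction the square of V^N, so the coefficients of `T`
  -- form a vector on which the group of ρ^(N,N) acts. It is fixed because `T` commutes, and the
  -- spanning half of the conjecture applies.
  coefficients-span : ∀ (T : Linear.LinearMap (ComplexNumbers.ℂ-ring 𝒞)
       (Linear.Free (ComplexNumbers.ℂ-ring 𝒞) (FiniteModule.finiteSet (FiniteRep.V ρ) ^ᶠ N))
       (Linear.Free (ComplexNumbers.ℂ-ring 𝒞) (FiniteModule.finiteSet (FiniteRep.V ρ) ^ᶠ N))) →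
    Commuting 𝒞 {F} ρ S N T →
    Linear.Span (ComplexNumbers.ℂ-ring 𝒞)
      (Linear.Free (ComplexNumbers.ℂ-ring 𝒞) ((FiniteModule.finiteSet (FiniteRep.V ρ) ^ᶠ N) ×ᶠ (FiniteModule.finiteSet (FiniteRep.V ρ) ^ᶠ N)))
      (λ i → fwe 𝒞 {F} (ρ ^⟨ N ,- N ⟩) (C i))
      (Matrices.coefficients (ComplexNumbers.ℂ-ring 𝒞) (FiniteModule.finiteSet (FiniteRep.V ρ) ^ᶠ N) T)
  coefficients-span T T-commuting = Span-reindex (ComplexNumbers.ℂ-ring 𝒞)
    {I = Σ (Code (ρ ^⟨ N ,- N ⟩)) (OfType (ρ ^⟨ N ,- N ⟩))} {J = Fin t} (ℂV 𝒞 {F} (ρ ^⟨ N ,- N ⟩))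
    (λ (D , _) → fwe 𝒞 {F} (ρ ^⟨ N ,- N ⟩) D) (λ i → fwe 𝒞 {F} (ρ ^⟨ N ,- N ⟩) (C i))
    (λ (D , D-type) → proj₁ (proj₂ C-complete D D-type))
    (λ (D , D-type) → fwe-cong 𝒞 S ρ N (ρ ^⟨ N ,- N ⟩) D (C (proj₁ (proj₂ C-complete D D-type)))
      (proj₂ (proj₂ C-complete D D-type)))
    {Matrices.coefficients (ComplexNumbers.ℂ-ring 𝒞) (FiniteModule.finiteSet (FiniteRep.V ρ) ^ᶠ N) T}
    (proj₂ (conjecture (ρ ^⟨ N ,- N ⟩)) (Matrices.coefficients (ComplexNumbers.ℂ-ring 𝒞) (FiniteModule.finiteSet (FiniteRep.V ρ) ^ᶠ N) T)
      (commutes⇒fixed 𝒞 {F} S ρ N (Matrices.coefficients (ComplexNumbers.ℂ-ring 𝒞) (FiniteModule.finiteSet (FiniteRep.V ρ) ^ᶠ N) T) T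
        (Matrices.matrix-apply (ComplexNumbers.ℂ-ring 𝒞) (FiniteModule.finiteSet (FiniteRep.V ρ) ^ᶠ N) (FiniteModule.finiteSet (FiniteRep.V ρ) ^ᶠ N) T)
        T-commuting))

  -- The other half of the conjecture enters: weight enumerators of codes of the Type are fixed
  -- vectors.
  represents⇒commuting : ∀ i T → Represents 𝒞 (FiniteModule.finiteSet (FiniteRep.V ρ) ^ᶠ N) (fwe 𝒞 {F} (ρ ^⟨ N ,- N ⟩) (C i)) T →
                         Commuting 𝒞 {F} ρ S N T
  represents⇒commuting i T r = fixed⇒commutes 𝒞 {F} S ρ N (fwe 𝒞 {F} (ρ ^⟨ N ,- N ⟩) (C i)) T
    (values 𝒞 (FiniteModule.finiteSet (FiniteRep.V ρ) ^ᶠ N) (fwe 𝒞 {F} (ρ ^⟨ N ,- N ⟩) (C i)) T r)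
    (proj₁ (conjecture (ρ ^⟨ N ,- N ⟩)) (C i , proj₁ C-complete i))

  fwe-span : ∀ (T : Linear.LinearMap (ComplexNumbers.ℂ-ring 𝒞)
       (Linear.Free (ComplexNumbers.ℂ-ring 𝒞) (FiniteModule.finiteSet (FiniteRep.V ρ) ^ᶠ N))
       (Linear.Free (ComplexNumbers.ℂ-ring 𝒞) (FiniteModule.finiteSet (FiniteRep.V ρ) ^ᶠ N))) →
    Commuting 𝒞 {F} ρ S N T →
    ∃[ cs ] ∀ u z → CommutativeRing._≈_ (ComplexNumbers.ℂ-ring 𝒞) ((T Linear.$$ u) ⟨$⟩ z)
      (linearSum (ComplexNumbers.ℂ-ring 𝒞) (λ i → FiniteSums.Σ[_] (CommutativeRing.commutativeSemiring (ComplexNumbers.ℂ-ring 𝒞))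
        (FiniteModule.finiteSet (FiniteRep.V ρ) ^ᶠ N) (λ y → CommutativeRing._*_ (ComplexNumbers.ℂ-ring 𝒞) (u ⟨$⟩ y) (fwe 𝒞 {F} (ρ ^⟨ N ,- N ⟩) (C i) ⟨$⟩ (z , y)))) cs)
  fwe-span T T-commuting = φ-span (ComplexNumbers.ℂ-ring 𝒞)
    (FiniteModule.finiteSet (FiniteRep.V ρ) ^ᶠ N) (λ i → fwe 𝒞 {F} (ρ ^⟨ N ,- N ⟩) (C i)) T (coefficients-span T T-commuting)

theorem8p1 :
    (𝒞 : ComplexNumbers) (F : FormRing) (S : SymmetricIdempotents F) →
    WeightEnumeratorConjecture 𝒞 F S →
    (ρ : FiniteRep F) (N : ℕ) → 1 ≤ N →
    (t : ℕ) (C : Fin t → Code (ρ ^⟨ N ,- N ⟩)) → IsCompleteList (ρ ^⟨ N ,- N ⟩) C →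
    let open Linear (ComplexNumbers.ℂ-ring 𝒞)
        Vᴺ = FiniteModule.finiteSet (FiniteRep.V ρ) ^ᶠ N
    in Generates (End (Free Vᴺ))
         (λ i → φ Vᴺ $$ fwe 𝒞 (ρ ^⟨ N ,- N ⟩) (C i))
         (Commuting 𝒞 ρ S N)
theorem8p1 𝒞 F S conjecture ρ N _ t C C-complete =
    (λ i → represents⇒commuting 𝒞 {F} S conjecture ρ N C C-complete i _
      (φ-represents 𝒞 (FiniteModule.finiteSet (FiniteRep.V ρ) ^ᶠ N) (fwe 𝒞 {F} (ρ ^⟨ N ,- N ⟩) (C i))))
  -- The separating functionals are the coordinates z in V^N, and `Represents` is the property that
  -- determines the values of each φ(fwe).
  , λ T T-commuting → at-ℂ 𝒞 EndSpan End-span _ _ T {Fin N → FiniteRep.V.Carrierᴹ ρ} (λ f z → f ⟨$⟩ z) (λ _ _ e → e)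
      (λ _ → CommutativeRing.refl (ComplexNumbers.ℂ-ring 𝒞)) (λ _ _ _ _ → CommutativeRing.refl (ComplexNumbers.ℂ-ring 𝒞))
      (λ i → Represents 𝒞 (FiniteModule.finiteSet (FiniteRep.V ρ) ^ᶠ N) (fwe 𝒞 {F} (ρ ^⟨ N ,- N ⟩) (C i)))
      (λ i u z → FiniteSums.Σ[_] (CommutativeRing.commutativeSemiring (ComplexNumbers.ℂ-ring 𝒞))
        (FiniteModule.finiteSet (FiniteRep.V ρ) ^ᶠ N) (λ y → CommutativeRing._*_ (ComplexNumbers.ℂ-ring 𝒞) (u ⟨$⟩ y) (fwe 𝒞 {F} (ρ ^⟨ N ,- N ⟩) (C i) ⟨$⟩ (z , y))))
      (λ i → values 𝒞 (FiniteModule.finiteSet (FiniteRep.V ρ) ^ᶠ N) (fwe 𝒞 {F} (ρ ^⟨ N ,- N ⟩) (C i)))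
      $′ ((λ i → φ-represents 𝒞 (FiniteModule.finiteSet (FiniteRep.V ρ) ^ᶠ N) (fwe 𝒞 {F} (ρ ^⟨ N ,- N ⟩) (C i)))
        , fwe-span 𝒞 {F} S conjecture ρ N C C-complete T T-commuting)
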